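{- Let $m\ge2$ and $k\ge 3$ be integers. For $3\le l\le k$ let $\mathcal{UC}(l;k)$ be the collection of connected linear $m$-uniform unicyclic hypergraphs in $\mathcal{P}(\mathcal{H})$ with $k$ edges whose cycle has length $l$, and let $UC^*_l\in\mathcal{UC}(l;k)$ be such that $\lambda_1(UC^*_l)=\max\{\lambda_1(\mathcal{H})\mid \mathcal{H}\in\mathcal{UC}(l;k)\}$. Then: (i) $UC^*_l=UC_l(c_1=k-l)$, and $\lambda_1(U)<\lambda_1(UC_l(c_1=k-l))$ for every other $U\in\mathcal{UC}(l;k)$. (ii) $\dfrac{m-1+\sqrt{m^2+6m-7}}{2m-2}\le\lambda_1(UC^*_l)$ for all $3\le l\le k$, with equality only when $UC^*_l=C_L(k)$; and $\lambda_1(UC^*_l)<\lambda_1(UC^*_{l-1})$ for all $4\le l\le k$. (iii) $\dfrac{m-2+\sqrt{(m-2)^2+4(k-l+2)(m-1)}}{2(m-1)}<\lambda_1(UC_l(c_1=k-l))<\dfrac{m+\sqrt{m^2+4(k-l+2)(m-1)}}{2(m-1)}.$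
   Context: A hypergraph has a finite vertex set and an edge set of non-empty subsets of the vertex set; it is $m$-uniform if all edges have cardinality $m$, and linear if two distinct edges share at most one vertex. The adjacency matrix of a linear $m$-uniform hypergraph $\mathcal{H}$ has $(i,j)$ entry $\frac{1}{m-1}$ if $i\ne j$ lie in a common edge, and $0$ otherwise; $\lambda_1(\mathcal{H})$ denotes its spectral radius. The $m$-th power hypergraph of a graph $G(V,E)$ is the $m$-uniform hypergraph obtained by adding to each edge $e\in E$ $m-2$ new vertices $v_{e,1},\dots,v_{e,m-2}$ (distinct for distinct edges). $\mathcal{P}(\mathcal{H})$ denotes the set of $m$-th power hypergraphs of graphs. A loose cycle of length $l\ge3$, $C_L(l)=v_1e_1v_2e_2\dots v_le_lv_1$, is the $m$-uniform hypergraph with edges $e_1,\dots,e_l$ in which $e_{i-1}\cap e_i=\{v_i\}$ (indices mod $l$, the $v_i$ distinct) and non-consecutive edges are disjoint; $v_1,\dots,v_l$ are its core vertices. A linear hypergraph is unicyclic if it contains exactly one loose cycle. Attaching a pendant edge at a vertex $v$ means adding a new edge consisting of $v$ and $m-1$ new vertices. $UC_l(c_1,\dots,c_l)$ is obtained from $C_L(l)$ by attaching $c_i$ pendant edges at $v_i$ for $i=1,\dots,l$; when only some of the $c_i$ are listed, the others are $0$. Equality of hypergraphs means isomorphism. -}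

module Defs where

open import Algebra.Bundles using (CommutativeRing)
import Algebra.Properties.Semiring.Mult as Mult
import Algebra.Properties.Semiring.Sum as Sum
open import Data.Bool.Base using (if_then_else_)
open import Data.Fin.Base using (Fin; zero; suc; toℕ; fromℕ<; _↑ˡ_)
open import Data.Fin.Properties using (_≟_; any?; toℕ<n; toℕ-fromℕ<)
open import Data.Fin.Subset
  using (Subset; _∈_; _∩_; _∪_; ⁅_⁆; ⊤; ⊥; ∣_∣; Nonempty; Empty)
open import Data.Fin.Subset.Properties
  using (_∈?_; x∈⁅x⁆; x∈⁅y⁆⇒x≡y; x∈p∪q⁺; x∈p∪q⁻)
open import Data.Nat.Base as ℕ using (ℕ; zero; suc; _∸_; s≤s; z≤n)
import Data.Nat.Properties as ℕ
open import Data.Nat.DivMod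
  using (_%_; _mod_; m<n⇒m%n≡m; n%n≡0)
open import Data.Product.Base using (Σ; ∃; ∃-syntax; _×_; _,_)
open import Data.Sum.Base using (_⊎_; inj₁; inj₂)
open import Data.Vec.Base using (_++_; concat; tabulate; here; there)
open import Data.Vec.Properties using (++-injectiveˡ; ++-injectiveʳ)
open import Data.Vec.Functional using (Vector)
open import Function.Bundles using (_↔_; _⇔_; Inverse)
open import Function.Definitions using (Injective)
open import Level using (0ℓ)
open import Relation.Binary.Construct.Closure.ReflexiveTransitive using (Star)
import Relation.Binary.Construct.StrictToNonStrict as StrictToNonStrict
open import Relation.Binary.Core using (Rel)
open import Relation.Binary.PropositionalEquality
  using (_≡_; _≢_; refl; sym; trans; cong; subst)
open import Relation.Binary.Structures using (IsStrictTotalOrder)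
open import Relation.Nullary using (¬_; contradiction)
open import Relation.Nullary.Decidable using (does; _×-dec_; ¬?)
open import Relation.Unary using (Pred; Satisfiable)

-- ℝ is any complete ordered field; classically there is exactly one up to
-- isomorphism. The strict order is trichotomous and suprema are
-- approximated by elements, so the structure is the classical one (it
-- proves excluded middle for Set). As usual for total operators, `0# ⁻¹`
-- and `⋁ S` for S empty or unbounded are unspecified.

record CompleteOrderedField : Set₁ where
  infix  4 _<_
  infix  8 _⁻¹
  infixl 7 _÷_
  field
    commutativeRing : CommutativeRing 0ℓ 0ℓ

  open CommutativeRing commutativeRing public
    using (_≈_; _≉_; _+_; _*_; -_; _-_; 0#; 1#; semiring)
    renaming (Carrier to ℝ)

  field
    _<_                : Rel ℝ 0ℓ
    isStrictTotalOrder : IsStrictTotalOrder _≈_ _<_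
    0<1                : 0# < 1#
    +-monoˡ-<          : ∀ z {x y} → x < y → x + z < y + z
    *-pos              : ∀ {x y} → 0# < x → 0# < y → 0# < x * y
    _⁻¹                : ℝ → ℝ
    ⁻¹-inverseʳ        : ∀ {x} → x ≉ 0# → x * x ⁻¹ ≈ 1#

  open StrictToNonStrict _≈_ _<_ public using (_≤_)

  BoundedAbove : Pred (Pred ℝ 0ℓ) 0ℓ
  BoundedAbove S = ∃[ b ] (∀ {x} → S x → x ≤ b)

  IsSupremum : Pred ℝ 0ℓ → Pred ℝ 0ℓ
  IsSupremum S s = (∀ {x} → S x → x ≤ s)
                 × (∀ {y} → y < s → ∃[ x ] S x × y < x)

  field
    ⋁            : Pred ℝ 0ℓ → ℝ
    ⋁-isSupremum : ∀ {S} → Satisfiable S → BoundedAbove S → IsSupremum S (⋁ S)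

  _÷_ : ℝ → ℝ → ℝ
  x ÷ y = x * y ⁻¹

  private module ×ℝ = Mult semiring

  ι : ℕ → ℝ
  ι n = n ×ℝ.× 1#

  √ : ℝ → ℝ
  √ x = ⋁ (λ s → s * s ≤ x)

  open Sum semiring public using (sum)

-- The edge set is a set: edge-injective excludes repeated edges.

record Hypergraph : Set where
  field
    order          : ℕ
    size           : ℕ
    edge           : Fin size → Subset order
    edge-nonempty  : ∀ e → Nonempty (edge e)
    edge-injective : Injective _≡_ _≡_ edge

open Hypergraph public

infix 4 _≅_

record _≅_ (H H′ : Hypergraph) : Set where
  field
    vertices  : Fin (order H) ↔ Fin (order H′)
    edges     : Fin (size H) ↔ Fin (size H′)
    incidence : ∀ v e → v ∈ edge H e ⇔
                        Inverse.to vertices v ∈ edge H′ (Inverse.to edges e)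

Uniform : ℕ → Pred Hypergraph 0ℓ
Uniform m H = ∀ e → ∣ edge H e ∣ ≡ m

Linear : Pred Hypergraph 0ℓ
Linear H = ∀ {e f} → e ≢ f → ∣ edge H e ∩ edge H f ∣ ℕ.≤ 1

Connected : Pred Hypergraph 0ℓ
Connected H = ∀ u v → Star (λ x y → ∃[ e ] x ∈ edge H e × y ∈ edge H e) u v

next : ∀ {l} → Fin l → Fin l
next {suc n} i = suc (toℕ i) mod suc n

record LooseCycle (H : Hypergraph) (l : ℕ) : Set where
  field
    length≥3     : 3 ℕ.≤ l
    v            : Fin l → Fin (order H)
    e            : Fin l → Fin (size H)
    v-injective  : Injective _≡_ _≡_ v
    e-injective  : Injective _≡_ _≡_ e
    consecutive  : ∀ i → edge H (e i) ∩ edge H (e (next i)) ≡ ⁅ v (next i) ⁆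
    disjoint     : ∀ {i j} → i ≢ j → j ≢ next i → i ≢ next j →
                   Empty (edge H (e i) ∩ edge H (e j))

-- A loose cycle, as a subhypergraph, is determined by its set of edges; the
-- choice of starting point and orientation is immaterial.
SameCycle : ∀ {H l l′} → LooseCycle H l → LooseCycle H l′ → Set
SameCycle C C′ = ∀ f → (∃[ i ] LooseCycle.e C i ≡ f) ⇔ (∃[ j ] LooseCycle.e C′ j ≡ f)

UnicyclicOfLength : ℕ → Pred Hypergraph 0ℓ
UnicyclicOfLength l H =
  Σ (LooseCycle H l) λ C → ∀ {l′} (C′ : LooseCycle H l′) → SameCycle C C′

private
  ∈-++ˡ : ∀ {n k} {x : Fin n} {p : Subset n} {q : Subset k} →
          x ∈ p → x ↑ˡ k ∈ p ++ q
  ∈-++ˡ here        = here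
  ∈-++ˡ (there x∈p) = there (∈-++ˡ x∈p)

-- The e-th of k consecutive blocks of r elements.
block : ∀ {k} r → Fin k → Subset (k ℕ.* r)
block r e = concat (tabulate λ f → if does (e ≟ f) then ⊤ else ⊥)

-- Vertex set: the old vertices followed by one block of m ∸ 2 new vertices
-- for each edge.
power : ℕ → Hypergraph → Hypergraph
power m G = record
  { order          = order G ℕ.+ size G ℕ.* (m ∸ 2)
  ; size           = size G
  ; edge           = λ e → edge G e ++ block (m ∸ 2) e
  ; edge-nonempty  = λ e → let (x , x∈e) = edge-nonempty G e in
                           x ↑ˡ _ , ∈-++ˡ x∈e
  ; edge-injective = λ {e} {f} eq →
                     edge-injective G (++-injectiveˡ (edge G e) (edge G f) eq)
  }
-- A (finite simple) graph is a 2-uniform hypergraph.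
InPowers : ℕ → Pred Hypergraph 0ℓ
InPowers m H = ∃[ G ] Uniform 2 G × H ≅ power m G

private
  toℕ-next-< : ∀ {n} (i : Fin (suc n)) → suc (toℕ i) ℕ.< suc n →
               toℕ (next i) ≡ suc (toℕ i)
  toℕ-next-< i i<n = trans (toℕ-fromℕ< _) (m<n⇒m%n≡m i<n)

  toℕ-next-≡ : ∀ {n} (i : Fin (suc n)) → suc (toℕ i) ≡ suc n → toℕ (next i) ≡ 0
  toℕ-next-≡ {n} i i≡n =
    trans (toℕ-fromℕ< _) (trans (cong (_% suc n) i≡n) (n%n≡0 (suc n)))

  next-cases : ∀ {n} (i : Fin (suc n)) →
               toℕ (next i) ≡ suc (toℕ i) ⊎ (toℕ i ≡ n × toℕ (next i) ≡ 0)
  next-cases i with ℕ.m≤n⇒m<n∨m≡n (toℕ<n i)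
  ... | inj₁ i<n = inj₁ (toℕ-next-< i i<n)
  ... | inj₂ i≡n = inj₂ (ℕ.suc-injective i≡n , toℕ-next-≡ i i≡n)

  next-next≢ : ∀ {l} → 3 ℕ.≤ l → (i : Fin l) → next (next i) ≢ i
  next-next≢ {suc n} (s≤s 2≤n) i eq with next-cases i | next-cases (next i)
  ... | inj₁ a       | inj₁ b       =
    ℕ.<⇒≢ (ℕ.m<n⇒m<1+n (ℕ.n<1+n _)) (trans (sym (cong toℕ eq)) (trans b (cong suc a)))
  ... | inj₁ a       | inj₂ (c , d) =
    contradiction 2≤n (ℕ.<⇒≱ (s≤s (ℕ.≤-reflexive
      (trans (sym c) (trans a (cong suc (trans (sym (cong toℕ eq)) d)))))))
  ... | inj₂ (a , b) | inj₁ c       =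
    contradiction 2≤n (ℕ.<⇒≱ (s≤s (ℕ.≤-reflexive
      (trans (sym a) (trans (sym (cong toℕ eq)) (trans c (cong suc b)))))))
  ... | inj₂ (a , b) | inj₂ (c , d) =
    contradiction 2≤n (ℕ.<⇒≱ (s≤s (ℕ.≤-trans (ℕ.≤-reflexive (trans (sym c) b)) z≤n)))

cycleGraph : ∀ {l} → 3 ℕ.≤ l → Hypergraph
cycleGraph {l} l≥3 = record
  { order          = l
  ; size           = l
  ; edge           = pair
  ; edge-nonempty  = λ i → i , i∈pair i
  ; edge-injective = pair-injective
  }
  where
  pair : Fin l → Subset l
  pair i = ⁅ i ⁆ ∪ ⁅ next i ⁆

  i∈pair : ∀ i → i ∈ pair i
  i∈pair i = x∈p∪q⁺ {p = ⁅ i ⁆} (inj₁ (x∈⁅x⁆ i))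

  ∈pair : ∀ {i} j → i ∈ pair j → i ≡ j ⊎ i ≡ next j
  ∈pair j i∈ with x∈p∪q⁻ ⁅ j ⁆ ⁅ next j ⁆ i∈
  ... | inj₁ p = inj₁ (x∈⁅y⁆⇒x≡y j p)
  ... | inj₂ p = inj₂ (x∈⁅y⁆⇒x≡y (next j) p)

  pair-injective : Injective _≡_ _≡_ pair
  pair-injective {i} {j} eq
    with ∈pair j (subst (i ∈_) eq (i∈pair i)) | ∈pair i (subst (j ∈_) (sym eq) (i∈pair j))
  ... | inj₁ i≡j  | _         = i≡j
  ... | inj₂ _    | inj₁ j≡i  = sym j≡i
  ... | inj₂ i≡j⁺ | inj₂ j≡i⁺ =
    contradiction (trans (cong next (sym j≡i⁺)) (sym i≡j⁺)) (next-next≢ l≥3 i)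

-- Core vertices are the first l vertices; the i-th edge consists of v_i,
-- v_{i+1} and its own m ∸ 2 further vertices.
C_L : ∀ m {l} → 3 ℕ.≤ l → Hypergraph
C_L m l≥3 = power m (cycleGraph l≥3)

-- The new edge consists of v and m ∸ 1 new vertices.
attachPendant : ∀ {m} → 2 ℕ.≤ m → (H : Hypergraph) → Fin (order H) → Hypergraph
attachPendant {m} m≥2 H v = record
  { order          = order H ℕ.+ (m ∸ 1)
  ; size           = suc (size H)
  ; edge           = newEdge
  ; edge-nonempty  = nonempty
  ; edge-injective = injective
  }
  where
  newEdge : Fin (suc (size H)) → Subset (order H ℕ.+ (m ∸ 1))
  newEdge zero    = ⁅ v ⁆ ++ ⊤
  newEdge (suc e) = edge H e ++ ⊥

  nonempty : ∀ e → Nonempty (newEdge e)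
  nonempty zero    = v ↑ˡ _ , ∈-++ˡ (x∈⁅x⁆ v)
  nonempty (suc e) = let (x , x∈e) = edge-nonempty H e in x ↑ˡ _ , ∈-++ˡ x∈e

  ⊤≢⊥ : ∀ {m} → 2 ℕ.≤ m → ⊤ {m ∸ 1} ≢ ⊥
  ⊤≢⊥ (s≤s (s≤s _)) ()

  injective : Injective _≡_ _≡_ newEdge
  injective {zero}  {zero}  _  = refl
  injective {zero}  {suc f} eq =
    contradiction (++-injectiveʳ ⁅ v ⁆ (edge H f) eq) (⊤≢⊥ m≥2)
  injective {suc e} {zero}  eq =
    contradiction (sym (++-injectiveʳ (edge H e) ⁅ v ⁆ eq)) (⊤≢⊥ m≥2)
  injective {suc e} {suc f} eq =
    cong suc (edge-injective H (++-injectiveˡ (edge H e) (edge H f) eq))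

attachPendants : ∀ {m} → 2 ℕ.≤ m → (H : Hypergraph) → Fin (order H) → ℕ → Hypergraph
attachPendants         m≥2 H v zero    = H
attachPendants {m = m} m≥2 H v (suc c) =
  attachPendants m≥2 (attachPendant m≥2 H v) (v ↑ˡ (m ∸ 1)) c

-- UC_l(c₁ = c), all other c_i being 0; v₁ is the vertex 0.
UC₁ : ∀ {m l} → 2 ℕ.≤ m → 3 ℕ.≤ l → ℕ → Hypergraph
UC₁ {m} {l} m≥2 l≥3 c = attachPendants m≥2 (C_L m l≥3) v₁ c
  where
  v₁ : Fin (order (C_L m l≥3))
  v₁ = fromℕ< (ℕ.≤-trans (s≤s z≤n) l≥3) ↑ˡ _

record InUC (m l k : ℕ) (H : Hypergraph) : Set where
  field
    connected : Connected H
    linear    : Linear H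
    uniform   : Uniform m H
    unicyclic : UnicyclicOfLength l H
    inPowers  : InPowers m H
    size≡k    : size H ≡ k

module Spectral (R : CompleteOrderedField) where
  open CompleteOrderedField R

  Matrix : ℕ → Set
  Matrix n = Fin n → Vector ℝ n

  adjacency : ℕ → (H : Hypergraph) → Matrix (order H)
  adjacency m H i j =
    if does (¬? (i ≟ j) ×-dec any? λ e → (i ∈? edge H e) ×-dec (j ∈? edge H e))
    then (ι m - 1#) ⁻¹
    else 0#

  -- a + bi is an eigenvalue of A, with eigenvector x + yi ≠ 0: the real and
  -- imaginary parts of A (x + yi) = (a + bi)(x + yi).
  IsEigenvalue : ∀ {n} → Matrix n → ℝ → ℝ → Set
  IsEigenvalue {n} A a b =
    Σ (Vector ℝ n) λ x → Σ (Vector ℝ n) λ y →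
      (∃[ i ] ¬ (x i ≈ 0# × y i ≈ 0#))
    × (∀ i → sum (λ j → A i j * x j) ≈ a * x i - b * y i)
    × (∀ i → sum (λ j → A i j * y j) ≈ a * y i + b * x i)

  -- The supremum of the moduli of the complex eigenvalues.
  spectralRadius : ∀ {n} → Matrix n → ℝ
  spectralRadius A =
    ⋁ (λ r → 0# ≤ r × ∃[ a ] ∃[ b ] (r * r ≈ a * a + b * b) × IsEigenvalue A a b)

  λ₁ : ℕ → Hypergraph → ℝ
  λ₁ m H = spectralRadius (adjacency m H)

  -- H is a possible choice of UC*_l.
  IsMaximal : (m l k : ℕ) → Hypergraph → Set
  IsMaximal m l k H = InUC m l k H × (∀ U → InUC m l k U → λ₁ m U ≤ λ₁ m H)

{-# OPTIONS --safe #-}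
module Submission where

-- A graph G determines the m-th power H, and m - 1 times the adjacency operator of H has the
-- quadratic form Σₑ ((Σ_{i∈e} xᵢ)² - Σ_{i∈e} xᵢ²).  Let x be the Perron vector of a unicyclic H
-- and u a vertex of G at which x is largest.  Every edge of G off the cycle is a bridge; keep its
-- end away from u and replace the other end by u, and let u take the place of the vertex of the
-- cycle nearest to it.  This single step turns H into UC_l(c₁ = k - l) and replaces in some edges
-- a vertex p by u, where x_p ≤ x_u, so the form does not decrease at x; if some edge changes, the
-- new row at u is too large for x to be an eigenvector, so the spectral radius grows strictly.
-- Replacing the cycle edge {v₂ , v₃} by {u , v₃} as well gives UC_{l-1}(c₁ = k - l + 1), hence
-- the monotonicity in l.  The numerical bounds come from explicit sub- and supersolutions.
--
-- The Perron vector is found without spectral theory: if ρ is the supremum of the Rayleigh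
-- quotients, then ρ I - A is positive semidefinite, and completing squares shows that such a
-- form either dominates ε |x|² for some ε > 0 or vanishes at some x ≠ 0; the former contradicts
-- the choice of ρ.

open import Defs
open import Algebra.Bundles using (CommutativeRing; RawRing)
import Algebra.Properties.AbelianGroup as GroupProperties
import Algebra.Properties.Ring as RingProperties
import Algebra.Properties.Semiring.Mult as Mult
import Algebra.Properties.Semiring.Mult.TCOptimised as Mult′
import Algebra.Properties.Semiring.Sum as Sum′
import Algebra.Solver.Ring as RingSolver
open import Algebra.Solver.Ring.AlmostCommutativeRing using (fromCommutativeRing; _-Raw-AlmostCommutative⟶_)
open import Data.Bool.Base using (if_then_else_)
open import Data.Fin.Base using (Fin; zero; suc; toℕ; fromℕ; inject₁; _↑ˡ_; _↑ʳ_; combine)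
open import Data.Fin.Induction using (<-weakInduction; <-weakInduction-startingFrom)
open import Data.Fin.Permutation using (↔⇒≡)
open import Data.Fin.Properties using (_≟_; any?; +↔⊎; *↔×; toℕ-fromℕ<; toℕ-injective; toℕ-inject₁; toℕ-fromℕ; toℕ<n; toℕ≤pred[n])
import Data.Fin.Properties as Fin
open import Data.Fin.Relation.Unary.Top using (view; ‵fromℕ; ‵inject₁)
open import Data.Fin.Subset using (Subset; inside; outside; _∈_; _∉_; _∩_; _∪_; ⁅_⁆; ⊤; ⊥; ∣_∣)
import Data.Fin.Subset.Properties as Subset
open import Data.Fin.Subset.Properties using (_∈?_)
open import Data.Integer.Base as ℤ using (ℤ; +_; -[1+_])
import Data.Integer.Properties as ℤ
open import Data.Maybe.Base using (Maybe; just; nothing)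
open import Data.Nat.Base as ℕ using (ℕ; zero; suc; z≤n; s≤s; _∸_)
open import Data.Nat.DivMod using (_%_; m<n⇒m%n≡m; n%n≡0)
import Data.Nat.Properties as ℕ
open import Data.Product.Base using (Σ; _×_; _,_; ∃-syntax; proj₁; proj₂)
open import Data.Product.Function.NonDependent.Propositional using (_×-↔_)
open import Data.Sum.Base as Sum using (_⊎_; inj₁; inj₂; [_,_]′)
open import Data.Sum.Function.Propositional using (_⊎-↔_)
open import Data.Unit.Base using (tt) renaming (⊤ to Unit)
open import Data.Vec.Base using (lookup; _++_; concat; tabulate; []; _∷_; here; there)
open import Data.Vec.Functional using (Vector)
open import Data.Vec.Properties using (lookup-++ˡ; lookup-++ʳ; lookup-concat; lookup∘tabulate; []=⇒lookup; lookup⇒[]=)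
open import Function.Base using (_∘_; id; const)
open import Function.Bundles using (_↔_; _⇔_; Inverse; Equivalence; mk⇔; mk↔ₛ′)
open import Function.Definitions using (Injective)
open import Function.Properties.Equivalence using () renaming (refl to ⇔-refl; sym to ⇔-sym; trans to ⇔-trans)
open import Function.Properties.Inverse using (↔-refl; ↔-sym; ↔-trans)
open import Level using (0ℓ)
open import Relation.Binary.Bundles using (StrictPartialOrder)
import Relation.Binary.Construct.Closure.ReflexiveTransitive as Star
open import Relation.Binary.Construct.Closure.ReflexiveTransitive using (Star; ε; _◅_; _◅◅_; reverse)
import Relation.Binary.Construct.StrictToNonStrict as StrictToNonStrict
open import Relation.Binary.Definitions using (DecidableEquality; tri<; tri≈; tri>)
open import Relation.Binary.PropositionalEquality.Core as ≡ using (_≡_; _≢_; refl; sym; trans; cong; cong₂; subst)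
import Relation.Binary.Reasoning.Setoid as SetoidReasoning
import Relation.Binary.Reasoning.StrictPartialOrder as OrderReasoning
open import Relation.Binary.Structures using (IsStrictTotalOrder; IsTotalOrder)
open import Relation.Nullary using (¬_; Dec; yes; no; contradiction; does)
open import Relation.Nullary.Decidable using (¬?; _×-dec_; _⊎-dec_)

-- After moving a single edge the Perron vector and the place of its maximum would be different
-- ones. All edges are therefore moved at once and tested with one vector `x`, which needs a
-- bijection between the two vertex sets. It comes from matching each edge off the cycle with its
-- end away from u; the cycle vertex displaced by u is such an end too, so it becomes a leaf. The
-- gain of the form in an edge is 2 (x_u - x_p) times a nonnegative number and may vanish; this is
-- why strictness is read off from row u instead. The maximum of `x` is taken over graph vertices
-- only, since the m - 2 inner vertices of an edge never change edges. With ρ = (m - 1) λ the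
-- numerical bounds are the larger roots of ρ² = (m - 2) ρ + (k - l + 2)(m - 1), of ρ² = m ρ + (k -
-- l + 2)(m - 1), and of ρ² = (m - 1) ρ + 2 (m - 1). The first belongs to the star of the k - l + 2
-- edges at the hub, the last to the cycle, where weights invariant under rotation form an
-- eigenvector.

two-elements⇒2≤card : ∀ {n} {p : Subset n} {x y} → x ∈ p → y ∈ p → x ≢ y → 2 ℕ.≤ ∣ p ∣
two-elements⇒2≤card {p = p} {x} {y} x∈p y∈p x≢y = ℕ.≤-trans
  (s≤s (ℕ.≤-<-trans z≤n (Subset.x∈p⇒∣p-x∣<∣p∣ (Subset.x∈p∧x≢y⇒x∈p-y y∈p (x≢y ∘ ≡.sym)))))
  (Subset.x∈p⇒∣p-x∣<∣p∣ x∈p)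

linear⇒same-edge : ∀ {H} → Linear H → ∀ {i j e f} → i ≢ j → i ∈ edge H e → j ∈ edge H e → i ∈ edge H f →
    j ∈ edge H f → e ≡ f
linear⇒same-edge lin {e = e} {f} i≢j i∈e j∈e i∈f j∈f with e ≟ f
... | yes e≡f = e≡f
... | no e≢f = contradiction (lin e≢f)
    (ℕ.<⇒≱ (two-elements⇒2≤card (Subset.x∈p∩q⁺ (i∈e , i∈f)) (Subset.x∈p∩q⁺ (j∈e , j∈f)) i≢j))

to-injective : ∀ {A B : Set} (i : A ↔ B) → Injective _≡_ _≡_ (Inverse.to i)
to-injective i {x} {y} eq = trans (sym (Inverse.strictlyInverseʳ i x))
    (trans (cong (Inverse.from i) eq) (Inverse.strictlyInverseʳ i y))

from-injective : ∀ {A B : Set} (i : A ↔ B) → Injective _≡_ _≡_ (Inverse.from i)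
from-injective i = to-injective (↔-sym i)

inj₁-injective : ∀ {A B : Set} {x y : A} → inj₁ {B = B} x ≡ inj₁ y → x ≡ y
inj₁-injective refl = refl

inj₂-injective : ∀ {A B : Set} {x y : B} → inj₂ {A = A} x ≡ inj₂ y → x ≡ y
inj₂-injective refl = refl

≡⇒∈⇔ : ∀ {n k} (p : Subset n) (q : Subset k) i j → lookup p i ≡ lookup q j → i ∈ p ⇔ j ∈ q
≡⇒∈⇔ p q i j eq = mk⇔ (λ i∈p → lookup⇒[]= j q (trans (sym eq) ([]=⇒lookup i∈p)))
                        (λ j∈q → lookup⇒[]= i p (trans eq ([]=⇒lookup j∈q)))

∈-++ˡ : ∀ {n k} (p : Subset n) (q : Subset k) i → i ↑ˡ k ∈ p ++ q ⇔ i ∈ p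
∈-++ˡ p q i = ≡⇒∈⇔ (p ++ q) p _ i (lookup-++ˡ p q i)

∈-++ʳ : ∀ {n k} (p : Subset n) (q : Subset k) j → n ↑ʳ j ∈ p ++ q ⇔ j ∈ q
∈-++ʳ p q j = ≡⇒∈⇔ (p ++ q) q _ j (lookup-++ʳ p q j)

∈-block : ∀ {k} r (e f : Fin k) (a : Fin r) → combine f a ∈ block r e ⇔ f ≡ e
∈-block {k} r e f a = ⇔-trans (≡⇒∈⇔ (block r e) (side f) _ a
    (trans (lookup-concat (tabulate side) f a) (cong (λ p → lookup p a) (lookup∘tabulate side f)))) (full-or-empty f)
  where
  side : Fin k → Subset r
  side f = if does (e ≟ f) then ⊤ else ⊥
  full-or-empty : ∀ f → a ∈ side f ⇔ f ≡ e
  full-or-empty f with e ≟ f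
  ... | yes e≡f = mk⇔ (λ _ → sym e≡f) (λ _ → Subset.∈⊤)
  ... | no e≢f = mk⇔ (λ a∈⊥ → contradiction a∈⊥ Subset.∉⊥) (λ f≡e → contradiction (sym f≡e) e≢f)

-- Powers of graphs

-- A multigraph is given by the two ends s e and t e of each edge e.

Incident : {V E : Set} (s t : E → V) → V → E → Set
Incident s t v e = v ≡ s e ⊎ v ≡ t e

PowerIncident : {V E : Set} (s t : E → V) {r : ℕ} → V ⊎ (E × Fin r) → E → Set
PowerIncident s t (inj₁ v) e = Incident s t v e
PowerIncident s t (inj₂ (f , _)) e = f ≡ e

-- Presents a power by sums and products of types instead of positions in `Fin`. Incidence is stated
-- through `from`, so that it can be verified by cases on the sum. Two hypergraphs presented over
-- the same graph are isomorphic, which is how powers are recognised.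
record IsPower (m : ℕ) (H : Hypergraph) {V E : Set} (s t : E → V) : Set where
  field
    vert : Fin (order H) ↔ (V ⊎ (E × Fin (m ∸ 2)))
    edg : Fin (size H) ↔ E
    incidence : ∀ v e → Inverse.from vert v ∈ edge H (Inverse.from edg e) ⇔ PowerIncident s t v e

  open Inverse vert public using () renaming
      (to to toV; from to fromV; strictlyInverseˡ to toV∘fromV; strictlyInverseʳ to fromV∘toV)
  open Inverse edg public using () renaming
      (to to toE; from to fromE; strictlyInverseˡ to toE∘fromE; strictlyInverseʳ to fromE∘toE)

  incidence′ : ∀ v e → v ∈ edge H e ⇔ PowerIncident s t (toV v) (toE e)
  incidence′ v e = subst (λ u → u ∈ edge H e ⇔ PowerIncident s t (toV v) (toE e)) (fromV∘toV v)
    (subst (λ f → fromV (toV v) ∈ edge H f ⇔ PowerIncident s t (toV v) (toE e)) (fromE∘toE e)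
        (incidence (toV v) (toE e)))

module _ {m : ℕ} {H H′ : Hypergraph} {V E : Set} {s t : E → V} where
  IsPower⇒≅ : IsPower m H s t → IsPower m H′ s t → H ≅ H′
  IsPower⇒≅ P P′ = record
    { vertices = ↔-trans P.vert (↔-sym P′.vert)
    ; edges = ↔-trans P.edg (↔-sym P′.edg)
    ; incidence = λ v e → ⇔-trans (P.incidence′ v e) (⇔-sym (P′.incidence (P.toV v) (P.toE e)))
    }
    where
    module P = IsPower P
    module P′ = IsPower P′

  IsPower-≅ : H ≅ H′ → IsPower m H′ s t → IsPower m H s t
  IsPower-≅ iso P = record
    { vert = ↔-trans I.vertices P.vert
    ; edg = ↔-trans I.edges P.edg
    ; incidence = λ v e → ⇔-trans (I.incidence _ _) (⇔-trans (P.incidence′ _ _)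
        (subst (λ w → PowerIncident s t w _ ⇔ PowerIncident s t v e)
            (sym (trans (cong P.toV (Inverse.strictlyInverseˡ I.vertices _)) (P.toV∘fromV v)))
        (subst (λ f → PowerIncident s t v f ⇔ PowerIncident s t v e)
            (sym (trans (cong P.toE (Inverse.strictlyInverseˡ I.edges _)) (P.toE∘fromE e))) ⇔-refl)))
    }
    where
    module I = _≅_ iso
    module P = IsPower P

module _ {V V′ E E′ : Set} {s t : E → V} {s′ t′ : E′ → V′} (φ : V ↔ V′) (ψ : E ↔ E′)
         (s-eq : ∀ e → Inverse.to φ (s e) ≡ s′ (Inverse.to ψ e))
             (t-eq : ∀ e → Inverse.to φ (t e) ≡ t′ (Inverse.to ψ e)) where
  private
    transport : ∀ (f : E → V) (f′ : E′ → V′) → (∀ e → Inverse.to φ (f e) ≡ f′ (Inverse.to ψ e)) → ∀ v e →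
        Inverse.from φ v ≡ f (Inverse.from ψ e) ⇔ v ≡ f′ e
    transport f f′ eq v e = mk⇔
      (λ p → trans (sym (Inverse.strictlyInverseˡ φ v)) (trans (cong (Inverse.to φ) p) step))
      (λ p → trans (cong (Inverse.from φ) (trans p (sym step))) (Inverse.strictlyInverseʳ φ _))
      where
      step : Inverse.to φ (f (Inverse.from ψ e)) ≡ f′ e
      step = trans (eq _) (cong f′ (Inverse.strictlyInverseˡ ψ e))

  relabel : ∀ {m H} → IsPower m H s t → IsPower m H s′ t′
  relabel P = record
    { vert = ↔-trans vert (φ ⊎-↔ (ψ ×-↔ ↔-refl))
    ; edg = ↔-trans edg ψ
    ; incidence = inc
    }
    where
    open IsPower P
    inc : ∀ v e → _ ⇔ PowerIncident s′ t′ v e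
    inc (inj₁ v) e = ⇔-trans (incidence (inj₁ (Inverse.from φ v)) (Inverse.from ψ e)) (mk⇔
      (Sum.map (Equivalence.to (transport s s′ s-eq v e)) (Equivalence.to (transport t t′ t-eq v e)))
      (Sum.map (Equivalence.from (transport s s′ s-eq v e)) (Equivalence.from (transport t t′ t-eq v e))))
    inc (inj₂ (f , a)) e = ⇔-trans (incidence (inj₂ (Inverse.from ψ f , a)) (Inverse.from ψ e))
        (mk⇔ (from-injective ψ) (cong (Inverse.from ψ)))

withPendants : ∀ {V E : Set} c → V → (s t : E → V) → (E ⊎ Fin c → V ⊎ Fin c) × (E ⊎ Fin c → V ⊎ Fin c)
withPendants c w s t = [ inj₁ ∘ s , const (inj₁ w) ]′ , [ inj₁ ∘ t , inj₂ ]′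

module _ {V E : Set} {s t : E → V} where
  private
    no-inner : (V ⊎ (E × Fin 0)) ↔ V
    no-inner = mk↔ₛ′ (λ { (inj₁ v) → v ; (inj₂ (_ , ())) }) inj₁ (λ _ → refl)
        (λ { (inj₁ v) → refl ; (inj₂ (_ , ())) })

  power-isPower : ∀ m {G} → IsPower 2 G s t → IsPower m (power m G) s t
  power-isPower m {G} P = record
    { vert = ↔-trans (+↔⊎ {order G}) (↔-trans vert no-inner ⊎-↔ ↔-trans (*↔× {size G}) (edg ×-↔ ↔-refl))
    ; edg = edg
    ; incidence = inc
    }
    where
    open IsPower P
    inc : ∀ v e → _ ⇔ PowerIncident s t v e
    inc (inj₁ v) e = ⇔-trans (∈-++ˡ (edge G (fromE e)) _ (fromV (inj₁ v))) (incidence (inj₁ v) e)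
    inc (inj₂ (f , a)) e = ⇔-trans (∈-++ʳ (edge G (fromE e)) _ _)
        (⇔-trans (∈-block _ (fromE e) (fromE f) a) (mk⇔ (from-injective edg) (cong fromE)))

  attachPendant-isPower : ∀ {m H v w} (m≥2 : 2 ℕ.≤ m) (P : IsPower m H s t) → IsPower.fromV P (inj₁ w) ≡ v →
    IsPower m (attachPendant m≥2 H v) (proj₁ (withPendants 1 w s t)) (proj₂ (withPendants 1 w s t))
  attachPendant-isPower {suc (suc r)} {H} {v} {w} (s≤s (s≤s z≤n)) P w≡v = record
    { vert = ↔-trans (+↔⊎ {order H}) (↔-trans (vert ⊎-↔ ↔-refl) rearranged)
    ; edg = mk↔ₛ′ (λ { zero → inj₂ zero ; (suc e) → inj₁ (toE e) }) (λ { (inj₁ e) → suc (fromE e) ; (inj₂ _) → zero })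
                  (λ { (inj₁ e) → cong inj₁ (toE∘fromE e) ; (inj₂ zero) → refl })
                      (λ { zero → refl ; (suc e) → cong suc (fromE∘toE e) })
    ; incidence = inc
    }
    where
    open IsPower P
    v≡w : toV v ≡ inj₁ w
    v≡w = trans (cong toV (sym w≡v)) (toV∘fromV _)
    rearranged : ((V ⊎ (E × Fin r)) ⊎ Fin (suc r)) ↔ ((V ⊎ Fin 1) ⊎ ((E ⊎ Fin 1) × Fin r))
    -- Of the m - 1 new vertices the one numbered zero becomes the leaf of the graph; the other m -
    -- 2 are the inner vertices of the pendant edge.
    rearranged = mk↔ₛ′
      (λ { (inj₁ (inj₁ v)) → inj₁ (inj₁ v) ; (inj₁ (inj₂ (e , a))) → inj₂ (inj₁ e , a) ; (inj₂ zero) → inj₁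
          (inj₂ zero) ; (inj₂ (suc a)) → inj₂ (inj₂ zero , a) })
      (λ { (inj₁ (inj₁ v)) → inj₁ (inj₁ v) ; (inj₁ (inj₂ _)) → inj₂ zero ; (inj₂ (inj₁ e , a)) → inj₁ (inj₂ (e , a)) ;
          (inj₂ (inj₂ _ , a)) → inj₂ (suc a) })
      (λ { (inj₁ (inj₁ v)) → refl ; (inj₁ (inj₂ zero)) → refl ; (inj₂ (inj₁ e , a)) → refl ; (inj₂ (inj₂ zero , a)) →
          refl })
      (λ { (inj₁ (inj₁ v)) → refl ; (inj₁ (inj₂ _)) → refl ; (inj₂ zero) → refl ; (inj₂ (suc a)) → refl })
    new : ∀ x → x ∈ ⁅ v ⁆ ⇔ toV x ≡ inj₁ w
    new x = mk⇔ (λ x∈ → trans (cong toV (Subset.x∈⁅y⁆⇒x≡y v x∈)) v≡w)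
                (λ eq → subst (_∈ ⁅ v ⁆) (to-injective vert (trans v≡w (sym eq))) (Subset.x∈⁅x⁆ v))
    inc : ∀ x e → _ ⇔ PowerIncident (proj₁ (withPendants 1 w s t)) (proj₂ (withPendants 1 w s t)) x e
    inc (inj₁ (inj₁ x)) (inj₁ e) = ⇔-trans (∈-++ˡ (edge H (fromE e)) _ (fromV (inj₁ x)))
        (⇔-trans (incidence (inj₁ x) e)
        (mk⇔ (Sum.map (cong inj₁) (cong inj₁)) (Sum.map inj₁-injective inj₁-injective)))
    inc (inj₁ (inj₁ x)) (inj₂ zero) = ⇔-trans (∈-++ˡ ⁅ v ⁆ _ (fromV (inj₁ x))) (⇔-trans (new _) (mk⇔
      (λ eq → inj₁ (cong inj₁ (inj₁-injective (trans (sym (toV∘fromV (inj₁ x))) eq)))) λ { (inj₁ refl) → toV∘fromV _ ;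
          (inj₂ ()) }))
    inc (inj₁ (inj₂ zero)) (inj₁ e) = ⇔-trans (∈-++ʳ (edge H (fromE e)) ⊥ zero)
        (mk⇔ (λ p → contradiction p Subset.∉⊥) λ { (inj₁ ()) ; (inj₂ ()) })
    inc (inj₁ (inj₂ zero)) (inj₂ zero) = ⇔-trans (∈-++ʳ ⁅ v ⁆ ⊤ zero) (mk⇔ (λ _ → inj₂ refl) (λ _ → Subset.∈⊤))
    inc (inj₂ (inj₁ f , a)) (inj₁ e) = ⇔-trans (∈-++ˡ (edge H (fromE e)) _ (fromV (inj₂ (f , a))))
        (⇔-trans (incidence (inj₂ (f , a)) e) (mk⇔ (cong inj₁) inj₁-injective))
    inc (inj₂ (inj₁ f , a)) (inj₂ zero) = ⇔-trans (∈-++ˡ ⁅ v ⁆ _ (fromV (inj₂ (f , a))))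
        (⇔-trans (new _) (mk⇔ (λ eq → contradiction (trans (sym (toV∘fromV (inj₂ (f , a)))) eq) λ ()) λ ()))
    inc (inj₂ (inj₂ zero , a)) (inj₁ e) = ⇔-trans (∈-++ʳ (edge H (fromE e)) ⊥ (suc a))
        (mk⇔ (λ p → contradiction p Subset.∉⊥) λ ())
    inc (inj₂ (inj₂ zero , a)) (inj₂ zero) = ⇔-trans (∈-++ʳ ⁅ v ⁆ ⊤ (suc a)) (mk⇔ (λ _ → refl) (λ _ → Subset.∈⊤))

  attachPendant-root : ∀ {m H v w} (m≥2 : 2 ℕ.≤ m) (P : IsPower m H s t) (w≡v : IsPower.fromV P (inj₁ w) ≡ v) →
    IsPower.fromV (attachPendant-isPower m≥2 P w≡v) (inj₁ (inj₁ w)) ≡ v ↑ˡ (m ∸ 1)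
  attachPendant-root {suc (suc r)} (s≤s (s≤s z≤n)) P w≡v = cong (_↑ˡ suc r) w≡v

private
  ⊎-Fin0 : ∀ {A : Set} → A ↔ (A ⊎ Fin 0)
  ⊎-Fin0 = mk↔ₛ′ inj₁ (λ { (inj₁ a) → a ; (inj₂ ()) }) (λ { (inj₁ a) → refl ; (inj₂ ()) }) (λ _ → refl)

  ⊎-Fin-suc : ∀ {A : Set} {c} → ((A ⊎ Fin 1) ⊎ Fin c) ↔ (A ⊎ Fin (suc c))
  ⊎-Fin-suc = mk↔ₛ′
    (λ { (inj₁ (inj₁ a)) → inj₁ a ; (inj₁ (inj₂ _)) → inj₂ zero ; (inj₂ j) → inj₂ (suc j) })
    (λ { (inj₁ a) → inj₁ (inj₁ a) ; (inj₂ zero) → inj₁ (inj₂ zero) ; (inj₂ (suc j)) → inj₂ j })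
    (λ { (inj₁ a) → refl ; (inj₂ zero) → refl ; (inj₂ (suc j)) → refl })
    (λ { (inj₁ (inj₁ a)) → refl ; (inj₁ (inj₂ zero)) → refl ; (inj₂ j) → refl })

-- Every attachment changes the graph, so the induction runs over all presentations and carries the
-- position of the hub along.
attachPendants-isPower : ∀ {V E : Set} {s t : E → V} {m H v w} (m≥2 : 2 ℕ.≤ m) (P : IsPower m H s t) → IsPower.fromV P
    (inj₁ w) ≡ v →
  ∀ c → IsPower m (attachPendants m≥2 H v c) (proj₁ (withPendants c w s t)) (proj₂ (withPendants c w s t))
attachPendants-isPower m≥2 P w≡v zero = relabel ⊎-Fin0 ⊎-Fin0 (λ _ → refl) (λ _ → refl) P
attachPendants-isPower {s = s} {t} m≥2 P w≡v (suc c) = relabel ⊎-Fin-suc ⊎-Fin-suc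
  (λ { (inj₁ (inj₁ e)) → refl ; (inj₁ (inj₂ zero)) → refl ; (inj₂ j) → refl })
  (λ { (inj₁ (inj₁ e)) → refl ; (inj₁ (inj₂ zero)) → refl ; (inj₂ j) → refl })
  (attachPendants-isPower m≥2 (attachPendant-isPower m≥2 P w≡v) (attachPendant-root m≥2 P w≡v) c)

-- The cyclic successor on `Fin l`.

next-cases : ∀ {n} (i : Fin (suc n)) → toℕ (next i) ≡ suc (toℕ i) ⊎ (toℕ i ≡ n × toℕ (next i) ≡ 0)
next-cases {n} i with ℕ.m≤n⇒m<n∨m≡n (toℕ<n i)
... | inj₁ i<n = inj₁ (trans (toℕ-fromℕ< _) (m<n⇒m%n≡m i<n))
... | inj₂ i≡n = inj₂ (ℕ.suc-injective i≡n , trans (toℕ-fromℕ< _) (trans (cong (_% suc n) i≡n) (n%n≡0 (suc n))))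

next-inject₁ : ∀ {n} (i : Fin n) → next (inject₁ i) ≡ suc i
next-inject₁ i with next-cases (inject₁ i)
... | inj₁ eq = toℕ-injective (trans eq (cong suc (toℕ-inject₁ i)))
... | inj₂ (p , _) = contradiction (trans (sym (toℕ-inject₁ i)) p) (ℕ.<⇒≢ (toℕ<n i))

next-fromℕ : ∀ n → next (fromℕ n) ≡ zero
next-fromℕ n with next-cases (fromℕ n)
... | inj₁ eq = contradiction (ℕ.≤-reflexive (sym (trans eq (cong suc (toℕ-fromℕ n)))))
    (ℕ.<⇒≱ (toℕ<n (next (fromℕ n))))
... | inj₂ (_ , p) = toℕ-injective p

prev : ∀ {l} → Fin l → Fin l
prev zero = fromℕ _
prev (suc i) = inject₁ i

next-prev : ∀ {l} (i : Fin l) → next (prev i) ≡ i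
next-prev zero = next-fromℕ _
next-prev (suc i) = next-inject₁ i

next-injective : ∀ {l} → Injective _≡_ _≡_ (next {l})
next-injective {suc n} {i} {j} eq with next-cases i | next-cases j
... | inj₁ p | inj₁ q = toℕ-injective (ℕ.suc-injective (trans (sym p) (trans (cong toℕ eq) q)))
... | inj₁ p | inj₂ (_ , q) = contradiction (trans (sym p) (trans (cong toℕ eq) q)) λ ()
... | inj₂ (_ , p) | inj₁ q = contradiction (trans (sym q) (trans (cong toℕ (sym eq)) p)) λ ()
... | inj₂ (p , _) | inj₂ (q , _) = toℕ-injective (trans p (sym q))

prev-next : ∀ {l} (i : Fin l) → prev (next i) ≡ i
prev-next i = next-injective (next-prev (next i))

next≢ : ∀ {l} → 3 ℕ.≤ l → (i : Fin l) → next i ≢ i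
next≢ {suc n} (s≤s 2≤n) i eq with next-cases i
... | inj₁ p = ℕ.<⇒≢ (ℕ.n<1+n _) (trans (sym (cong toℕ eq)) p)
... | inj₂ (p , q) = contradiction 2≤n
    (ℕ.<⇒≱ (s≤s (ℕ.≤-trans (ℕ.≤-reflexive (trans (sym p) (trans (sym (cong toℕ eq)) q))) z≤n)))

next-next≢ : ∀ {l} → 3 ℕ.≤ l → (i : Fin l) → next (next i) ≢ i
next-next≢ {suc n} (s≤s 2≤n) i eq with next-cases i | next-cases (next i)
... | inj₁ a | inj₁ b = ℕ.<⇒≢ (ℕ.m<n⇒m<1+n (ℕ.n<1+n _)) (trans (sym (cong toℕ eq)) (trans b (cong suc a)))
... | inj₁ a | inj₂ (c , d) = contradiction 2≤n (ℕ.<⇒≱ (s≤s (ℕ.≤-reflexive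
      (trans (sym c) (trans a (cong suc (trans (sym (cong toℕ eq)) d)))))))
... | inj₂ (a , b) | inj₁ c = contradiction 2≤n (ℕ.<⇒≱ (s≤s (ℕ.≤-reflexive
      (trans (sym a) (trans (sym (cong toℕ eq)) (trans c (cong suc b)))))))
... | inj₂ (a , b) | inj₂ (c , d) = contradiction 2≤n (ℕ.<⇒≱ (s≤s (ℕ.≤-trans (ℕ.≤-reflexive (trans (sym c) b)) z≤n)))

-- Climbing from `i` reaches the last index, wrapping around gives zero, and ordinary induction does
-- the rest.
next-closed⇒all : ∀ {l} (P : Fin l → Set) → (∀ i → P i → P (next i)) → ∀ {i} → P i → ∀ j → P j
next-closed⇒all {suc n} P step {i} Pi = <-weakInduction P P-zero step′
  where
  step′ : ∀ j → P (inject₁ j) → P (suc j)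
  step′ j Pj = subst P (next-inject₁ j) (step (inject₁ j) Pj)
  P-zero : P zero
  P-zero = subst P (next-fromℕ n)
      (step (fromℕ n) (<-weakInduction-startingFrom P Pi step′
      (subst (toℕ i ℕ.≤_) (sym (toℕ-fromℕ n)) (toℕ≤pred[n] i))))

-- Simple graphs given by their end maps, and connectedness of their powers.

module _ {V E : Set} (s t : E → V) where
  Joins : E → V → V → Set
  Joins e a b = (a ≡ s e × b ≡ t e) ⊎ (a ≡ t e × b ≡ s e)

  Adj : V → V → Set
  Adj a b = ∃[ e ] Joins e a b

  GraphConnected : Set
  GraphConnected = ∀ a b → Star Adj a b

  record IsSimple : Set where
    field
      loopless : ∀ e → s e ≢ t e
      no-multi : ∀ {a b e f} → Joins e a b → Joins f a b → e ≡ f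

module Ends {V E : Set} (s t : E → V) where
  joins-sym : ∀ {e a b} → Joins s t e a b → Joins s t e b a
  joins-sym (inj₁ (p , q)) = inj₂ (q , p)
  joins-sym (inj₂ (p , q)) = inj₁ (q , p)

  joinsˡ : ∀ {e a b} → Joins s t e a b → Incident s t a e
  joinsˡ (inj₁ (p , _)) = inj₁ p
  joinsˡ (inj₂ (p , _)) = inj₂ p

  joinsʳ : ∀ {e a b} → Joins s t e a b → Incident s t b e
  joinsʳ = joinsˡ ∘ joins-sym

  incident-joins : ∀ {e a b} x → Joins s t e a b → Incident s t x e → x ≡ a ⊎ x ≡ b
  incident-joins x (inj₁ (p , q)) (inj₁ r) = inj₁ (trans r (sym p))
  incident-joins x (inj₁ (p , q)) (inj₂ r) = inj₂ (trans r (sym q))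
  incident-joins x (inj₂ (p , q)) (inj₁ r) = inj₂ (trans r (sym q))
  incident-joins x (inj₂ (p , q)) (inj₂ r) = inj₁ (trans r (sym p))

  joins-incident : ∀ {e a b} → Joins s t e a b → ∀ x → Incident s t x e ⇔ (x ≡ a ⊎ x ≡ b)
  joins-incident j x = mk⇔ (incident-joins x j) [ (λ { refl → joinsˡ j }) , (λ { refl → joinsʳ j }) ]′

  incident-pair : ∀ {e a b} → Incident s t a e → Incident s t b e → a ≡ b ⊎ Joins s t e a b
  incident-pair (inj₁ p) (inj₁ q) = inj₁ (trans p (sym q))
  incident-pair (inj₁ p) (inj₂ q) = inj₂ (inj₁ (p , q))
  incident-pair (inj₂ p) (inj₁ q) = inj₂ (inj₂ (p , q))
  incident-pair (inj₂ p) (inj₂ q) = inj₁ (trans p (sym q))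

  incident-≢ : ∀ {e a b} → a ≢ b → Incident s t a e → Incident s t b e → Joins s t e a b
  incident-≢ a≢b p q with incident-pair p q
  ... | inj₁ a≡b = contradiction a≡b a≢b
  ... | inj₂ j = j

  joins-≢ : IsSimple s t → ∀ {e a b} → Joins s t e a b → a ≢ b
  joins-≢ simple {e} (inj₁ (p , q)) a≡b = IsSimple.loopless simple e (trans (sym p) (trans a≡b q))
  joins-≢ simple {e} (inj₂ (p , q)) a≡b = IsSimple.loopless simple e (trans (sym q) (trans (sym a≡b) p))

  adj-sym : ∀ {a b} → Adj s t a b → Adj s t b a
  adj-sym (e , j) = e , joins-sym j

all-equal⇒card≤1 : ∀ {n} (p : Subset n) → (∀ {x y} → x ∈ p → y ∈ p → x ≡ y) → ∣ p ∣ ℕ.≤ 1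
all-equal⇒card≤1 [] _ = z≤n
all-equal⇒card≤1 (outside ∷ p) eq = all-equal⇒card≤1 p λ x∈p y∈p → Fin.suc-injective (eq (there x∈p) (there y∈p))
all-equal⇒card≤1 {suc n} (inside ∷ p) eq = s≤s
    (ℕ.≤-reflexive (trans (cong ∣_∣ (Subset.Empty-unique λ { (x , x∈p) → contradiction (eq here (there x∈p)) λ () }))
    (Subset.∣⊥∣≡0 n)))

card≡0⇒∉ : ∀ {n} (p : Subset n) → ∣ p ∣ ≡ 0 → ∀ x → x ∉ p
card≡0⇒∉ (outside ∷ p) eq (suc x) (there x∈p) = card≡0⇒∉ p eq x x∈p

card≡1⇒singleton : ∀ {n} (p : Subset n) → ∣ p ∣ ≡ 1 → ∃[ a ] ∀ x → x ∈ p ⇔ x ≡ a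
card≡1⇒singleton (outside ∷ p) eq with card≡1⇒singleton p eq
... | a , spec = suc a , λ
  { zero → mk⇔ (λ ()) (λ ())
  ; (suc x) → mk⇔ (λ { (there x∈p) → cong suc (Equivalence.to (spec x) x∈p) })
      (λ { refl → there (Equivalence.from (spec x) refl) }) }
card≡1⇒singleton (inside ∷ p) eq = zero , λ
  { zero → mk⇔ (λ _ → refl) (λ _ → here)
  ; (suc x) → mk⇔ (λ { (there x∈p) → contradiction x∈p (card≡0⇒∉ p (ℕ.suc-injective eq) x) }) (λ ()) }

card≡2⇒pair : ∀ {n} (p : Subset n) → ∣ p ∣ ≡ 2 → ∃[ a ] ∃[ b ] a ≢ b × (∀ x → x ∈ p ⇔ (x ≡ a ⊎ x ≡ b))
card≡2⇒pair (outside ∷ p) eq with card≡2⇒pair p eq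
... | a , b , a≢b , spec = suc a , suc b , a≢b ∘ Fin.suc-injective , λ
  { zero → mk⇔ (λ ()) (λ { (inj₁ ()) ; (inj₂ ()) })
  ; (suc x) → mk⇔ (λ { (there x∈p) → Sum.map (cong suc) (cong suc) (Equivalence.to (spec x) x∈p) })
                  (λ q → there (Equivalence.from (spec x) (Sum.map Fin.suc-injective Fin.suc-injective q))) }
card≡2⇒pair (inside ∷ p) eq with card≡1⇒singleton p (ℕ.suc-injective eq)
... | a , spec = zero , suc a , (λ ()) , λ
  { zero → mk⇔ (λ _ → inj₁ refl) (λ _ → here)
  ; (suc x) → mk⇔ (λ { (there x∈p) → inj₂ (cong suc (Equivalence.to (spec x) x∈p)) })
                  (λ { (inj₁ ()) ; (inj₂ refl) → there (Equivalence.from (spec x) refl) }) }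

module GraphEnds (G : Hypergraph) (uniform : Uniform 2 G) where
  private
    pair : ∀ e → _
    pair e = card≡2⇒pair (edge G e) (uniform e)

  end₁ end₂ : Fin (size G) → Fin (order G)
  end₁ e = proj₁ (pair e)
  end₂ e = proj₁ (proj₂ (pair e))

  ∈⇔incident : ∀ x e → x ∈ edge G e ⇔ Incident end₁ end₂ x e
  ∈⇔incident x e = proj₂ (proj₂ (proj₂ (pair e))) x

  open Ends end₁ end₂

  isPower : IsPower 2 G end₁ end₂
  isPower = record
    { vert = mk↔ₛ′ inj₁ (λ { (inj₁ v) → v ; (inj₂ (_ , ())) }) (λ { (inj₁ v) → refl ; (inj₂ (_ , ())) }) (λ _ → refl)
    ; edg = ↔-refl
    ; incidence = λ { (inj₁ v) e → ∈⇔incident v e ; (inj₂ (_ , ())) e }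
    }

  isSimple : IsSimple end₁ end₂
  isSimple = record
    { loopless = λ e → proj₁ (proj₂ (proj₂ (pair e)))
    ; no-multi = λ {_} {_} {e} {f} j k → edge-injective G (Subset.⊆-antisym (sub e f j k) (sub f e k j))
    }
    where
    sub : ∀ e f {a b} → Joins end₁ end₂ e a b → Joins end₁ end₂ f a b → ∀ {x} → x ∈ edge G e → x ∈ edge G f
    sub e f j k {x} x∈e = Equivalence.from (∈⇔incident x f)
        (Equivalence.from (joins-incident k x) (incident-joins x j (Equivalence.to (∈⇔incident x e) x∈e)))

module _ {m H} {V E : Set} {s t : E → V} (P : IsPower m H s t) where
  open IsPower P
  open Ends s t

  -- An inner vertex lies in one edge only, and two common graph vertices would make the edges
  -- parallel.
  simple⇒linear : IsSimple s t → Linear H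
  simple⇒linear simple {e} {f} e≢f = all-equal⇒card≤1 _ λ {x} {y} x∈ y∈ →
    let x∈e , x∈f = Subset.x∈p∩q⁻ (edge H e) (edge H f) x∈
        y∈e , y∈f = Subset.x∈p∩q⁻ (edge H e) (edge H f) y∈
    in to-injective vert (equal (toV x) (toV y) (inc x∈e) (inc x∈f) (inc y∈e) (inc y∈f))
    where
    inc : ∀ {x e} → x ∈ edge H e → PowerIncident s t (toV x) (toE e)
    inc {x} {e} = Equivalence.to (incidence′ x e)
    e≢f′ : toE e ≢ toE f
    e≢f′ = e≢f ∘ to-injective edg
    equal : ∀ a b → PowerIncident s t a (toE e) → PowerIncident s t a (toE f) → PowerIncident s t b (toE e) →
        PowerIncident s t b (toE f) → a ≡ b
    equal (inj₂ (g , _)) b p q _ _ = contradiction (trans (sym p) q) e≢f′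
    equal (inj₁ a) (inj₂ (g , _)) _ _ p q = contradiction (trans (sym p) q) e≢f′
    equal (inj₁ a) (inj₁ b) p q p′ q′ with incident-pair p p′ | incident-pair q q′
    ... | inj₁ a≡b | _ = cong inj₁ a≡b
    ... | inj₂ _ | inj₁ a≡b = cong inj₁ a≡b
    ... | inj₂ j | inj₂ k = contradiction (IsSimple.no-multi simple j k) e≢f′

  -- Retracts the power onto the graph: two vertices of a common edge have equal or adjacent images,
  -- so walks in the hypergraph project to walks in the graph.
  anchor : V ⊎ (E × Fin (m ∸ 2)) → V
  anchor (inj₁ v) = v
  anchor (inj₂ (e , _)) = s e

  anchor-incident : ∀ w e → PowerIncident s t w e → Incident s t (anchor w) e
  anchor-incident (inj₁ v) e p = p
  anchor-incident (inj₂ (f , _)) e refl = inj₁ refl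

  connected⇒graphConnected : Connected H → GraphConnected s t
  connected⇒graphConnected connected a b =
    subst (λ w → Star (Adj s t) a (anchor w)) (toV∘fromV (inj₁ b))
        (subst (λ w → Star (Adj s t) (anchor w) (anchor (toV (fromV (inj₁ b))))) (toV∘fromV (inj₁ a))
        (walk (connected (fromV (inj₁ a)) (fromV (inj₁ b)))))
    where
    walk : ∀ {x y} → Star (λ x y → ∃[ e ] x ∈ edge H e × y ∈ edge H e) x y → Star (Adj s t) (anchor (toV x))
        (anchor (toV y))
    walk ε = ε
    walk {x} (_◅_ {j = y} (e , x∈e , y∈e) path) with incident-pair
        (anchor-incident (toV x) (toE e) (Equivalence.to (incidence′ x e) x∈e))
        (anchor-incident (toV y) (toE e) (Equivalence.to (incidence′ y e) y∈e))
    ... | inj₁ eq = subst (λ v → Star (Adj s t) v _) (sym eq) (walk path)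
    ... | inj₂ j = (toE e , j) ◅ walk path

  graphConnected⇒connected : (∀ v → ∃[ e ] Incident s t v e) → GraphConnected s t → Connected H
  graphConnected⇒connected some-edge connected x y = to-anchor x ◅ (walk (connected _ _) ◅◅ (flip (to-anchor y) ◅ ε))
    where
    R : Fin (order H) → Fin (order H) → Set
    R x y = ∃[ e ] x ∈ edge H e × y ∈ edge H e
    flip : ∀ {x y} → R x y → R y x
    flip (e , p , q) = e , q , p
    walk : ∀ {a b} → Star (Adj s t) a b → Star R (fromV (inj₁ a)) (fromV (inj₁ b))
    walk ε = ε
    walk ((e , j) ◅ path) = (fromE e , Equivalence.from (incidence _ e) (joinsˡ j) , Equivalence.from (incidence _ e)
        (joinsʳ j)) ◅ walk path
    through : ∀ w → ∃[ e ] PowerIncident s t w e × Incident s t (anchor w) e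
    through (inj₁ v)       = let e , p = some-edge v in e , p , p
    through (inj₂ (e , _)) = e , refl , inj₁ refl
    to-anchor : ∀ x → R x (fromV (inj₁ (anchor (toV x))))
    to-anchor x = let e , p , q = through (toV x) in
      fromE e , subst (_∈ edge H (fromE e)) (fromV∘toV x) (Equivalence.from (incidence (toV x) e) p) ,
          Equivalence.from (incidence _ e) q

-- The graph underlying `UC₁`.

module _ {n : ℕ} where
  private
    l = suc n

  coreEnd : Fin l → Fin l
  coreEnd i = i

  -- The graph UC_l(c₁ = c): a cycle on Fin l, with c pendant edges at zero.
  end₁ᵁ end₂ᵁ : ∀ {c} → Fin l ⊎ Fin c → Fin l ⊎ Fin c
  end₁ᵁ {c} = proj₁ (withPendants c zero coreEnd next)
  end₂ᵁ {c} = proj₂ (withPendants c zero coreEnd next)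

  module _ (l≥3 : 3 ℕ.≤ l) where
    cycleGraph-isPower : IsPower 2 (cycleGraph l≥3) coreEnd next
    cycleGraph-isPower = record
      { vert = mk↔ₛ′ inj₁ (λ { (inj₁ v) → v ; (inj₂ (_ , ())) }) (λ { (inj₁ v) → refl ; (inj₂ (_ , ())) })
          (λ _ → refl)
      ; edg = ↔-refl
      ; incidence = λ { (inj₁ v) e → mk⇔
          (λ v∈ → Sum.map (Subset.x∈⁅y⁆⇒x≡y e) (Subset.x∈⁅y⁆⇒x≡y (next e)) (Subset.x∈p∪q⁻ ⁅ e ⁆ ⁅ next e ⁆ v∈))
          (λ p → Subset.x∈p∪q⁺ {p = ⁅ e ⁆} {⁅ next e ⁆}
              (Sum.map (λ { refl → Subset.x∈⁅x⁆ e }) (λ { refl → Subset.x∈⁅x⁆ (next e) }) p))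
        ; (inj₂ (_ , ())) e }
      }

    UC₁-isPower : ∀ {m} (m≥2 : 2 ℕ.≤ m) c → IsPower m (UC₁ m≥2 l≥3 c) (end₁ᵁ {c}) end₂ᵁ
    UC₁-isPower {m} m≥2 c = attachPendants-isPower m≥2 (power-isPower m cycleGraph-isPower) refl c

    open Ends

    core-edge-unique : ∀ {i j a b} → Joins coreEnd next i a b → Joins coreEnd next j a b → i ≡ j
    core-edge-unique (inj₁ (refl , refl)) (inj₁ (p , _)) = p
    core-edge-unique {i} (inj₁ (refl , refl)) (inj₂ (p , q)) = contradiction (trans (cong next q) (sym p))
        (next-next≢ l≥3 i)
    core-edge-unique {i} (inj₂ (refl , refl)) (inj₁ (p , q)) = contradiction (trans (cong next p) (sym q))
        (next-next≢ l≥3 i)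
    core-edge-unique (inj₂ (refl , refl)) (inj₂ (_ , q)) = q

    private
      drop-inj₁ : ∀ {c i a b} → Joins (end₁ᵁ {c}) end₂ᵁ (inj₁ i) a b → ∃[ a′ ] ∃[ b′ ] a ≡ inj₁ a′ × b ≡ inj₁ b′
          × Joins coreEnd next i a′ b′
      drop-inj₁ (inj₁ (refl , refl)) = _ , _ , refl , refl , inj₁ (refl , refl)
      drop-inj₁ (inj₂ (refl , refl)) = _ , _ , refl , refl , inj₂ (refl , refl)

    UC-simple : ∀ {c} → IsSimple (end₁ᵁ {c}) end₂ᵁ
    UC-simple {c} = record { loopless = loopless ; no-multi = no-multi }
      where
      loopless : ∀ e → end₁ᵁ {c} e ≢ end₂ᵁ e
      loopless (inj₁ i) eq = next≢ l≥3 i (sym (inj₁-injective eq))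
      loopless (inj₂ j) ()
      pendant : ∀ {i : Fin l} {j : Fin c} {a b} → Joins (end₁ᵁ {c}) end₂ᵁ (inj₁ i) a b → ¬ Joins (end₁ᵁ {c}) end₂ᵁ
          (inj₂ j) a b
      pendant (inj₁ (refl , refl)) (inj₁ (_ , ()))
      pendant (inj₁ (refl , refl)) (inj₂ (() , _))
      pendant (inj₂ (refl , refl)) (inj₁ (_ , ()))
      pendant (inj₂ (refl , refl)) (inj₂ (() , _))
      no-multi : ∀ {a b e f} → Joins (end₁ᵁ {c}) end₂ᵁ e a b → Joins (end₁ᵁ {c}) end₂ᵁ f a b → e ≡ f
      no-multi {e = inj₁ i} {inj₁ j} p q with drop-inj₁ p | drop-inj₁ q
      ... | _ , _ , refl , refl , p′ | _ , _ , refl , refl , q′ = cong inj₁ (core-edge-unique p′ q′)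
      no-multi {e = inj₁ i} {inj₂ j} p q = contradiction q (pendant p)
      no-multi {e = inj₂ i} {inj₁ j} p q = contradiction p (pendant q)
      no-multi {e = inj₂ i} {inj₂ j} (inj₁ (_ , refl)) (inj₁ (_ , q)) = sym (cong inj₂ (sym (inj₂-injective q)))
      no-multi {e = inj₂ i} {inj₂ j} (inj₁ (refl , refl)) (inj₂ (() , _))
      no-multi {e = inj₂ i} {inj₂ j} (inj₂ (refl , refl)) (inj₁ (_ , ()))
      no-multi {e = inj₂ i} {inj₂ j} (inj₂ (refl , _)) (inj₂ (q , _)) = cong inj₂ (inj₂-injective q)

    UC-connected : ∀ {c} → GraphConnected (end₁ᵁ {c}) end₂ᵁ
    UC-connected {c} a b = reverse (λ { (e , p) → adj-sym _ _ (e , p) }) (from-root a) ◅◅ from-root b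
      where
      from-root-core : ∀ i → Star (Adj (end₁ᵁ {c}) end₂ᵁ) (inj₁ zero) (inj₁ i)
      from-root-core = <-weakInduction _ ε λ i path → path ◅◅
          ((inj₁ (inject₁ i) , inj₁ (refl , cong inj₁ (sym (next-inject₁ i)))) ◅ ε)
      from-root : ∀ a → Star (Adj (end₁ᵁ {c}) end₂ᵁ) (inj₁ zero) a
      from-root (inj₁ i) = from-root-core i
      from-root (inj₂ j) = (inj₂ j , inj₁ (refl , refl)) ◅ ε

    UC-some-edge : ∀ {c} v → ∃[ e ] Incident (end₁ᵁ {c}) end₂ᵁ v e
    UC-some-edge (inj₁ i) = inj₁ i , inj₁ refl
    UC-some-edge (inj₂ j) = inj₂ j , inj₂ refl

-- Cardinalities of edges and uniformity.

∣++∣ : ∀ {n k} (p : Subset n) (q : Subset k) → ∣ p ++ q ∣ ≡ ∣ p ∣ ℕ.+ ∣ q ∣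
∣++∣ [] q = refl
∣++∣ (outside ∷ p) q = ∣++∣ p q
∣++∣ (inside ∷ p) q = cong suc (∣++∣ p q)

∣block∣ : ∀ {k} r (e : Fin k) → ∣ block r e ∣ ≡ r
∣block∣ {k} r e = go (λ f → if does (e ≟ f) then ⊤ else ⊥) e
    (λ f f≢e → trans (cong ∣_∣ (side-no f f≢e)) (Subset.∣⊥∣≡0 r)) (trans (cong ∣_∣ side-yes) (Subset.∣⊤∣≡n r))
  where
  side-no : ∀ f → f ≢ e → (if does (e ≟ f) then ⊤ else ⊥) ≡ ⊥
  side-no f f≢e with e ≟ f
  ... | yes e≡f = contradiction (sym e≡f) f≢e
  ... | no _ = refl
  side-yes : (if does (e ≟ e) then ⊤ else ⊥) ≡ ⊤
  side-yes with e ≟ e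
  ... | yes _ = refl
  ... | no e≢e = contradiction refl e≢e
  empty : ∀ {k} (g : Fin k → Subset r) → (∀ f → ∣ g f ∣ ≡ 0) → ∣ concat (tabulate g) ∣ ≡ 0
  empty {zero} g _ = refl
  empty {suc k} g g0 = trans (∣++∣ (g zero) _) (cong₂ ℕ._+_ (g0 zero) (empty (g ∘ suc) (g0 ∘ suc)))
  go : ∀ {k} (g : Fin k → Subset r) e → (∀ f → f ≢ e → ∣ g f ∣ ≡ 0) → ∣ g e ∣ ≡ r → ∣ concat (tabulate g) ∣ ≡ r
  go g zero g0 gr = trans (∣++∣ (g zero) _)
      (trans (cong₂ ℕ._+_ gr (empty (g ∘ suc) λ f → g0 (suc f) λ ())) (ℕ.+-identityʳ r))
  go g (suc e) g0 gr = trans (∣++∣ (g zero) _)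
      (cong₂ ℕ._+_ (g0 zero λ ()) (go (g ∘ suc) e (λ f f≢e → g0 (suc f) (f≢e ∘ Fin.suc-injective)) gr))

power-uniform : ∀ {m G} → 2 ℕ.≤ m → Uniform 2 G → Uniform m (power m G)
power-uniform {m} {G} m≥2 uniform e = trans (∣++∣ (edge G e) _)
    (trans (cong₂ ℕ._+_ (uniform e) (∣block∣ (m ∸ 2) e)) (ℕ.m+[n∸m]≡n m≥2))

attachPendant-uniform : ∀ {m} (m≥2 : 2 ℕ.≤ m) {H} v → Uniform m H → Uniform m (attachPendant m≥2 H v)
attachPendant-uniform {m} m≥2 v uniform zero = trans (∣++∣ ⁅ v ⁆ (⊤ {m ∸ 1}))
    (trans (cong₂ ℕ._+_ (Subset.∣⁅x⁆∣≡1 v) (Subset.∣⊤∣≡n (m ∸ 1))) (ℕ.m+[n∸m]≡n (ℕ.≤-trans (s≤s z≤n) m≥2)))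
attachPendant-uniform {m} m≥2 {H} v uniform (suc e) = trans (∣++∣ (edge H e) (⊥ {m ∸ 1}))
    (trans (cong₂ ℕ._+_ (uniform e) (Subset.∣⊥∣≡0 (m ∸ 1))) (ℕ.+-identityʳ m))

attachPendants-uniform : ∀ {m} (m≥2 : 2 ℕ.≤ m) {H} v c → Uniform m H → Uniform m (attachPendants m≥2 H v c)
attachPendants-uniform m≥2 v zero uniform = uniform
attachPendants-uniform m≥2 v (suc c) uniform = attachPendants-uniform m≥2 _ c (attachPendant-uniform m≥2 v uniform)

cycleGraph-uniform : ∀ {l} (l≥3 : 3 ℕ.≤ l) → Uniform 2 (cycleGraph l≥3)
cycleGraph-uniform l≥3 i = ℕ.≤-antisym
  (ℕ.≤-trans (∣∪∣≤ ⁅ i ⁆ ⁅ next i ⁆) (ℕ.≤-reflexive (cong₂ ℕ._+_ (Subset.∣⁅x⁆∣≡1 i) (Subset.∣⁅x⁆∣≡1 (next i)))))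
  (two-elements⇒2≤card (Subset.x∈p∪q⁺ {p = ⁅ i ⁆} {⁅ next i ⁆} (inj₁ (Subset.x∈⁅x⁆ i)))
      (Subset.x∈p∪q⁺ {p = ⁅ i ⁆} {⁅ next i ⁆} (inj₂ (Subset.x∈⁅x⁆ (next i)))) (next≢ l≥3 i ∘ sym))
  where
  ∣∪∣≤ : ∀ {n} (p q : Subset n) → ∣ p ∪ q ∣ ℕ.≤ ∣ p ∣ ℕ.+ ∣ q ∣
  ∣∪∣≤ [] [] = z≤n
  ∣∪∣≤ (outside ∷ p) (outside ∷ q) = ∣∪∣≤ p q
  ∣∪∣≤ (outside ∷ p) (inside ∷ q) = ℕ.≤-trans (s≤s (∣∪∣≤ p q)) (ℕ.≤-reflexive (sym (ℕ.+-suc ∣ p ∣ ∣ q ∣)))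
  ∣∪∣≤ (inside ∷ p) (outside ∷ q) = s≤s (∣∪∣≤ p q)
  ∣∪∣≤ (inside ∷ p) (inside ∷ q) = s≤s (ℕ.≤-trans (∣∪∣≤ p q) (ℕ.+-monoʳ-≤ ∣ p ∣ (ℕ.n≤1+n ∣ q ∣)))

UC₁-uniform : ∀ {m l} (m≥2 : 2 ℕ.≤ m) (l≥3 : 3 ℕ.≤ l) c → Uniform m (UC₁ m≥2 l≥3 c)
UC₁-uniform {m} m≥2 l≥3 c = attachPendants-uniform m≥2 _ c
    (power-uniform {m} {cycleGraph l≥3} m≥2 (cycleGraph-uniform l≥3))

-- The graph is the same construction with m = 2; its m-th power and `UC₁` are both presented by
-- `end₁ᵁ` and `end₂ᵁ`.
UC₁-inPowers : ∀ {m n} (m≥2 : 2 ℕ.≤ m) (l≥3 : 3 ℕ.≤ suc n) c → InPowers m (UC₁ m≥2 l≥3 c)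
UC₁-inPowers {m} m≥2 l≥3 c = G , UC₁-uniform ℕ.≤-refl l≥3 c , IsPower⇒≅ (UC₁-isPower l≥3 m≥2 c)
    (power-isPower m (UC₁-isPower l≥3 ℕ.≤-refl c))
  where
  G = UC₁ {2} ℕ.≤-refl l≥3 c

-- Cycles in graphs and loose cycles in their powers

record Cycle {V E : Set} (s t : E → V) (l : ℕ) : Set where
  field
    length≥3 : 3 ℕ.≤ l
    v : Fin l → V
    e : Fin l → E
    v-injective : Injective _≡_ _≡_ v
    joins : ∀ i → Joins s t (e i) (v i) (v (next i))

  -- Equal edges have the same pair of ends. Traversed in the same direction they start at the same
  -- vertex; traversed in opposite directions they would give `next (next i) ≡ i`, impossible for
  -- length at least 3.
  e-injective : Injective _≡_ _≡_ e
  e-injective {i} {j} eq with joins i | subst (λ f → Joins s t f (v j) (v (next j))) (sym eq) (joins j)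
  ... | inj₁ (p , _) | inj₁ (q , _) = v-injective (trans p (sym q))
  ... | inj₂ (_ , p) | inj₂ (_ , q) = next-injective (v-injective (trans p (sym q)))
  ... | inj₁ (p , p′) | inj₂ (q , q′) = contradiction
      (trans (cong next (v-injective (trans p′ (sym q)))) (sym (v-injective (trans p (sym q′)))))
      (next-next≢ length≥3 i)
  ... | inj₂ (p , p′) | inj₁ (q , q′) = contradiction
      (trans (cong next (v-injective (trans p′ (sym q)))) (sym (v-injective (trans p (sym q′)))))
      (next-next≢ length≥3 i)

module _ {m H} {V E : Set} {s t : E → V} (P : IsPower m H s t) where
  open IsPower P
  open Ends s t

  private
    inc : ∀ {x e} → x ∈ edge H e → PowerIncident s t (toV x) (toE e)
    inc {x} {e} = Equivalence.to (incidence′ x e)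

  -- The core vertices of a loose cycle lie in two edges, so they are vertices of the graph.
  fromLooseCycle : ∀ {l} (C : LooseCycle H l) → Σ (Cycle s t l) λ C′ → ∀ i → Cycle.e C′ i ≡ toE (LooseCycle.e C i)
  fromLooseCycle {l} C = record
    { length≥3 = length≥3
    ; v = core
    ; e = toE ∘ e
    ; v-injective = λ {i} {j} eq → v-injective
        (to-injective vert (trans (proj₂ (is-core i)) (trans (cong inj₁ eq) (sym (proj₂ (is-core j))))))
    ; joins = λ i → incident-≢ (λ eq → next≢ length≥3 i
        (sym (v-injective (to-injective vert
        (trans (proj₂ (is-core i)) (trans (cong inj₁ eq) (sym (proj₂ (is-core (next i))))))))))
        (subst (λ w → PowerIncident s t w (toE (e i))) (proj₂ (is-core i)) (inc (v∈ i)))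
        (subst (λ w → PowerIncident s t w (toE (e i))) (proj₂ (is-core (next i))) (inc (proj₁ (next-v∈ i))))
    } , λ _ → refl
    where
    open LooseCycle C
    next-v∈ : ∀ i → v (next i) ∈ edge H (e i) × v (next i) ∈ edge H (e (next i))
    next-v∈ i = Subset.x∈p∩q⁻ (edge H (e i)) (edge H (e (next i)))
        (subst (v (next i) ∈_) (sym (consecutive i)) (Subset.x∈⁅x⁆ _))
    prev-v∈ : ∀ i → v i ∈ edge H (e (prev i)) × v i ∈ edge H (e i)
    prev-v∈ i = subst (λ j → v j ∈ edge H (e (prev i)) × v j ∈ edge H (e j)) (next-prev i) (next-v∈ (prev i))
    v∈ : ∀ i → v i ∈ edge H (e i)
    v∈ i = proj₂ (prev-v∈ i)
    core-of : ∀ w f g → f ≢ g → PowerIncident s t w f → PowerIncident s t w g → ∃[ a ] w ≡ inj₁ a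
    core-of (inj₁ a) f g _ _ _ = a , refl
    core-of (inj₂ (h , _)) f g f≢g p q = contradiction (trans (sym p) q) f≢g
    is-core : ∀ i → ∃[ a ] toV (v i) ≡ inj₁ a
    is-core i = core-of (toV (v i)) (toE (e (prev i))) (toE (e i))
      (λ eq → next≢ length≥3 (prev i) (trans (next-prev i) (sym (e-injective (to-injective edg eq)))))
      (inc (proj₁ (prev-v∈ i))) (inc (v∈ i))
    core : Fin l → V
    core i = proj₁ (is-core i)

  -- Distinct edges of a power share no inner vertex, so their intersections are those of the graph
  -- cycle.
  toLooseCycle : ∀ {l} (C : Cycle s t l) → Σ (LooseCycle H l) λ C′ → ∀ i → LooseCycle.e C′ i ≡ fromE (Cycle.e C i)
  toLooseCycle {l} C = record
    { length≥3 = length≥3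
    ; v = λ i → fromV (inj₁ (v i))
    ; e = fromE ∘ e
    ; v-injective = λ eq → v-injective (inj₁-injective (from-injective vert eq))
    ; e-injective = λ eq → e-injective (from-injective edg eq)
    ; consecutive = λ i → Subset.⊆-antisym (shared i) (shared′ i)
    ; disjoint = λ { {i} {j} i≢j j≢ i≢ (x , x∈) → apart i≢j j≢ i≢ (toV x)
        (on i (proj₁ (Subset.x∈p∩q⁻ (edge H (fromE (e i))) (edge H (fromE (e j))) x∈)))
        (on j (proj₂ (Subset.x∈p∩q⁻ (edge H (fromE (e i))) (edge H (fromE (e j))) x∈))) }
    } , λ _ → refl
    where
    open Cycle C
    on : ∀ i {x} → x ∈ edge H (fromE (e i)) → PowerIncident s t (toV x) (e i)
    on i {x} x∈ = subst (PowerIncident s t (toV x)) (toE∘fromE (e i)) (inc x∈)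
    meet : ∀ {i j} → i ≢ j → ∀ w → PowerIncident s t w (e i) → PowerIncident s t w (e j) →
           ∃[ a ] w ≡ inj₁ a × (a ≡ v i ⊎ a ≡ v (next i)) × (a ≡ v j ⊎ a ≡ v (next j))
    meet i≢j (inj₁ a) p q = a , refl , incident-joins a (joins _) p , incident-joins a (joins _) q
    meet i≢j (inj₂ (f , _)) p q = contradiction (e-injective (trans (sym p) q)) i≢j
    apart : ∀ {i j} → i ≢ j → j ≢ next i → i ≢ next j → ∀ w → PowerIncident s t w (e i) → ¬ PowerIncident s t w (e j)
    apart i≢j j≢ i≢ w p q with meet i≢j w p q
    ... | a , _ , inj₁ x , inj₁ y = i≢j (v-injective (trans (sym x) y))
    ... | a , _ , inj₁ x , inj₂ y = i≢ (v-injective (trans (sym x) y))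
    ... | a , _ , inj₂ x , inj₁ y = j≢ (v-injective (trans (sym y) x))
    ... | a , _ , inj₂ x , inj₂ y = i≢j (next-injective (v-injective (trans (sym x) y)))
    shared : ∀ i {x} → x ∈ edge H (fromE (e i)) ∩ edge H (fromE (e (next i))) → x ∈ ⁅ fromV (inj₁ (v (next i))) ⁆
    shared i {x} x∈ = subst (_∈ ⁅ fromV (inj₁ (v (next i))) ⁆) (trans (cong fromV (sym x≡)) (fromV∘toV x))
        (Subset.x∈⁅x⁆ _)
      where
      x∈₁ = proj₁ (Subset.x∈p∩q⁻ (edge H (fromE (e i))) (edge H (fromE (e (next i)))) x∈)
      x∈₂ = proj₂ (Subset.x∈p∩q⁻ (edge H (fromE (e i))) (edge H (fromE (e (next i)))) x∈)
      x≡ : toV x ≡ inj₁ (v (next i))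
      x≡ with meet (λ eq → next≢ length≥3 i (sym eq)) (toV x) (on i x∈₁) (on (next i) x∈₂)
      ... | a , w≡ , inj₂ p , _ = trans w≡ (cong inj₁ p)
      ... | a , w≡ , inj₁ p , inj₁ q = contradiction (v-injective (trans (sym q) p)) (next≢ length≥3 i)
      ... | a , w≡ , inj₁ p , inj₂ q = contradiction (v-injective (trans (sym q) p)) (next-next≢ length≥3 i)
    shared′ : ∀ i {x} → x ∈ ⁅ fromV (inj₁ (v (next i))) ⁆ → x ∈ edge H (fromE (e i)) ∩ edge H (fromE (e (next i)))
    shared′ i {x} x∈ = subst (_∈ edge H (fromE (e i)) ∩ edge H (fromE (e (next i)))) (sym (Subset.x∈⁅y⁆⇒x≡y _ x∈))
      (Subset.x∈p∩q⁺ (Equivalence.from (incidence _ (e i)) (joinsʳ (joins i)) , Equivalence.from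
          (incidence _ (e (next i))) (joinsˡ (joins (next i)))))

-- Unicyclic graphs

SameEdges : {V E : Set} {s t : E → V} {l l′ : ℕ} → Cycle s t l → Cycle s t l′ → Set
SameEdges C C′ = ∀ f → (∃[ i ] Cycle.e C i ≡ f) ⇔ (∃[ j ] Cycle.e C′ j ≡ f)

module _ {n} (l≥3 : 3 ℕ.≤ suc n) {c : ℕ} where
  private
    s t : Fin (suc n) ⊎ Fin c → Fin (suc n) ⊎ Fin c
    s = end₁ᵁ {n} {c}
    t = end₂ᵁ {n} {c}
    open Ends s t

  UC-cycle : Cycle s t (suc n)
  UC-cycle = record
    { length≥3 = l≥3 ; v = inj₁ ; e = inj₁ ; v-injective = inj₁-injective ; joins = λ i → inj₁ (refl , refl) }

  -- A cycle vertex lies on two distinct edges of the cycle but a leaf on only one edge, so no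
  -- pendant edge is used. From one core edge the cycle has to continue with the only other core
  -- edge at `next i`, and thus goes all the way round.
  UC-unicyclic : ∀ {l′} (C : Cycle s t l′) → SameEdges UC-cycle C
  UC-unicyclic {zero} C = contradiction (Cycle.length≥3 C) λ ()
  UC-unicyclic {suc n′} C f = mk⇔ (λ { (i , refl) → all-covered i }) (λ { (j , refl) → not-pendant j (e j) refl })
    where
    open Cycle C
    pendant-only : ∀ {a} f → Incident s t (inj₂ a) f → f ≡ inj₂ a
    pendant-only (inj₁ i) (inj₁ ())
    pendant-only (inj₁ i) (inj₂ ())
    pendant-only (inj₂ b) (inj₁ ())
    pendant-only (inj₂ b) (inj₂ refl) = refl
    v∈₁ : ∀ j → Incident s t (v j) (e j)
    v∈₁ j = joinsˡ {e j} (joins j)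
    v∈₂ : ∀ j → Incident s t (v (next j)) (e j)
    v∈₂ j = joinsʳ {e j} (joins j)
    v∈₃ : ∀ j → Incident s t (v j) (e (prev j))
    v∈₃ j = subst (λ i → Incident s t (v i) (e (prev j))) (next-prev j) (v∈₂ (prev j))
    v≢pendant : ∀ j a → v j ≢ inj₂ a
    v≢pendant j a eq = next≢ length≥3 (prev j) (trans (next-prev j) (e-injective (trans
      (pendant-only (e j) (subst (λ w → Incident s t w (e j)) eq (v∈₁ j)))
      (sym (pendant-only (e (prev j)) (subst (λ w → Incident s t w (e (prev j))) eq (v∈₃ j)))))))
    not-pendant : ∀ j f → e j ≡ f → ∃[ i ] inj₁ i ≡ f
    not-pendant j (inj₁ i) _ = i , refl
    not-pendant j (inj₂ a) eq with joins j
    ... | inj₁ (_ , p) = contradiction (trans p (cong t eq)) (v≢pendant (next j) a)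
    ... | inj₂ (p , _) = contradiction (trans p (cong t eq)) (v≢pendant j a)
    Covered : Fin (suc n) → Set
    Covered i = ∃[ j ] e j ≡ inj₁ i
    core-edges : ∀ {i i′} → Incident s t (inj₁ (next i)) (inj₁ i′) → inj₁ {B = Fin c} i′ ≢ inj₁ i → i′ ≡ next i
    core-edges (inj₁ refl) _ = refl
    core-edges (inj₂ eq) i′≢i = contradiction (cong inj₁ (sym (next-injective (inj₁-injective eq)))) i′≢i
    other-edge : ∀ {i} j j′ → e j ≡ inj₁ i → e j′ ≢ e j → Incident s t (inj₁ (next i)) (e j′) → Covered (next i)
    other-edge j j′ eq neq p with not-pendant j′ (e j′) refl
    ... | i′ , eq′ = j′ , trans (sym eq′)
        (cong inj₁ (core-edges (subst (Incident s t _) (sym eq′) p) (λ q → neq (trans (sym eq′) (trans q (sym eq))))))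
    advance : ∀ i → Covered i → Covered (next i)
    -- `C` may run through core edge `i` in either direction; accordingly the edge at `next i` is
    -- its successor or its predecessor in `C`.
    advance i (j , eq) with subst (λ f → Joins s t f (v j) (v (next j))) eq (joins j)
    ... | inj₁ (_ , p) = other-edge j (next j) eq (λ q → next≢ length≥3 j (e-injective q))
        (subst (λ w → Incident s t w (e (next j))) p (v∈₁ (next j)))
    ... | inj₂ (p , _) = other-edge j (prev j) eq
        (λ q → next≢ length≥3 (prev j) (trans (next-prev j) (sym (e-injective q))))
        (subst (λ w → Incident s t w (e (prev j))) p (v∈₃ j))
    all-covered : ∀ i → Covered i
    all-covered = let i , eq = not-pendant zero (e zero) refl in next-closed⇒all Covered advance (zero , sym eq)

-- Closing a detour around an edge to a cycle.

snoc : ∀ {A : Set} {n} → (Fin n → A) → A → Fin (suc n) → A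
snoc {n = zero} f x _ = x
snoc {n = suc n} f x zero = f zero
snoc {n = suc n} f x (suc i) = snoc (f ∘ suc) x i

snoc-inject₁ : ∀ {A : Set} {n} (f : Fin n → A) x i → snoc f x (inject₁ i) ≡ f i
snoc-inject₁ f x zero = refl
snoc-inject₁ f x (suc i) = snoc-inject₁ (f ∘ suc) x i

snoc-fromℕ : ∀ {A : Set} n (f : Fin n → A) x → snoc f x (fromℕ n) ≡ x
snoc-fromℕ zero f x = refl
snoc-fromℕ (suc n) f x = snoc-fromℕ n (f ∘ suc) x

module _ {V E : Set} (s t : E → V) where
  Avoid : E → V → V → Set
  Avoid e a b = ∃[ f ] f ≢ e × Joins s t f a b

  module _ (_≟V_ : DecidableEquality V) (simple : IsSimple s t) (e : E) where
    open Ends s t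

    private
      record SimplePath (a b : V) : Set where
        field
          length : ℕ
          v : Fin (suc length) → V
          f : Fin length → E
          v-injective : Injective _≡_ _≡_ v
          start : v zero ≡ a
          end : v (fromℕ length) ≡ b
          avoids : ∀ i → f i ≢ e
          steps : ∀ i → Joins s t (f i) (v (inject₁ i)) (v (suc i))

      trivial : ∀ a → SimplePath a a
      trivial a = record
        { length = 0 ; v = λ _ → a ; f = λ () ; v-injective = λ { {zero} {zero} _ → refl } ; start = refl ; end =
            refl ; avoids = λ () ; steps = λ () }

      suffix : ∀ {a b} (p : SimplePath a b) j → SimplePath (SimplePath.v p j) b
      suffix p zero = record { SimplePath p hiding (start) ; start = refl }
      suffix record { length = suc n ; v = v ; f = f ; v-injective = inj ; start = start ; end = end ; avoids =
          avoids ; steps = steps } (suc j) =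
        suffix {a = v (suc zero)} record { length = n ; v = v ∘ suc ; f = f ∘ suc ; v-injective = λ eq →
            Fin.suc-injective (inj eq) ; start = refl ; end = end ; avoids = avoids ∘ suc ; steps = steps ∘ suc } j

      -- Loop erasure: if `a` already occurs on the path, only the part from that occurrence on is
      -- kept.
      cons : ∀ {a b c} g → g ≢ e → Joins s t g a b → SimplePath b c → SimplePath a c
      cons {a} {b} {c} g g≢e j p with any? (λ i → a ≟V SimplePath.v p i)
      ... | yes (i , a≡) = subst (λ x → SimplePath x c) (sym a≡) (suffix p i)
      ... | no a∉ = record
        { length = suc length
        ; v = λ { zero → a ; (suc i) → v i }
        ; f = λ { zero → g ; (suc i) → f i }
        ; v-injective = λ { {zero} {zero} _ → refl ; {zero} {suc k} eq → contradiction
            (k , eq) a∉ ; {suc k} {zero} eq → contradiction (k , sym eq) a∉ ; {suc k} {suc k′} eq → cong suc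
            (v-injective eq) }
        ; start = refl
        ; end = end
        ; avoids = λ { zero → g≢e ; (suc i) → avoids i }
        ; steps = λ { zero → subst (Joins s t g a) (sym start) j ; (suc i) → steps i }
        }
        where open SimplePath p

      simplify : ∀ {a b} → Star (Avoid e) a b → SimplePath a b
      simplify ε = trivial _
      simplify ((g , g≢e , j) ◅ path) = cons g g≢e j (simplify path)

    -- The loop-erased detour closes up with `e`. Length 0 would make `e` a loop and length 1 would
    -- give an edge parallel to `e`, so the cycle has length at least 3.
    detour⇒cycle : Star (Avoid e) (s e) (t e) → ∃[ l ] Σ (Cycle s t l) λ C → ∃[ i ] Cycle.e C i ≡ e
    detour⇒cycle path = close (simplify path)
      where
      close : SimplePath (s e) (t e) → ∃[ l ] Σ (Cycle s t l) λ C → ∃[ i ] Cycle.e C i ≡ e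
      close record { length = 0 ; start = start ; end = end } = contradiction (trans (sym start) end)
          (IsSimple.loopless simple e)
      close record { length = 1 ; start = start ; end = end ; avoids = avoids ; steps = steps } =
        contradiction (IsSimple.no-multi simple (steps zero) (inj₁ (start , end))) (avoids zero)
      close record { length = n@(suc (suc _)) ; v = v ; f = f ; v-injective = inj ; start = start ; end =
          end ; avoids = avoids ; steps = steps } =
        suc n , record
          { length≥3 = s≤s (s≤s (s≤s z≤n))
          ; v = v
          ; e = snoc f e
          ; v-injective = inj
          ; joins = joins
          } , fromℕ n , snoc-fromℕ n f e
        where
        joins-resp : ∀ {g g′ a a′ b b′} → g ≡ g′ → a ≡ a′ → b ≡ b′ → Joins s t g′ a′ b′ → Joins s t g a b
        joins-resp refl refl refl j = j
        joins : ∀ i → Joins s t (snoc f e i) (v i) (v (next i))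
        joins i with view i
        ... | ‵fromℕ = joins-resp (snoc-fromℕ n f e) end (trans (cong v (next-fromℕ n)) start) (inj₂ (refl , refl))
        ... | ‵inject₁ j = joins-resp (snoc-inject₁ f e j) refl (cong v (next-inject₁ j)) (steps j)

-- Shifting a unicyclic graph onto UC_l(c₁)

bijection : ∀ {A B : Set} (f : A → B) → Injective _≡_ _≡_ f → (∀ b → ∃[ a ] f a ≡ b) → A ↔ B
bijection f inj surj = mk↔ₛ′ f (proj₁ ∘ surj) (proj₂ ∘ surj) (λ a → inj (proj₂ (surj (f a))))

-- Meant for the edges off the cycle. Their number `c` becomes the number of pendant edges; it is
-- identified with k - l only later, by comparing sizes.
enumerate : ∀ {k} (P : Fin k → Set) → (∀ e → Dec (P e)) →
  ∃[ c ] Σ (Fin c → Fin k) λ g → Injective _≡_ _≡_ g × (∀ a → P (g a)) × (∀ e → P e → ∃[ a ] g a ≡ e)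
enumerate {zero} P P? = 0 , (λ ()) , (λ { {()} }) , (λ ()) , λ ()
enumerate {suc k} P P? with enumerate (P ∘ suc) (P? ∘ suc) | P? zero
... | c , g , inj , sound , complete | no ¬p = c , suc ∘ g , (λ eq → inj (Fin.suc-injective eq)) , sound , λ
  { zero p → contradiction p ¬p ; (suc e) p → let a , eq = complete e p in a , cong suc eq }
... | c , g , inj , sound , complete | yes p = suc c , (λ { zero → zero ; (suc a) → suc (g a) })
  , (λ { {zero} {zero} _ → refl ; {suc a} {suc b} eq → cong suc (inj (Fin.suc-injective eq)) })
  , (λ { zero → p ; (suc a) → sound a })
  , λ { zero _ → zero , refl ; (suc e) p → let a , eq = complete e p in suc a , cong suc eq }

-- The edge e of the graph (s , t) becomes an edge between a and b by keeping its ends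
-- or by replacing one of them by u.
EdgeShift : {V E : Set} (s t : E → V) (u : V) → E → V → V → Set
EdgeShift s t u e a b = Joins s t e a b
  ⊎ (∃[ y ] ∃[ p ] p ≢ u × Joins s t e y p × ((a ≡ u × b ≡ y) ⊎ (a ≡ y × b ≡ u)))

-- The maps go from the target to the source: the new graph is read as a graph on the old vertices,
-- so that a weighting of the old vertices can be evaluated on it.
record Shifts {V E V′ E′ : Set} (s t : E → V) (s′ t′ : E′ → V′) (u : V) : Set where
  field
    φ : V′ ↔ V
    ψ : E′ ↔ E
    shifted : ∀ e → EdgeShift s t u (Inverse.to ψ e) (Inverse.to φ (s′ e)) (Inverse.to φ (t′ e))

rotation : ∀ {n} (j : Fin (suc n)) → Σ (Fin (suc n) → Fin (suc n)) λ ρ →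
  Injective _≡_ _≡_ ρ × (∀ i → ρ (next i) ≡ next (ρ i)) × ρ zero ≡ j × (∀ i → ∃[ i′ ] ρ i′ ≡ i)
rotation = <-weakInduction _ (id , id , (λ _ → refl) , refl , λ i → i , refl)
  λ j (ρ , inj , comm , start , surj) → next ∘ ρ , (λ eq → inj (next-injective eq)) , cong next ∘ comm
    , trans (cong next start) (next-inject₁ j)
    , λ i → let i′ , eq = surj (prev i) in i′ , trans (cong next eq) (next-prev i)

module _ {V E : Set} {s t : E → V} {l : ℕ} (C : Cycle s t l) where
  OffCycle : V → Set
  OffCycle x = ∀ i → Cycle.v C i ≢ x

  NonCycle : E → Set
  NonCycle e = ∀ i → Cycle.e C i ≢ e

  -- A path of such steps ending on the cycle meets it only in its last vertex, which serves as the
  -- vertex of the cycle nearest to the start.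
  Approach : V → V → Set
  Approach x y = OffCycle x × Adj s t x y

module _ (dec : (P : Set) → Dec P) {V : Set} {k : ℕ} (s t : Fin k → V) (simple : IsSimple s t)
    (connected : GraphConnected s t) {n : ℕ} where
  open Ends s t

  private
    first-hit : (C : Cycle s t (suc n)) → ∀ {u w} → Star (Adj s t) u w → (∃[ i ] Cycle.v C i ≡ w) → ∃[ j ] Star
        (Approach C) u (Cycle.v C j)
    first-hit C ε (i , refl) = i , ε
    first-hit C {u} (step ◅ path) w∈C with dec (∃[ i ] Cycle.v C i ≡ u)
    ... | yes (i , refl) = i , ε
    ... | no u∉C = let j , hit = first-hit C path w∈C in j , ((λ i eq → u∉C (i , eq)) , step) ◅ hit

    module Rooted (C : Cycle s t (suc n)) (bridge : ∀ e → NonCycle C e → ¬ Star (Avoid s t e) (s e) (t e))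
                  (u : V) (hit : Star (Approach C) u (Cycle.v C zero)) where
      open Cycle C

      Reach : Fin k → V → Set
      Reach f = Star (Avoid s t f) u

      -- The path is followed until it first uses `f`; at that moment an end of `f` has been reached
      -- without `f`.
      extend : ∀ {f x y} → Reach f x → Star (Adj s t) x y → Reach f y ⊎ (Reach f (s f) ⊎ Reach f (t f))
      extend r ε = inj₁ r
      extend {f} {x} r ((g , j) ◅ path) with g ≟ f
      ... | no g≢f = extend (r ◅◅ ((g , g≢f , j) ◅ ε)) path
      ... | yes refl with joinsˡ j
      ... | inj₁ refl = inj₂ (inj₁ r)
      ... | inj₂ refl = inj₂ (inj₂ r)

      -- A bridge separates its child end from u.
      record Child (f : Fin k) : Set where
        field
          child parent : V
          ends : Joins s t f child parent
          reached : Reach f parent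
          unreached : ¬ Reach f child

      open Child

      -- By connectedness some end of `f` is reached without `f`. If both were, the two paths would
      -- join the ends of `f` around it, against `bridge`.
      orient : ∀ f → NonCycle C f → Child f
      orient f f∉C with extend {f} ε (connected u (s f))
      ... | inj₁ r = record { child = t f ; parent = s f ; ends = inj₂ (refl , refl) ; reached = r ; unreached =
          λ r′ → bridge f f∉C (reverse (λ { (g , p , j) → g , p , joins-sym j }) r ◅◅ r′) }
      ... | inj₂ (inj₁ r) = record { child = t f ; parent = s f ; ends = inj₂ (refl , refl) ; reached =
          r ; unreached = λ r′ → bridge f f∉C (reverse (λ { (g , p , j) → g , p , joins-sym j }) r ◅◅ r′) }
      ... | inj₂ (inj₂ r) = record { child = s f ; parent = t f ; ends = inj₁ (refl , refl) ; reached =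
          r ; unreached = λ r′ → bridge f f∉C (reverse (λ { (g , p , j) → g , p , joins-sym j }) r′ ◅◅ r) }

      child-irrelevant : ∀ {f} (c c′ : Child f) → child c ≡ child c′
      child-irrelevant {f} c c′ with incident-joins _ (ends c) (joinsˡ (ends c′))
      ... | inj₁ eq = sym eq
      ... | inj₂ eq = contradiction (subst (Reach f) (sym eq) (reached c)) (unreached c′)

      u≢child : ∀ {f} (c : Child f) → u ≢ child c
      u≢child {f} c u≡ = unreached c (subst (Reach f) u≡ ε)

      Outside : V → V → V → Set
      Outside w x y = ∃[ g ] ¬ Incident s t w g × Joins s t g x y

      -- The path is cut at its first visit to `w`, so what precedes the edge into `w` avoids every
      -- edge at `w`, whichever of them later has to be avoided. `P` preserves what is known about
      -- the vertex before `w`.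
      last-edge : ∀ {P : V → Set} {x w} → x ≢ w → Star (λ x y → P x × Adj s t x y) x w →
        ∃[ f ] ∃[ q ] Joins s t f q w × P q × Star (Outside w) x q
      last-edge x≢w ε = contradiction refl x≢w
      last-edge {x = x} {w} x≢w (_◅_ {j = y} (px , g , j) path) with dec (y ≡ w)
      ... | yes refl = g , x , j , px , ε
      ... | no y≢w with last-edge y≢w path
      ... | f , q , j′ , pq , rest = f , q , j′ , pq ,
          (g , (λ w∈g → [ x≢w ∘ sym , y≢w ∘ sym ]′ (incident-joins w j w∈g)) , j) ◅ rest

      outside⇒reach : ∀ {f w} → Incident s t w f → ∀ {q} → Star (Outside w) u q → Reach f q
      outside⇒reach w∈f ε-or-path = go ε-or-path
        where
        go : ∀ {x q} → Star (Outside _) x q → Star (Avoid s t _) x q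
        go ε = ε
        go ((g , w∉g , j) ◅ path) = (g , (λ { refl → w∉g w∈f }) , j) ◅ go path

      -- Take the edge `g` by which a path from `u` enters the child. Any edge with this child must
      -- be `g`, since otherwise the path followed by `g` reaches the child without that edge.
      child-injective : ∀ {f f′} (c : Child f) (c′ : Child f′) → child c ≡ child c′ → f ≡ f′
      child-injective c c′ eq with last-edge {P = λ _ → Unit} (u≢child c)
          (Star.map (λ a → tt , a) (connected u (child c)))
      ... | g , q , j , _ , path = trans (sym (is c refl)) (is c′ eq)
        where
        is : ∀ {f} (c″ : Child f) → child c ≡ child c″ → g ≡ f
        is {f} c″ eq with g ≟ f
        ... | yes g≡f = g≡f
        ... | no g≢f = contradiction (outside⇒reach
            (subst (λ w → Incident s t w f) (sym eq) (joinsˡ (ends c″))) path ◅◅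
            ((g , g≢f , subst (Joins s t g q) eq j) ◅ ε)) (unreached c″)

      core-reach : ∀ {f} → NonCycle C f → ∀ i → Star (Avoid s t f) (v zero) (v i)
      core-reach f∉C = <-weakInduction _ ε λ i path → path ◅◅
          ((e (inject₁ i) , f∉C (inject₁ i) , subst (λ j → Joins s t (e (inject₁ i)) (v (inject₁ i)) (v j))
          (next-inject₁ i) (joins (inject₁ i))) ◅ ε)

      -- The path `hit` has no vertex on the cycle except `v zero`, so it cannot use an edge ending
      -- at another `v i`. Going on around the cycle, which does not contain `f`, would reach the
      -- child without `f`.
      child-on-cycle : ∀ {f} → NonCycle C f → (c : Child f) → ∀ i → v i ≡ child c → i ≡ zero
      child-on-cycle {f} f∉C c i vi≡c with i ≟ zero
      ... | yes i≡0 = i≡0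
      ... | no i≢0 = contradiction (subst (Reach f) vi≡c (walk hit ◅◅ core-reach f∉C i)) (unreached c)
        where
        walk : ∀ {x} → Star (Approach C) x (v zero) → Star (Avoid s t f) x (v zero)
        walk ε = ε
        walk ((x∉C , g , j) ◅ path) with g ≟ f
        ... | no g≢f = (g , g≢f , j) ◅ walk path
        ... | yes refl with incident-joins _ j (joinsˡ (ends c))
        ... | inj₁ c≡x = contradiction (trans vi≡c c≡x) (x∉C i)
        ... | inj₂ c≡y with path
        ... | ε = contradiction (v-injective (trans vi≡c c≡y)) i≢0
        ... | (y∉C , _) ◅ _ = contradiction (trans vi≡c c≡y) (y∉C i)

      u-on-cycle : ∀ i → v i ≡ u → i ≡ zero
      u-on-cycle i vi≡u = at-start hit vi≡u
        where
        at-start : ∀ {x} → Star (Approach C) x (v zero) → v i ≡ x → i ≡ zero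
        at-start ε vi≡x = v-injective vi≡x
        at-start ((x∉C , _) ◅ _) vi≡x = contradiction vi≡x (x∉C i)

      off-cycle-end : ∀ {f q w} → Joins s t f q w → OffCycle C q → NonCycle C f
      off-cycle-end {q = q} j q∉C i refl with incident-joins q (joins i) (joinsˡ j)
      ... | inj₁ eq = q∉C i (sym eq)
      ... | inj₂ eq = q∉C (next i) (sym eq)

      -- The surjectivity half of the matching: besides `u` and the cycle vertices other than
      -- `v zero`, every vertex is the far end of exactly one edge off the cycle.
      is-child : ∀ w → u ≢ w → (∀ i → v i ≡ w → i ≡ zero) → ∃[ f ] NonCycle C f × Σ (Child f) λ c → child c ≡ w
      is-child w u≢w w∉C = found (dec (v zero ≡ w))
        where
        as-child : ∀ {f q} → Joins s t f q w → NonCycle C f → Star (Outside w) u q → ∃[ f ] NonCycle C f × Σ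
            (Child f) λ c → child c ≡ w
        as-child {f} {q} j f∉C path with orient f f∉C
        ... | c with incident-joins _ j (joinsˡ (ends c))
        ... | inj₁ c≡q = contradiction (subst (Reach f) (sym c≡q) (outside⇒reach (joinsʳ j) path)) (unreached c)
        ... | inj₂ c≡w = f , f∉C , c , c≡w
        found : Dec (v zero ≡ w) → ∃[ f ] NonCycle C f × Σ (Child f) λ c → child c ≡ w
        -- An arbitrary path could enter `v zero` by a cycle edge. Along `hit` the vertex before it
        -- is off the cycle, hence so is the edge.
        found (yes refl) = let f , q , j , q∉C , path = last-edge u≢w hit in as-child j (off-cycle-end j q∉C) path
        found (no v0≢w)  = let f , q , j , _ , path = last-edge {P = λ _ → Unit} u≢w (Star.map (λ a → tt , a) (connected u w)) in
          as-child j (off-cycle-end (joins-sym j) λ i eq → v0≢w (trans (cong v (sym (w∉C i eq))) eq)) path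

      private
        enumeration = enumerate (NonCycle C) (λ f → dec (NonCycle C f))

      c : ℕ
      c = proj₁ enumeration
      g : Fin c → Fin k
      g = proj₁ (proj₂ enumeration)
      g-injective : Injective _≡_ _≡_ g
      g-injective = proj₁ (proj₂ (proj₂ enumeration))
      g-noncycle : ∀ a → NonCycle C (g a)
      g-noncycle = proj₁ (proj₂ (proj₂ (proj₂ enumeration)))
      g-complete : ∀ f → NonCycle C f → ∃[ a ] g a ≡ f
      g-complete = proj₂ (proj₂ (proj₂ (proj₂ enumeration)))

      oriented : ∀ a → Child (g a)
      oriented a = orient (g a) (g-noncycle a)

      -- If `v zero` differs from `u`, it is the child of the edge by which `hit` reaches the cycle,
      -- and so reappears among the leaves.
      label : Fin (suc n) ⊎ Fin c → V
      label (inj₁ zero) = u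
      label (inj₁ (suc i)) = v (suc i)
      label (inj₂ a) = child (oriented a)

      label-injective : Injective _≡_ _≡_ label
      label-injective {inj₁ zero} {inj₁ zero} _ = refl
      label-injective {inj₁ zero} {inj₁ (suc i)} eq = contradiction (u-on-cycle (suc i) (sym eq)) λ ()
      label-injective {inj₁ (suc i)} {inj₁ zero} eq = contradiction (u-on-cycle (suc i) eq) λ ()
      label-injective {inj₁ (suc i)} {inj₁ (suc j)} eq = cong inj₁ (v-injective eq)
      label-injective {inj₁ zero} {inj₂ a} eq = contradiction eq (u≢child (oriented a))
      label-injective {inj₂ a} {inj₁ zero} eq = contradiction (sym eq) (u≢child (oriented a))
      label-injective {inj₁ (suc i)} {inj₂ a} eq = contradiction
          (child-on-cycle (g-noncycle a) (oriented a) (suc i) eq) λ ()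
      label-injective {inj₂ a} {inj₁ (suc i)} eq = contradiction
          (child-on-cycle (g-noncycle a) (oriented a) (suc i) (sym eq)) λ ()
      label-injective {inj₂ a} {inj₂ b} eq = cong inj₂ (g-injective (child-injective (oriented a) (oriented b) eq))

      label-surjective : ∀ w → ∃[ x ] label x ≡ w
      label-surjective w with dec (u ≡ w)
      ... | yes u≡w = inj₁ zero , u≡w
      ... | no u≢w with any? (λ i → dec (v (suc i) ≡ w))
      ... | yes (i , eq) = inj₁ (suc i) , eq
      ... | no w∉C with is-child w u≢w (λ { zero _ → refl ; (suc i) eq → contradiction (i , eq) w∉C })
      ... | f , f∉C , ch , eq with g-complete f f∉C
      ... | a , refl = inj₂ a , trans (child-irrelevant (oriented a) ch) eq

      edgeLabel : Fin (suc n) ⊎ Fin c → Fin k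
      edgeLabel (inj₁ i) = e i
      edgeLabel (inj₂ a) = g a

      edgeLabel-injective : Injective _≡_ _≡_ edgeLabel
      edgeLabel-injective {inj₁ i} {inj₁ j} eq = cong inj₁ (e-injective eq)
      edgeLabel-injective {inj₁ i} {inj₂ a} eq = contradiction eq (g-noncycle a i)
      edgeLabel-injective {inj₂ a} {inj₁ i} eq = contradiction (sym eq) (g-noncycle a i)
      edgeLabel-injective {inj₂ a} {inj₂ b} eq = cong inj₂ (g-injective eq)

      edgeLabel-surjective : ∀ f → ∃[ x ] edgeLabel x ≡ f
      edgeLabel-surjective f with any? (λ i → e i ≟ f)
      ... | yes (i , eq) = inj₁ i , eq
      ... | no f∉C = let a , eq = g-complete f (λ i eq → f∉C (i , eq)) in inj₂ a , eq

      -- Covers the degenerate case `p ≡ u`, in which the edge keeps its ends. `EdgeShift` excludes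
      -- it from its second alternative, so that this alternative always means a genuine change.
      replace : ∀ {f y p a b} → Joins s t f y p → ((a ≡ u × b ≡ y) ⊎ (a ≡ y × b ≡ u)) → EdgeShift s t u f a b
      replace {p = p} j ends with dec (p ≡ u)
      ... | no p≢u = inj₂ (_ , _ , p≢u , j , ends)
      replace j (inj₁ (refl , refl)) | yes refl = inj₁ (joins-sym j)
      replace j (inj₂ (refl , refl)) | yes refl = inj₁ j

      edge-shifts : ∀ x → EdgeShift s t u (edgeLabel x) (label (end₁ᵁ x)) (label (end₂ᵁ x))
      edge-shifts (inj₂ a) = replace (ends (oriented a)) (inj₁ (refl , refl))
      edge-shifts (inj₁ zero) with next {suc n} zero in eq
      ... | zero = contradiction eq (next≢ length≥3 zero)
      ... | suc i = replace (joins-sym (subst (λ j → Joins s t (e zero) (v zero) (v j)) eq (joins zero)))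
          (inj₁ (refl , refl))
      edge-shifts (inj₁ (suc i)) with next (suc i) in eq
      ... | zero = replace (subst (λ j → Joins s t (e (suc i)) (v (suc i)) (v j)) eq (joins (suc i)))
          (inj₂ (refl , refl))
      ... | suc j = inj₁ (subst (λ j → Joins s t (e (suc i)) (v (suc i)) (v j)) eq (joins (suc i)))

      shifts : Shifts s t (end₁ᵁ {n} {c}) end₂ᵁ u
      shifts = record
        { φ = bijection label label-injective label-surjective
        ; ψ = bijection edgeLabel edgeLabel-injective edgeLabel-surjective
        ; shifted = edge-shifts
        }

  -- Root the graph at u, let the vertex of the cycle nearest to u change places with u,
  -- and make every edge off the cycle pendant at u, keeping the end away from u.
  shifts-onto-UC : (C : Cycle s t (suc n)) (bridge : ∀ e → NonCycle C e → ¬ Star (Avoid s t e) (s e) (t e)) (u : V) →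
    ∃[ c ] Σ (Shifts s t (end₁ᵁ {n} {c}) end₂ᵁ u) λ S → Inverse.to (Shifts.φ S) (inj₁ zero) ≡ u
  shifts-onto-UC C bridge u = Root.c , Root.shifts , refl
    where
    hit = first-hit C (connected u (Cycle.v C zero)) (zero , refl)
    j = proj₁ hit
    ρ = proj₁ (rotation j)
    ρ-inj = proj₁ (proj₂ (rotation j))
    ρ-next = proj₁ (proj₂ (proj₂ (rotation j)))
    ρ-zero = proj₁ (proj₂ (proj₂ (proj₂ (rotation j))))
    ρ-surj = proj₂ (proj₂ (proj₂ (proj₂ (rotation j))))
    open Cycle C
    C′ : Cycle s t (suc n)
    C′ = record
      { length≥3 = length≥3 ; v = v ∘ ρ ; e = e ∘ ρ ; v-injective = λ eq → ρ-inj (v-injective eq)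
      ; joins = λ i → subst (λ j → Joins s t (e (ρ i)) (v (ρ i)) (v j)) (sym (ρ-next i)) (joins (ρ i)) }
    approach : ∀ {x y} → Star (Approach C) x y → Star (Approach C′) x y
    approach ε = ε
    approach ((x∉C , a) ◅ path) = ((λ i → x∉C (ρ i)) , a) ◅ approach path
    bridge′ : ∀ f → NonCycle C′ f → ¬ Star (Avoid s t f) (s f) (t f)
    bridge′ f f∉C′ = bridge f λ i → subst (λ i → e i ≢ f) (proj₂ (ρ-surj i)) (f∉C′ (proj₁ (ρ-surj i)))
    hit′ : Star (Approach C′) u (v (ρ zero))
    hit′ = subst (λ i → Star (Approach C′) u (v i)) (sym ρ-zero) (approach (proj₂ hit))
    module Root = Rooted C′ bridge′ u hit′

-- From a cycle of length l to a cycle of length l - 1.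

skipOne : ∀ {n} → Fin (suc n) → Fin (suc (suc n))
skipOne zero = zero
skipOne (suc i) = suc (suc i)

-- Edge i of the shorter cycle is edge i + 1 of the longer one; this makes their far ends agree, the
-- wrap-around included.
next-suc : ∀ {n} (i : Fin (suc n)) → next (suc i) ≡ skipOne (next i)
next-suc {n} i with view i
... | ‵fromℕ = trans (next-fromℕ (suc n)) (cong skipOne (sym (next-fromℕ n)))
... | ‵inject₁ j = trans (next-inject₁ (suc j)) (cong skipOne (sym (next-inject₁ j)))

-- The edge {1 , 2} of the longer cycle becomes {0 , 2}, and the edge {0 , 1} becomes pendant.
module _ {n c : ℕ} where
  private
    V = Fin (suc (suc n)) ⊎ Fin c
    V′ = Fin (suc n) ⊎ Fin (suc c)

  shortcutV shortcutE : V′ ↔ V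
  shortcutV = mk↔ₛ′
    (λ { (inj₁ i) → inj₁ (skipOne i) ; (inj₂ zero) → inj₁ (suc zero) ; (inj₂ (suc a)) → inj₂ a })
    (λ { (inj₁ zero) → inj₁ zero ; (inj₁ (suc zero)) → inj₂ zero ; (inj₁ (suc (suc i))) → inj₁ (suc i) ; (inj₂ a) →
        inj₂ (suc a) })
    (λ { (inj₁ zero) → refl ; (inj₁ (suc zero)) → refl ; (inj₁ (suc (suc i))) → refl ; (inj₂ a) → refl })
    (λ { (inj₁ zero) → refl ; (inj₁ (suc i)) → refl ; (inj₂ zero) → refl ; (inj₂ (suc a)) → refl })
  shortcutE = mk↔ₛ′
    (λ { (inj₁ i) → inj₁ (suc i) ; (inj₂ zero) → inj₁ zero ; (inj₂ (suc a)) → inj₂ a })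
    (λ { (inj₁ zero) → inj₂ zero ; (inj₁ (suc i)) → inj₁ i ; (inj₂ a) → inj₂ (suc a) })
    (λ { (inj₁ zero) → refl ; (inj₁ (suc i)) → refl ; (inj₂ a) → refl })
    (λ { (inj₁ i) → refl ; (inj₂ zero) → refl ; (inj₂ (suc a)) → refl })

  module _ (n≥2 : 2 ℕ.≤ n) {W E : Set} {s t : E → W} {u : W} (S : Shifts s t (end₁ᵁ {suc n} {c}) end₂ᵁ u)
           (φ0≡u : Inverse.to (Shifts.φ S) (inj₁ zero) ≡ u) where
    open Shifts S
    private
      φ→ = Inverse.to φ
      φ′→ : V′ → W
      φ′→ = φ→ ∘ Inverse.to shortcutV
      ψ′→ : V′ → E
      ψ′→ = Inverse.to ψ ∘ Inverse.to shortcutE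

      φ≢u : ∀ i → φ→ (inj₁ (suc i)) ≢ u
      φ≢u i eq = contradiction (to-injective φ (trans eq (sym φ0≡u))) λ ()

    Replaced : E → W → W → Set
    Replaced e a b = ∃[ y ] ∃[ p ] p ≢ u × Joins s t e y p × ((a ≡ u × b ≡ y) ⊎ (a ≡ y × b ≡ u))

    -- The edge {1 , 2} of the longer cycle does not contain the hub, so `S` leaves it unchanged.
    -- Hence this replacement of vertex 1 always takes place, which later makes the comparison
    -- strict for every hypergraph.
    first-replaced : Replaced (ψ′→ (inj₁ zero)) (φ′→ (end₁ᵁ (inj₁ zero))) (φ′→ (end₂ᵁ (inj₁ zero)))
    first-replaced = _ , _ , φ≢u zero , Ends.joins-sym s t unchanged , inj₁ (φ0≡u , refl)
      where
      1→2 : ∀ {n} → 2 ℕ.≤ n → skipOne {n} (next zero) ≢ zero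
      1→2 {suc n} _ eq = contradiction (trans (sym eq) (cong skipOne (next-inject₁ {suc n} zero))) λ ()
      target≢u : ∀ i → i ≢ zero → φ→ (inj₁ i) ≢ u
      target≢u zero 0≢0 = contradiction refl 0≢0
      target≢u (suc i) _ = φ≢u i
      next-one : inj₁ {B = Fin c} (next (suc zero)) ≡ inj₁ (skipOne (next zero))
      next-one = cong inj₁ (next-suc zero)
      unchanged : Joins s t (ψ′→ (inj₁ zero)) (φ→ (inj₁ (suc zero))) (φ′→ (inj₁ (next zero)))
      unchanged with shifted (inj₁ (suc zero))
      ... | inj₁ j = subst (Joins s t _ _) (cong φ→ next-one) j
      ... | inj₂ (_ , _ , _ , _ , inj₁ (eq , _)) = contradiction eq (φ≢u zero)
      ... | inj₂ (_ , _ , _ , _ , inj₂ (_ , eq)) = contradiction (trans (cong φ→ (sym next-one)) eq)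
          (target≢u _ (1→2 n≥2))

    -- No edge is changed both by `S` and by the shortcut. The composite therefore replaces at most
    -- one vertex per edge and is again a single shift, comparable by the same Perron vector.
    shortened : Shifts s t (end₁ᵁ {n} {suc c}) end₂ᵁ u
    shortened = record
      { φ = ↔-trans shortcutV φ
      ; ψ = ↔-trans shortcutE ψ
      ; shifted = λ
        { (inj₁ zero) → inj₂ first-replaced
        ; (inj₁ (suc i)) → subst (λ w → EdgeShift s t u (ψ′→ (inj₁ (suc i))) (φ′→ (inj₁ (suc i))) (φ→ (inj₁ w)))
            (next-suc (suc i)) (shifted (inj₁ (suc (suc i))))
        ; (inj₂ zero) → subst (λ w → EdgeShift s t u (ψ′→ (inj₂ zero)) (φ→ (inj₁ zero)) (φ→ (inj₁ w)))
            (next-inject₁ zero) (shifted (inj₁ zero))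
        ; (inj₂ (suc a)) → shifted (inj₂ a)
        }
      }

-- Membership of UC_l(c₁ = c) in the class.

UC₁-size : ∀ {m n} (m≥2 : 2 ℕ.≤ m) (l≥3 : 3 ℕ.≤ suc n) c → size (UC₁ m≥2 l≥3 c) ≡ suc n ℕ.+ c
UC₁-size m≥2 l≥3 c = ↔⇒≡ (↔-trans (IsPower.edg (UC₁-isPower l≥3 m≥2 c)) (↔-sym +↔⊎))

UC₁-inUC : ∀ {m n} (m≥2 : 2 ℕ.≤ m) (l≥3 : 3 ℕ.≤ suc n) c → InUC m (suc n) (suc n ℕ.+ c) (UC₁ m≥2 l≥3 c)
UC₁-inUC {m} {n} m≥2 l≥3 c = record
  { connected = graphConnected⇒connected P (UC-some-edge l≥3) (UC-connected l≥3)
  ; linear = λ {e} {f} → simple⇒linear P (UC-simple l≥3) {e} {f}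
  ; uniform = UC₁-uniform m≥2 l≥3 c
  ; unicyclic = proj₁ (toLooseCycle P (UC-cycle l≥3)) , same
  ; inPowers = UC₁-inPowers m≥2 l≥3 c
  ; size≡k = UC₁-size m≥2 l≥3 c
  }
  where
  P = UC₁-isPower l≥3 m≥2 c
  open IsPower P using (toE; fromE; toE∘fromE; fromE∘toE)
  same : ∀ {l′} (C : LooseCycle (UC₁ m≥2 l≥3 c) l′) → SameCycle (proj₁ (toLooseCycle P (UC-cycle l≥3))) C
  same C f = mk⇔
    (λ { (i , eq) → let j , eq′ = Equivalence.to covered (i , trans (sym (toE∘fromE (inj₁ i))) (cong toE eq)) in j , to-injective (IsPower.edg P) (trans (sym (proj₂ D j)) eq′) })
    (λ { (j , eq) → let i , eq′ = Equivalence.from covered (j , trans (proj₂ D j) (cong toE eq)) in i , trans (cong fromE eq′) (fromE∘toE f) })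
    where
    D = fromLooseCycle P C
    covered = UC-unicyclic l≥3 (proj₁ D) (toE f)

-- Ordered fields

module OrderedField (R : CompleteOrderedField) where
  open CompleteOrderedField R public
  open CommutativeRing commutativeRing public
    using (ring; setoid; +-cong; +-congˡ; +-congʳ; *-cong; *-congˡ; *-congʳ;
           +-assoc; +-comm; *-assoc; *-comm; distribˡ; distribʳ; zeroˡ; zeroʳ;
           +-identityˡ; +-identityʳ; *-identityˡ; *-identityʳ; -‿inverseˡ;
           -‿inverseʳ; -‿cong; +-abelianGroup)
    renaming (refl to ≈-refl; sym to ≈-sym; trans to ≈-trans; reflexive to ≈-reflexive)
  module ≈-Reasoning = SetoidReasoning setoid

  private
    module Nat = Mult semiring
    module Nat′ = Mult′ semiring
    module Rng = RingProperties ring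
    module Grp = GroupProperties +-abelianGroup

  open ≈-Reasoning

  private
    -- Integer coefficients have decidable equality, so the ring solver can cancel terms. With this
    -- form of multiples, 1 and 2 evaluate to `1#` and `1# + 1#` exactly.
    ⟦_⟧ℤ : ℤ → ℝ
    ⟦ + n ⟧ℤ = n Nat′.× 1#
    ⟦ -[1+ n ] ⟧ℤ = - (suc n Nat′.× 1#)

    ⟦-⟧ : ∀ i → ⟦ ℤ.- i ⟧ℤ ≈ - ⟦ i ⟧ℤ
    ⟦-⟧ (+ zero) = ≈-sym Rng.-0#≈0#
    ⟦-⟧ (+ (suc n)) = ≈-refl
    ⟦-⟧ (-[1+ n ]) = ≈-sym (Rng.-‿involutive _)

    cancel : ∀ c a b → a - b ≈ (c + a) - (c + b)
    cancel c a b = begin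
      a - b ≈⟨ +-congʳ (+-identityˡ a) ⟨
      0# + a - b ≈⟨ +-congʳ (+-congʳ (-‿inverseʳ c)) ⟨
      c - c + a - b ≈⟨ +-congʳ (+-assoc c (- c) a) ⟩
      c + (- c + a) - b ≈⟨ +-congʳ (+-congˡ (+-comm (- c) a)) ⟩
      c + (a - c) - b ≈⟨ +-congʳ (+-assoc c a (- c)) ⟨
      c + a - c - b ≈⟨ +-assoc (c + a) (- c) (- b) ⟩
      c + a + (- c - b) ≈⟨ +-congˡ (Grp.⁻¹-∙-comm c b) ⟩
      (c + a) - (c + b) ∎

    ⟦⊖⟧ : ∀ m n → ⟦ m ℤ.⊖ n ⟧ℤ ≈ ⟦ + m ⟧ℤ - ⟦ + n ⟧ℤ
    ⟦⊖⟧ zero zero = ≈-sym (-‿inverseʳ 0#)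
    ⟦⊖⟧ zero (suc n) = ≈-sym (+-identityˡ _)
    ⟦⊖⟧ (suc m) zero = ≈-sym (≈-trans (+-congˡ Rng.-0#≈0#) (+-identityʳ _))
    ⟦⊖⟧ (suc m) (suc n) = begin
      ⟦ suc m ℤ.⊖ suc n ⟧ℤ ≈⟨ ≈-reflexive (≡.cong ⟦_⟧ℤ (ℤ.[1+m]⊖[1+n]≡m⊖n m n)) ⟩
      ⟦ m ℤ.⊖ n ⟧ℤ ≈⟨ ⟦⊖⟧ m n ⟩
      ⟦ + m ⟧ℤ - ⟦ + n ⟧ℤ ≈⟨ cancel 1# _ _ ⟩
      (1# + ⟦ + m ⟧ℤ) - (1# + ⟦ + n ⟧ℤ) ≈⟨ +-cong (Nat′.1+× m 1#) (-‿cong (Nat′.1+× n 1#)) ⟨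
      ⟦ + suc m ⟧ℤ - ⟦ + suc n ⟧ℤ ∎

    ⟦+⟧ : ∀ i j → ⟦ i ℤ.+ j ⟧ℤ ≈ ⟦ i ⟧ℤ + ⟦ j ⟧ℤ
    ⟦+⟧ (+ m) (+ n) = Nat′.×-homo-+ 1# m n
    ⟦+⟧ (+ m) (-[1+ n ]) = ⟦⊖⟧ m (suc n)
    ⟦+⟧ (-[1+ m ]) (+ n) = ≈-trans (⟦⊖⟧ n (suc m)) (+-comm _ _)
    ⟦+⟧ (-[1+ m ]) (-[1+ n ]) = begin
      - (suc (suc (m ℕ.+ n)) Nat′.× 1#) ≈⟨ -‿cong (≈-reflexive (≡.cong (Nat′._× 1#) (≡.cong suc (ℕ.+-suc m n)))) ⟨
      - ((suc m ℕ.+ suc n) Nat′.× 1#) ≈⟨ -‿cong (Nat′.×-homo-+ 1# (suc m) (suc n)) ⟩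
      - (suc m Nat′.× 1# + suc n Nat′.× 1#) ≈⟨ Grp.⁻¹-∙-comm _ _ ⟨
      - (suc m Nat′.× 1#) - (suc n Nat′.× 1#) ∎
      where import Data.Nat.Properties as ℕ

    ⟦-n⟧ : ∀ n → ⟦ ℤ.- (+ n) ⟧ℤ ≈ - (n Nat′.× 1#)
    ⟦-n⟧ n = ⟦-⟧ (+ n)

    ⟦*⟧ : ∀ i j → ⟦ i ℤ.* j ⟧ℤ ≈ ⟦ i ⟧ℤ * ⟦ j ⟧ℤ
    ⟦*⟧ (+ m) (+ n) = ≈-trans (≈-reflexive (≡.cong ⟦_⟧ℤ (ℤ.+◃n≡+n (m ℕ.* n)))) (Nat′.×1-homo-* m n)
    ⟦*⟧ (+ m) (-[1+ n ]) = begin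
      _ ≈⟨ ≈-reflexive (≡.cong ⟦_⟧ℤ (ℤ.-◃n≡-n (m ℕ.* suc n))) ⟩
      _ ≈⟨ ⟦-n⟧ (m ℕ.* suc n) ⟩
      - ((m ℕ.* suc n) Nat′.× 1#) ≈⟨ -‿cong (Nat′.×1-homo-* m (suc n)) ⟩
      - ((m Nat′.× 1#) * (suc n Nat′.× 1#)) ≈⟨ Rng.-‿distribʳ-* _ _ ⟩
      _ ∎
    ⟦*⟧ (-[1+ m ]) (+ n) = begin
      _ ≈⟨ ≈-reflexive (≡.cong ⟦_⟧ℤ (ℤ.-◃n≡-n (suc m ℕ.* n))) ⟩
      _ ≈⟨ ⟦-n⟧ (suc m ℕ.* n) ⟩
      - ((suc m ℕ.* n) Nat′.× 1#) ≈⟨ -‿cong (Nat′.×1-homo-* (suc m) n) ⟩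
      - ((suc m Nat′.× 1#) * (n Nat′.× 1#)) ≈⟨ Rng.-‿distribˡ-* _ _ ⟩
      _ ∎
    ⟦*⟧ (-[1+ m ]) (-[1+ n ]) = begin
      _ ≈⟨ Nat′.×1-homo-* (suc m) (suc n) ⟩
      (suc m Nat′.× 1#) * (suc n Nat′.× 1#) ≈⟨ Rng.-‿involutive _ ⟨
      - - ((suc m Nat′.× 1#) * (suc n Nat′.× 1#)) ≈⟨ -‿cong (Rng.-‿distribˡ-* _ _) ⟩
      - (- (suc m Nat′.× 1#) * (suc n Nat′.× 1#)) ≈⟨ Rng.-‿distribʳ-* _ _ ⟩
      _ ∎

    ℤ-rawRing : RawRing 0ℓ 0ℓ
    ℤ-rawRing = ℤ.+-*-rawRing

    fromℤ : ℤ-rawRing -Raw-AlmostCommutative⟶ fromCommutativeRing commutativeRing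
    fromℤ = record
      { ⟦_⟧ = ⟦_⟧ℤ ; +-homo = ⟦+⟧ ; *-homo = ⟦*⟧ ; -‿homo = ⟦-⟧
      ; 0-homo = ≈-refl ; 1-homo = ≈-refl }

    _≟ℤ_ : ∀ i j → Maybe (⟦ i ⟧ℤ ≈ ⟦ j ⟧ℤ)
    i ≟ℤ j with i ℤ.≟ j
    ... | yes i≡j = just (≈-reflexive (≡.cong ⟦_⟧ℤ i≡j))
    ... | no _ = nothing

  open RingSolver ℤ-rawRing (fromCommutativeRing commutativeRing) fromℤ _≟ℤ_ public
    using (Polynomial; solve; _:=_; _:+_; _:*_; _:-_; :-_; con)

  :0 :1 :2 : ∀ {n} → Polynomial n
  :0 = con (+ 0)
  :1 = con (+ 1)
  :2 = con (+ 2)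

-- Order laws, excluded middle and finite sums.

module Order (R : CompleteOrderedField) where
  open OrderedField R public
  private module S = Sum′ semiring

  private
    module O = IsStrictTotalOrder isStrictTotalOrder
    module N = StrictToNonStrict _≈_ _<_
    module T = IsTotalOrder (N.isTotalOrder isStrictTotalOrder)

  <-poset : StrictPartialOrder 0ℓ 0ℓ 0ℓ
  <-poset = record { isStrictPartialOrder = O.isStrictPartialOrder }

  module ≤-Reasoning = OrderReasoning <-poset

  open O public using (compare) renaming
      (trans to <-trans; irrefl to <-irrefl; <-respʳ-≈ to <-respʳ; <-respˡ-≈ to <-respˡ)
  open T public using () renaming
      (refl to ≤-refl; reflexive to ≤-reflexive; trans to ≤-trans; antisym to ≤-antisym; total to ≤-total; ≤-respʳ-≈
      to ≤-respʳ; ≤-respˡ-≈ to ≤-respˡ)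

  <⇒≤ : ∀ {x y} → x < y → x ≤ y
  <⇒≤ = inj₁

  <-≤-trans : ∀ {x y z} → x < y → y ≤ z → x < z
  <-≤-trans = N.<-≤-trans <-trans <-respʳ

  ≤-<-trans : ∀ {x y z} → x ≤ y → y < z → x < z
  ≤-<-trans = N.≤-<-trans ≈-sym <-trans <-respˡ

  ≤⇒≯ : ∀ {x y} → x ≤ y → ¬ (y < x)
  ≤⇒≯ x≤y y<x = <-irrefl ≈-refl (≤-<-trans x≤y y<x)

  ≮⇒≥ : ∀ {x y} → ¬ (x < y) → y ≤ x
  ≮⇒≥ {x} {y} x≮y with compare x y
  ... | tri< x<y _ _ = contradiction x<y x≮y
  ... | tri≈ _ x≈y _ = inj₂ (≈-sym x≈y)
  ... | tri> _ _ y<x = inj₁ y<x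

  <-or-≥ : ∀ x y → x < y ⊎ y ≤ x
  <-or-≥ x y with compare x y
  ... | tri< x<y _ _ = inj₁ x<y
  ... | tri≈ _ x≈y _ = inj₂ (inj₂ (≈-sym x≈y))
  ... | tri> _ _ y<x = inj₂ (inj₁ y<x)

  +-monoʳ-< : ∀ z {x y} → x < y → z + x < z + y
  +-monoʳ-< z x<y = <-respˡ (+-comm _ _) (<-respʳ (+-comm _ _) (+-monoˡ-< z x<y))

  +-monoˡ-≤ : ∀ z {x y} → x ≤ y → x + z ≤ y + z
  +-monoˡ-≤ z (inj₁ x<y) = inj₁ (+-monoˡ-< z x<y)
  +-monoˡ-≤ z (inj₂ x≈y) = inj₂ (+-congʳ x≈y)

  +-monoʳ-≤ : ∀ z {x y} → x ≤ y → z + x ≤ z + y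
  +-monoʳ-≤ z (inj₁ x<y) = inj₁ (+-monoʳ-< z x<y)
  +-monoʳ-≤ z (inj₂ x≈y) = inj₂ (+-congˡ x≈y)

  +-mono-≤ : ∀ {w x y z} → w ≤ x → y ≤ z → w + y ≤ x + z
  +-mono-≤ w≤x y≤z = ≤-trans (+-monoˡ-≤ _ w≤x) (+-monoʳ-≤ _ y≤z)

  +-mono-<-≤ : ∀ {w x y z} → w < x → y ≤ z → w + y < x + z
  +-mono-<-≤ w<x y≤z = <-≤-trans (+-monoˡ-< _ w<x) (+-monoʳ-≤ _ y≤z)

  +-mono-≤-< : ∀ {w x y z} → w ≤ x → y < z → w + y < x + z
  +-mono-≤-< w≤x y<z = ≤-<-trans (+-monoˡ-≤ _ w≤x) (+-monoʳ-< _ y<z)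

  +-nonneg : ∀ {x y} → 0# ≤ x → 0# ≤ y → 0# ≤ x + y
  +-nonneg p q = ≤-trans (inj₂ (≈-sym (+-identityˡ 0#))) (+-mono-≤ p q)

  +-pos-nonneg : ∀ {x y} → 0# < x → 0# ≤ y → 0# < x + y
  +-pos-nonneg p q = <-respˡ (+-identityˡ 0#) (+-mono-<-≤ p q)

  +-nonneg-pos : ∀ {x y} → 0# ≤ x → 0# < y → 0# < x + y
  +-nonneg-pos p q = <-respˡ (+-identityˡ 0#) (+-mono-≤-< p q)

  *-nonneg : ∀ {x y} → 0# ≤ x → 0# ≤ y → 0# ≤ x * y
  *-nonneg (inj₁ p) (inj₁ q) = inj₁ (*-pos p q)
  *-nonneg (inj₁ p) (inj₂ q) = inj₂ (≈-sym (≈-trans (*-congˡ (≈-sym q)) (zeroʳ _)))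
  *-nonneg (inj₂ p) _ = inj₂ (≈-sym (≈-trans (*-congʳ (≈-sym p)) (zeroˡ _)))

  ≤-by : ∀ {x y p} → 0# ≤ p → y ≈ x + p → x ≤ y
  ≤-by {x} 0≤p y≈x+p = ≤-respʳ (≈-sym y≈x+p) (≤-trans (inj₂ (≈-sym (+-identityʳ x))) (+-monoʳ-≤ x 0≤p))

  <-by : ∀ {x y p} → 0# < p → y ≈ x + p → x < y
  <-by {x} 0<p y≈x+p = <-respʳ (≈-sym y≈x+p) (≤-<-trans (inj₂ (≈-sym (+-identityʳ x))) (+-monoʳ-< x 0<p))

  x≤y⇒0≤y-x : ∀ {x y} → x ≤ y → 0# ≤ y - x
  x≤y⇒0≤y-x {x} x≤y = ≤-trans (inj₂ (≈-sym (-‿inverseʳ x))) (+-monoˡ-≤ (- x) x≤y)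

  x<y⇒0<y-x : ∀ {x y} → x < y → 0# < y - x
  x<y⇒0<y-x {x} x<y = ≤-<-trans (inj₂ (≈-sym (-‿inverseʳ x))) (+-monoˡ-< (- x) x<y)

  0≤y-x⇒x≤y : ∀ {x y} → 0# ≤ y - x → x ≤ y
  0≤y-x⇒x≤y {x} {y} p = ≤-by p (solve 2 (λ x y → y := x :+ (y :- x)) ≈-refl x y)

  *-monoˡ-≤ : ∀ {x y z} → 0# ≤ z → x ≤ y → z * x ≤ z * y
  *-monoˡ-≤ {x} {y} {z} 0≤z x≤y =
    ≤-by (*-nonneg 0≤z (x≤y⇒0≤y-x x≤y)) (solve 3 (λ x y z → z :* y := z :* x :+ z :* (y :- x)) ≈-refl x y z)

  *-monoʳ-≤ : ∀ {x y z} → 0# ≤ z → x ≤ y → x * z ≤ y * z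
  *-monoʳ-≤ 0≤z x≤y = ≤-respˡ (*-comm _ _) (≤-respʳ (*-comm _ _) (*-monoˡ-≤ 0≤z x≤y))

  *-monoˡ-< : ∀ {x y z} → 0# < z → x < y → z * x < z * y
  *-monoˡ-< {x} {y} {z} 0<z x<y =
    <-by (*-pos 0<z (x<y⇒0<y-x x<y)) (solve 3 (λ x y z → z :* y := z :* x :+ z :* (y :- x)) ≈-refl x y z)

  *-monoʳ-< : ∀ {x y z} → 0# < z → x < y → x * z < y * z
  *-monoʳ-< 0<z x<y = <-respˡ (*-comm _ _) (<-respʳ (*-comm _ _) (*-monoˡ-< 0<z x<y))

  *-cancelʳ-≤ : ∀ {x y z} → 0# < z → x * z ≤ y * z → x ≤ y
  *-cancelʳ-≤ 0<z p = ≮⇒≥ λ y<x → ≤⇒≯ p (*-monoʳ-< 0<z y<x)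

  *-cancelʳ-< : ∀ {x y z} → 0# ≤ z → x * z < y * z → x < y
  *-cancelʳ-< {x} {y} 0≤z p with <-or-≥ x y
  ... | inj₁ x<y = x<y
  ... | inj₂ y≤x = contradiction p (≤⇒≯ (*-monoʳ-≤ 0≤z y≤x))

  *-cancelʳ-≈ : ∀ {x y z} → 0# < z → x * z ≈ y * z → x ≈ y
  *-cancelʳ-≈ 0<z p = ≤-antisym (*-cancelʳ-≤ 0<z (inj₂ p)) (*-cancelʳ-≤ 0<z (inj₂ (≈-sym p)))

  -‿anti-≤0 : ∀ {x} → x ≤ 0# → 0# ≤ - x
  -‿anti-≤0 {x} p = ≤-respʳ (+-identityˡ (- x)) (x≤y⇒0≤y-x p)

  sq-nonneg : ∀ x → 0# ≤ x * x
  sq-nonneg x with ≤-total 0# x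
  ... | inj₁ p = *-nonneg p p
  ... | inj₂ p = ≤-respʳ (solve 1 (λ x → (:- x) :* (:- x) := x :* x) ≈-refl x) (*-nonneg (-‿anti-≤0 p) (-‿anti-≤0 p))

  sq-pos : ∀ {x} → x ≉ 0# → 0# < x * x
  sq-pos {x} x≉0 with compare 0# x
  ... | tri< p _ _ = *-pos p p
  ... | tri≈ _ p _ = contradiction (≈-sym p) x≉0
  ... | tri> _ _ p = <-respʳ (solve 1 (λ x → (:0 :- x) :* (:0 :- x) := x :* x) ≈-refl x)
      (*-pos (x<y⇒0<y-x p) (x<y⇒0<y-x p))

  pos⇒≉0 : ∀ {x} → 0# < x → x ≉ 0#
  pos⇒≉0 p q = <-irrefl (≈-sym q) p

  ⁻¹-pos : ∀ {x} → 0# < x → 0# < x ⁻¹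
  ⁻¹-pos {x} 0<x with <-or-≥ 0# (x ⁻¹)
  ... | inj₁ p = p
  ... | inj₂ p = contradiction 0<1
      (≤⇒≯ (≤-respˡ (⁻¹-inverseʳ (pos⇒≉0 0<x)) (≤-respʳ (zeroʳ x) (*-monoˡ-≤ (inj₁ 0<x) p))))

  ÷-* : ∀ {x y} → 0# < y → (x ÷ y) * y ≈ x
  ÷-* {x} {y} 0<y = begin
    x * y ⁻¹ * y ≈⟨ *-assoc x _ _ ⟩
    x * (y ⁻¹ * y) ≈⟨ *-congˡ (≈-trans (*-comm _ _) (⁻¹-inverseʳ (pos⇒≉0 0<y))) ⟩
    x * 1# ≈⟨ *-identityʳ x ⟩
    x ∎
    where open ≈-Reasoning

  ι-nonneg : ∀ n → 0# ≤ ι n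
  ι-nonneg zero = ≤-refl
  ι-nonneg (suc n) = +-nonneg (inj₁ 0<1) (ι-nonneg n)

  ι-pos : ∀ n → 0# < ι (suc n)
  ι-pos n = +-pos-nonneg 0<1 (ι-nonneg n)

  0<2 : 0# < 1# + 1#
  0<2 = *-pos′ where
    *-pos′ = +-pos-nonneg 0<1 (inj₁ 0<1)

  module _ (P : Set) where
    private
      S : ℝ → Set
      S x = x ≈ 0# ⊎ (x ≈ 1# × P)

      bounded : ∀ {x} → S x → x ≤ 1#
      bounded (inj₁ x≈0) = ≤-respˡ (≈-sym x≈0) (inj₁ 0<1)
      bounded (inj₂ (x≈1 , _)) = inj₂ x≈1

      isSup = ⋁-isSupremum {S} (0# , inj₁ ≈-refl) (1# , bounded)

      witness : ∃[ x ] S x × 0# < x → P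
      witness (x , inj₁ x≈0 , 0<x) = contradiction x≈0 (pos⇒≉0 0<x)
      witness (x , inj₂ (_ , p) , _) = p

    -- `S` contains 0 always and 1 only together with a proof of `P`. Trichotomy decides whether its
    -- supremum exceeds 0, and an element above 0 carries the proof.
    excluded-middle : Dec P
    excluded-middle with <-or-≥ 0# (⋁ S)
    ... | inj₁ 0<s = yes (witness (proj₂ isSup 0<s))
    ... | inj₂ s≤0 = no λ p → ≤⇒≯ (≤-trans (proj₁ isSup (inj₂ (≈-refl , p))) s≤0) 0<1

  -- Opaque, so that the unifier compares sums by their summands.
  opaque
    ∑ : ∀ {n} → Vector ℝ n → ℝ
    ∑ = sum

    ∑≡sum : ∀ {n} (f : Vector ℝ n) → ∑ f ≡ sum f
    ∑≡sum f = ≡.refl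

    ∑-zero : (f : Vector ℝ 0) → ∑ f ≈ 0#
    ∑-zero f = ≈-refl

    ∑-suc : ∀ {n} (f : Vector ℝ (suc n)) → ∑ f ≈ f zero + ∑ (f ∘ suc)
    ∑-suc f = ≈-refl

    ∑-cong : ∀ {n} {f g : Vector ℝ n} → (∀ i → f i ≈ g i) → ∑ f ≈ ∑ g
    ∑-cong = S.sum-cong-≋

    ∑-+ : ∀ {n} (f g : Vector ℝ n) → ∑ (λ i → f i + g i) ≈ ∑ f + ∑ g
    ∑-+ = S.∑-distrib-+

    ∑-comm : ∀ {m n} (f : Fin m → Fin n → ℝ) → ∑ (λ i → ∑ (λ j → f i j)) ≈ ∑ (λ j → ∑ (λ i → f i j))
    ∑-comm = S.∑-comm

    *-∑ : ∀ {n} x (f : Vector ℝ n) → x * ∑ f ≈ ∑ (λ i → x * f i)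
    *-∑ = S.*-distribˡ-sum

    ∑-permute : ∀ {m n} (f : Vector ℝ n) (π : Fin m ↔ Fin n) → ∑ f ≈ ∑ (λ i → f (Inverse.to π i))
    ∑-permute = S.sum-permute

    ∑-const : ∀ n (x : ℝ) → ∑ {n} (λ _ → x) ≈ ι n * x
    ∑-const zero x = ≈-sym (zeroˡ x)
    ∑-const (suc n) x = ≈-trans (+-congˡ (∑-const n x))
        (solve 2 (λ x n → x :+ n :* x := (:1 :+ n) :* x) ≈-refl x (ι n))

    ∑-0 : ∀ {n} {f : Vector ℝ n} → (∀ i → f i ≈ 0#) → ∑ f ≈ 0#
    ∑-0 {n} f≈0 = ≈-trans (∑-cong f≈0) (S.sum-replicate-zero n)

    ∑-mono-≤ : ∀ {n} {f g : Vector ℝ n} → (∀ i → f i ≤ g i) → ∑ f ≤ ∑ g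
    ∑-mono-≤ {zero} f≤g = ≤-refl
    ∑-mono-≤ {suc n} f≤g = +-mono-≤ (f≤g zero) (∑-mono-≤ (f≤g ∘ suc))

    ∑-mono-< : ∀ {n} {f g : Vector ℝ n} → (∀ i → f i ≤ g i) → ∀ i → f i < g i → ∑ f < ∑ g
    ∑-mono-< f≤g zero p = +-mono-<-≤ p (∑-mono-≤ (f≤g ∘ suc))
    ∑-mono-< f≤g (suc i) p = +-mono-≤-< (f≤g zero) (∑-mono-< (f≤g ∘ suc) i p)

    ∑-nonneg : ∀ {n} {f : Vector ℝ n} → (∀ i → 0# ≤ f i) → 0# ≤ ∑ f
    ∑-nonneg {zero} p = ≤-refl
    ∑-nonneg {suc n} p = +-nonneg (p zero) (∑-nonneg (p ∘ suc))

    ≤-∑ : ∀ {n} {f : Vector ℝ n} → (∀ i → 0# ≤ f i) → ∀ i → f i ≤ ∑ f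
    ≤-∑ {suc n} p zero = ≤-by (∑-nonneg (p ∘ suc)) ≈-refl
    ≤-∑ {suc n} p (suc i) = ≤-trans (≤-∑ (p ∘ suc) i) (≤-by (p zero) (+-comm _ _))

    ∑-minus : ∀ {n} (f g : Vector ℝ n) → ∑ (λ i → f i - g i) ≈ ∑ f - ∑ g
    ∑-minus {zero} f g = ≈-sym (-‿inverseʳ 0#)
    ∑-minus {suc n} f g = ≈-trans (+-congˡ (∑-minus (f ∘ suc) (g ∘ suc)))
      (solve 4 (λ a b c d → a :- b :+ (c :- d) := a :+ c :- (b :+ d)) ≈-refl (f zero) (g zero) _ _)

    ∑-single : ∀ {n} {f : Vector ℝ n} i → (∀ j → j ≢ i → f j ≈ 0#) → ∑ f ≈ f i
    ∑-single zero p = ≈-trans (+-congˡ (∑-0 λ j → p (suc j) λ ())) (+-identityʳ _)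
    ∑-single (suc i) p = ≈-trans (+-cong (p zero λ ()) (∑-single i λ j j≢i → p (suc j) (j≢i ∘ Fin.suc-injective)))
        (+-identityˡ _)

  ∑-pos : ∀ {n} {f : Vector ℝ n} → (∀ i → 0# ≤ f i) → ∀ i → 0# < f i → 0# < ∑ f
  ∑-pos p i q = <-≤-trans q (≤-∑ p i)

  ∑≈0⇒≈0 : ∀ {n} {f : Vector ℝ n} → (∀ i → 0# ≤ f i) → ∑ f ≈ 0# → ∀ i → f i ≈ 0#
  ∑≈0⇒≈0 p s i = ≤-antisym (≤-respʳ s (≤-∑ p i)) (p i)

  -- Square roots as suprema.

  module _ {x : ℝ} (0≤x : 0# ≤ x) where
    private
      S : ℝ → Set
      S s = s * s ≤ x
      r = √ x
      x+1 = x + 1#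
      bounded : ∀ {s} → S s → s ≤ x+1
      bounded {s} s²≤x = ≮⇒≥ λ x+1<s → ≤⇒≯ s²≤x (lemma x+1<s)
        where
        lemma : x+1 < s → x < s * s
        lemma p = <-trans (<-by {p = 1# + x + x * x} (+-pos-nonneg (+-pos-nonneg 0<1 0≤x) (sq-nonneg x))
                            (solve 1 (λ x → (x :+ :1) :* (x :+ :1) := x :+ (:1 :+ x :+ x :* x)) ≈-refl x))
                          (<-trans (*-monoˡ-< 0<x+1 p) (*-monoʳ-< (<-trans 0<x+1 p) p))
          where 0<x+1 = +-nonneg-pos 0≤x 0<1
      isSup = ⋁-isSupremum {S} (0# , ≤-respˡ (≈-sym (zeroˡ 0#)) 0≤x) (x+1 , λ {s} → bounded {s})

    √-nonneg : 0# ≤ r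
    √-nonneg = proj₁ isSup (≤-respˡ (≈-sym (zeroˡ 0#)) 0≤x)

    private
      0≤r = √-nonneg
      h : ℝ
      h = 1# + (r + r)
      0<h = +-pos-nonneg 0<1 (+-nonneg 0≤r 0≤r)

    √-square : r * r ≈ x
    √-square with compare (r * r) x
    ... | tri≈ _ p _ = p
    -- δ = min 1 ((x - r²)/(1+2r)) satisfies (r+δ)² ≤ r² + δ(1+2r) ≤ x.
    ... | tri< r²<x _ _ = contradiction (proj₁ isSup {r + δ} bigger) (≤⇒≯′ (<-by 0<δ ≈-refl))
      where
      ≤⇒≯′ : ∀ {x y} → y < x → ¬ (x ≤ y)
      ≤⇒≯′ p q = ≤⇒≯ q p
      e = x - r * r
      q = e ÷ h
      0<e = x<y⇒0<y-x r²<x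
      0<q : 0# < q
      0<q = *-pos 0<e (⁻¹-pos 0<h)
      choose : ∃[ d ] 0# < d × d ≤ 1# × d ≤ q
      choose with ≤-total 1# q
      ... | inj₁ 1≤q = 1# , 0<1 , ≤-refl , 1≤q
      ... | inj₂ q≤1 = q , 0<q , q≤1 , ≤-refl
      δ = proj₁ choose
      0<δ = proj₁ (proj₂ choose)
      δ≤1 = proj₁ (proj₂ (proj₂ choose))
      δ≤q = proj₂ (proj₂ (proj₂ choose))
      bigger : (r + δ) * (r + δ) ≤ x
      bigger = begin
        (r + δ) * (r + δ) ≤⟨ ≤-by (*-nonneg (<⇒≤ 0<δ) (x≤y⇒0≤y-x δ≤1))
            (solve 2 (λ r d → r :* r :+ d :* (:1 :+ (r :+ r)) := (r :+ d) :* (r :+ d) :+ d :* (:1 :- d)) ≈-refl r δ) ⟩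
        r * r + δ * h ≤⟨ +-monoʳ-≤ _ (*-monoʳ-≤ (<⇒≤ 0<h) δ≤q) ⟩
        r * r + q * h ≈⟨ +-congˡ (÷-* 0<h) ⟩
        r * r + (x - r * r) ≈⟨ solve 2 (λ r x → r :* r :+ (x :- r :* r) := x) ≈-refl r x ⟩
        x ∎
        where open ≤-Reasoning
    -- Put q = (r² - x)/(1 + 2r), so that (r - q)² = x + q + q² exceeds x. If r - q ≥ 0, no s above
    -- r - q has s² ≤ x, against r being the supremum; if r ≤ q, then r² ≤ q r < q (1 + 2r) = r² -
    -- x, against 0 ≤ x.
    ... | tri> _ _ x<r² = contradiction (proj₂ isSup r-q<r) no-witness
      where
      e = r * r - x
      q = e ÷ h
      0<e = x<y⇒0<y-x x<r²
      0<q : 0# < q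
      0<q = *-pos 0<e (⁻¹-pos 0<h)
      qh≈e : q * h ≈ e
      qh≈e = ÷-* 0<h
      r-q<r : r - q < r
      r-q<r = <-by 0<q (solve 2 (λ r q → r := r :- q :+ q) ≈-refl r q)
      no-witness : ¬ (∃[ s ] S s × r - q < s)
      no-witness (s , s²≤x , p) with ≤-total 0# (r - q)
      ... | inj₁ 0≤r-q = ≤⇒≯ s²≤x (begin-strict
        x ≤⟨ ≤-by (+-nonneg (<⇒≤ 0<q) (sq-nonneg q)) (begin-equality
          (r - q) * (r - q) ≈⟨ solve 3 (λ r q x → (r :- q) :* (r :- q) := x :+ (q :+ q :* q) :+
              ((r :* r :- x) :- q :* (:1 :+ (r :+ r)))) ≈-refl r q x ⟩
          x + (q + q * q) + (e - q * h) ≈⟨ +-congˡ (≈-trans (+-congˡ (-‿cong qh≈e)) (-‿inverseʳ e)) ⟩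
          x + (q + q * q) + 0# ≈⟨ +-identityʳ _ ⟩
          x + (q + q * q) ∎) ⟩
        (r - q) * (r - q) ≤⟨ *-monoˡ-≤ 0≤r-q (<⇒≤ p) ⟩
        (r - q) * s <⟨ *-monoʳ-< (≤-<-trans 0≤r-q p) p ⟩
        s * s ∎)
        where open ≤-Reasoning
      ... | inj₂ r-q≤0 = <-irrefl ≈-refl (begin-strict
        e ≤⟨ ≤-by 0≤x (solve 2 (λ r x → r :* r := r :* r :- x :+ x) ≈-refl r x) ⟩
        r * r ≤⟨ *-monoʳ-≤ 0≤r (0≤y-x⇒x≤y
            (≤-respʳ (solve 2 (λ r q → :- (r :- q) := q :- r) ≈-refl r q) (-‿anti-≤0 r-q≤0))) ⟩
        q * r <⟨ <-by (+-pos-nonneg 0<q (*-nonneg (<⇒≤ 0<q) 0≤r))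
            (solve 2 (λ r q → q :* (:1 :+ (r :+ r)) := q :* r :+ (q :+ q :* r)) ≈-refl r q) ⟩
        q * h ≈⟨ qh≈e ⟩
        e ∎)
        where open ≤-Reasoning

-- Quadratic forms and Perron vectors

module Forms (R : CompleteOrderedField) where
  open Order R public
  open Spectral R public

  infixl 7 _∙_
  infix 8 ⟨_,_⟩

  _∙_ : ∀ {n} → Matrix n → Vector ℝ n → Vector ℝ n
  (M ∙ x) i = ∑ λ j → M i j * x j

  ⟨_,_⟩ : ∀ {n} → Vector ℝ n → Vector ℝ n → ℝ
  ⟨ x , y ⟩ = ∑ λ i → x i * y i

  N : ∀ {n} → Vector ℝ n → ℝ
  N x = ⟨ x , x ⟩

  Q : ∀ {n} → Matrix n → Vector ℝ n → ℝ
  Q M x = ⟨ x , M ∙ x ⟩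

  Symmetric : ∀ {n} → Matrix n → Set
  Symmetric M = ∀ i j → M i j ≈ M j i

  PSD : ∀ {n} → Matrix n → Set
  PSD M = ∀ x → 0# ≤ Q M x

  ⟨⟩-cong : ∀ {n} {x y u v : Vector ℝ n} → (∀ i → x i ≈ y i) → (∀ i → u i ≈ v i) → ⟨ x , u ⟩ ≈ ⟨ y , v ⟩
  ⟨⟩-cong p q = ∑-cong λ i → *-cong (p i) (q i)

  ⟨⟩-comm : ∀ {n} (x y : Vector ℝ n) → ⟨ x , y ⟩ ≈ ⟨ y , x ⟩
  ⟨⟩-comm x y = ∑-cong λ i → *-comm _ _

  ⟨⟩-scaleˡ : ∀ {n} c (x y : Vector ℝ n) → ⟨ (λ i → c * x i) , y ⟩ ≈ c * ⟨ x , y ⟩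
  ⟨⟩-scaleˡ c x y = ≈-trans (∑-cong λ i → *-assoc c (x i) (y i)) (≈-sym (*-∑ c _))

  ⟨⟩-scaleʳ : ∀ {n} c (x y : Vector ℝ n) → ⟨ x , (λ i → c * y i) ⟩ ≈ c * ⟨ x , y ⟩
  ⟨⟩-scaleʳ c x y = ≈-trans (⟨⟩-comm x _) (≈-trans (⟨⟩-scaleˡ c y x) (*-congˡ (⟨⟩-comm y x)))

  ⟨⟩-linearˡ : ∀ {n} a b (x y u : Vector ℝ n) → ⟨ (λ i → a * x i + b * y i) , u ⟩ ≈ a * ⟨ x , u ⟩ + b * ⟨ y , u ⟩
  ⟨⟩-linearˡ a b x y u = begin
    ⟨ (λ i → a * x i + b * y i) , u ⟩ ≈⟨ ∑-cong
        (λ i → solve 5 (λ a b x y u → (a :* x :+ b :* y) :* u := (a :* x) :* u :+ (b :* y) :* u) ≈-refl a b (x i)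
        (y i) (u i)) ⟩
    ∑ (λ i → (a * x i) * u i + (b * y i) * u i) ≈⟨ ∑-+ (λ i → (a * x i) * u i) _ ⟩
    ⟨ (λ i → a * x i) , u ⟩ + ⟨ (λ i → b * y i) , u ⟩ ≈⟨ +-cong (⟨⟩-scaleˡ a x u) (⟨⟩-scaleˡ b y u) ⟩
    a * ⟨ x , u ⟩ + b * ⟨ y , u ⟩ ∎
    where open ≈-Reasoning

  ⟨⟩-linearʳ : ∀ {n} a b (x y u : Vector ℝ n) → ⟨ u , (λ i → a * x i + b * y i) ⟩ ≈ a * ⟨ u , x ⟩ + b * ⟨ u , y ⟩
  ⟨⟩-linearʳ a b x y u = ≈-trans (⟨⟩-comm u _)
      (≈-trans (⟨⟩-linearˡ a b x y u) (+-cong (*-congˡ (⟨⟩-comm x u)) (*-congˡ (⟨⟩-comm y u))))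

  ∙-linear : ∀ {n} (M : Matrix n) a b x y i → (M ∙ (λ i → a * x i + b * y i)) i ≈ a * (M ∙ x) i + b * (M ∙ y) i
  ∙-linear M a b x y i = ⟨⟩-linearʳ a b x y (M i)

  self-adjoint : ∀ {n} {M : Matrix n} → Symmetric M → ∀ x y → ⟨ x , M ∙ y ⟩ ≈ ⟨ y , M ∙ x ⟩
  self-adjoint {M = M} M-sym x y = begin
    ∑ (λ i → x i * ∑ (λ j → M i j * y j)) ≈⟨ ∑-cong (λ i → *-∑ (x i) _) ⟩
    ∑ (λ i → ∑ (λ j → x i * (M i j * y j))) ≈⟨ ∑-comm _ ⟩
    ∑ (λ j → ∑ (λ i → x i * (M i j * y j))) ≈⟨ ∑-cong
        (λ j → ∑-cong λ i → ≈-trans (*-congˡ (*-congʳ (M-sym i j)))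
        (solve 3 (λ x m y → x :* (m :* y) := y :* (m :* x)) ≈-refl (x i) (M j i) (y j))) ⟩
    ∑ (λ j → ∑ (λ i → y j * (M j i * x i))) ≈⟨ ∑-cong (λ j → *-∑ (y j) _) ⟨
    ∑ (λ j → y j * ∑ (λ i → M j i * x i)) ∎
    where open ≈-Reasoning

  N-nonneg : ∀ {n} (x : Vector ℝ n) → 0# ≤ N x
  N-nonneg x = ∑-nonneg λ i → sq-nonneg (x i)

  N-pos : ∀ {n} (x : Vector ℝ n) i → x i ≉ 0# → 0# < N x
  N-pos x i p = ∑-pos (λ i → sq-nonneg (x i)) i (sq-pos p)

  sq≈0⇒≈0 : ∀ {x} → x * x ≈ 0# → x ≈ 0#
  sq≈0⇒≈0 {x} p with compare x 0#
  ... | tri≈ _ q _ = q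
  ... | tri< _ q _ = contradiction p (pos⇒≉0 (sq-pos q))
  ... | tri> _ q _ = contradiction p (pos⇒≉0 (sq-pos q))

  N≈0⇒≈0 : ∀ {n} (x : Vector ℝ n) → N x ≈ 0# → ∀ i → x i ≈ 0#
  N≈0⇒≈0 x p i = sq≈0⇒≈0 (∑≈0⇒≈0 (λ i → sq-nonneg (x i)) p i)

  Q-combination : ∀ {n} {M : Matrix n} → Symmetric M → ∀ a b x y →
    Q M (λ i → a * x i + b * y i) ≈ a * a * Q M x + (a * b * ⟨ y , M ∙ x ⟩ + a * b * ⟨ y , M ∙ x ⟩) + b * b * Q M y
  Q-combination {M = M} M-sym a b x y = begin
    Q M z ≈⟨ ⟨⟩-linearˡ a b x y (M ∙ z) ⟩
    a * ⟨ x , M ∙ z ⟩ + b * ⟨ y , M ∙ z ⟩ ≈⟨ +-cong (*-congˡ (expand x)) (*-congˡ (expand y)) ⟩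
    a * (a * Q M x + b * ⟨ x , M ∙ y ⟩) + b * (a * ⟨ y , M ∙ x ⟩ + b * Q M y)
      ≈⟨ +-congʳ (*-congˡ (+-congˡ (*-congˡ (self-adjoint {M = M} M-sym x y)))) ⟩
    a * (a * Q M x + b * ⟨ y , M ∙ x ⟩) + b * (a * ⟨ y , M ∙ x ⟩ + b * Q M y)
      ≈⟨ solve 5 (λ a b p q r → a :* (a :* p :+ b :* q) :+ b :* (a :* q :+ b :* r) := a :* a :* p :+
          (a :* b :* q :+ a :* b :* q) :+ b :* b :* r) ≈-refl a b _ _ _ ⟩
    a * a * Q M x + (a * b * ⟨ y , M ∙ x ⟩ + a * b * ⟨ y , M ∙ x ⟩) + b * b * Q M y ∎
    where
    open ≈-Reasoning
    z = λ i → a * x i + b * y i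
    expand : ∀ u → ⟨ u , M ∙ z ⟩ ≈ a * ⟨ u , M ∙ x ⟩ + b * ⟨ u , M ∙ y ⟩
    expand u = ≈-trans (⟨⟩-cong (λ _ → ≈-refl) (∙-linear M a b x y)) (⟨⟩-linearʳ a b (M ∙ x) (M ∙ y) u)

  -- With g = M x, G = |g|² and q = Q(g), the form at (q+1)x - G g is -G²(q+2).
  PSD-null⇒kernel : ∀ {n} {M : Matrix n} → Symmetric M → PSD M → ∀ x → Q M x ≈ 0# → ∀ i → (M ∙ x) i ≈ 0#
  PSD-null⇒kernel {M = M} M-sym M-psd x Qx≈0 = N≈0⇒≈0 g (≤-antisym (≮⇒≥ G≯0) (N-nonneg g))
    where
    g = M ∙ x
    G = N g
    q = Q M g
    z = λ i → (q + 1#) * x i + (- G) * g i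
    G≯0 : ¬ (0# < G)
    G≯0 0<G = ≤⇒≯ (M-psd z) (begin-strict
      Q M z ≈⟨ Q-combination {M = M} M-sym (q + 1#) (- G) x g ⟩
      (q + 1#) * (q + 1#) * Q M x + ((q + 1#) * (- G) * G + (q + 1#) * (- G) * G) + (- G) * (- G) * q
        ≈⟨ +-congʳ (+-congʳ (*-congˡ Qx≈0)) ⟩
      (q + 1#) * (q + 1#) * 0# + ((q + 1#) * (- G) * G + (q + 1#) * (- G) * G) + (- G) * (- G) * q
        <⟨ <-by (*-pos (*-pos 0<G 0<G) (+-nonneg-pos (M-psd g) 0<2))
             (solve 2 (λ q G → :0 := (q :+ :1) :* (q :+ :1) :* :0 :+
                 ((q :+ :1) :* (:- G) :* G :+ (q :+ :1) :* (:- G) :* G) :+ (:- G) :* (:- G) :* q :+ G :* G :*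
                 (q :+ :2)) ≈-refl q G) ⟩
      0# ∎)
      where open ≤-Reasoning

  -- A crude Cauchy-Schwarz inequality: `extend-gap` needs only some constant, and (u + s)² ≤ 2u² +
  -- 2s² provides one by induction.
  dot-bound : ∀ {n} (b : Vector ℝ n) → ∃[ K ] 0# ≤ K × (∀ x → ⟨ b , x ⟩ * ⟨ b , x ⟩ ≤ K * N x)
  dot-bound {zero} b = 0# , ≤-refl , λ x → inj₂ (≈-trans (≈-trans (*-congʳ (∑-zero _)) (zeroˡ _)) (≈-sym (zeroˡ _)))
  dot-bound {suc n} b with dot-bound (b ∘ suc)
  ... | K , 0≤K , bound = (b₀² + b₀²) + (K + K) , +-nonneg 0≤b₀²+ (+-nonneg 0≤K 0≤K) , λ x →
    let u = b zero * x zero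
        s = ⟨ b ∘ suc , x ∘ suc ⟩
        n′ = N (x ∘ suc)
        t = x zero * x zero
    in begin
    ⟨ b , x ⟩ * ⟨ b , x ⟩ ≈⟨ *-cong (∑-suc _) (∑-suc _) ⟩
    (u + s) * (u + s) ≤⟨ ≤-by (sq-nonneg (u - s))
        (solve 2 (λ u s → (u :* u :+ u :* u) :+ (s :* s :+ s :* s) := (u :+ s) :* (u :+ s) :+ (u :- s) :*
        (u :- s)) ≈-refl u s) ⟩
    (u * u + u * u) + (s * s + s * s) ≤⟨ +-monoʳ-≤ _ (+-mono-≤ (bound (x ∘ suc)) (bound (x ∘ suc))) ⟩
    (u * u + u * u) + (K * n′ + K * n′) ≤⟨ ≤-by
        (+-nonneg (*-nonneg 0≤b₀²+ (N-nonneg (x ∘ suc))) (*-nonneg (+-nonneg 0≤K 0≤K) (sq-nonneg (x zero))))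
      (solve 4 (λ b x K n → ((b :* b :+ b :* b) :+ (K :+ K)) :* (x :* x :+ n) :=
          ((b :* x) :* (b :* x) :+ (b :* x) :* (b :* x)) :+ (K :* n :+ K :* n) :+
          ((b :* b :+ b :* b) :* n :+ (K :+ K) :* (x :* x))) ≈-refl (b zero) (x zero) K n′) ⟩
    ((b₀² + b₀²) + (K + K)) * (t + n′) ≈⟨ *-congˡ (∑-suc _) ⟨
    ((b₀² + b₀²) + (K + K)) * N x ∎
    where
    open ≤-Reasoning
    b₀² = b zero * b zero
    0≤b₀²+ = +-nonneg (sq-nonneg (b zero)) (sq-nonneg (b zero))

  -- This dichotomy replaces compactness of the unit sphere: a semidefinite form either has a
  -- positive lower bound there or vanishes at some point.
  Gap Null : ∀ {n} → Matrix n → Set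
  Gap M = ∃[ γ ] 0# < γ × (∀ x → γ * N x ≤ Q M x)
  Null M = ∃[ x ] 0# < N x × Q M x ≈ 0#

  private
    module Schur {n} (M : Matrix (suc n)) (M-sym : Symmetric M) (0<a : 0# < M zero zero) where
      a = M zero zero
      c = a ⁻¹
      b : Vector ℝ n
      b j = M zero (suc j)
      minor M′ : Matrix n
      minor i j = M (suc i) (suc j)
      M′ i j = minor i j - b i * b j * c

      M′-sym : Symmetric M′
      M′-sym i j = +-cong (M-sym (suc i) (suc j)) (-‿cong (*-congʳ (*-comm _ _)))

      ac≈1 : a * c ≈ 1#
      ac≈1 = ⁻¹-inverseʳ (pos⇒≉0 0<a)

      M′∙ : ∀ x i → (M′ ∙ x) i ≈ (minor ∙ x) i - (c * ⟨ b , x ⟩) * b i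
      M′∙ x i = begin
        ∑ (λ j → (minor i j - b i * b j * c) * x j) ≈⟨ ∑-cong
            (λ j → solve 5 (λ m bi bj c x → (m :- bi :* bj :* c) :* x := m :* x :- (c :* bi) :* (bj :* x)) ≈-refl
            (minor i j) (b i) (b j) c (x j)) ⟩
        ∑ (λ j → minor i j * x j - (c * b i) * (b j * x j)) ≈⟨ ∑-minus (λ j → minor i j * x j) _ ⟩
        (minor ∙ x) i - ∑ (λ j → (c * b i) * (b j * x j)) ≈⟨ +-congˡ (-‿cong (*-∑ (c * b i) (λ j → b j * x j))) ⟨
        (minor ∙ x) i - (c * b i) * ⟨ b , x ⟩ ≈⟨ +-congˡ
            (-‿cong (solve 3 (λ c b s → c :* b :* s := c :* s :* b) ≈-refl c (b i) _)) ⟩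
        (minor ∙ x) i - (c * ⟨ b , x ⟩) * b i ∎
        where open ≈-Reasoning

      Q-M′ : ∀ x → Q M′ x ≈ Q minor x - c * ⟨ b , x ⟩ * ⟨ b , x ⟩
      Q-M′ x = begin
        ⟨ x , M′ ∙ x ⟩ ≈⟨ ∑-cong (λ i → ≈-trans (*-congˡ (M′∙ x i))
            (solve 4 (λ x m k b → x :* (m :- k :* b) := x :* m :- k :* (b :* x)) ≈-refl (x i) _ _ (b i))) ⟩
        ∑ (λ i → x i * (minor ∙ x) i - c * ⟨ b , x ⟩ * (b i * x i)) ≈⟨ ∑-minus (λ i → x i * (minor ∙ x) i) _ ⟩
        Q minor x - ∑ (λ i → c * ⟨ b , x ⟩ * (b i * x i)) ≈⟨ +-congˡ
            (-‿cong (*-∑ (c * ⟨ b , x ⟩) (λ i → b i * x i))) ⟨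
        Q minor x - c * ⟨ b , x ⟩ * ⟨ b , x ⟩ ∎
        where open ≈-Reasoning

      complete-square : ∀ x → let x₀ = x zero ; x′ = x ∘ suc ; w = x₀ + c * ⟨ b , x′ ⟩ in
                        Q M x ≈ a * (w * w) + Q M′ x′
      complete-square x = begin
        Q M x ≈⟨ ∑-suc _ ⟩
        x₀ * (M ∙ x) zero + ∑ (λ i → x′ i * (M ∙ x) (suc i)) ≈⟨ +-cong (*-congˡ (∑-suc _))
            (∑-cong λ i → *-congˡ (∑-suc _)) ⟩
        x₀ * (a * x₀ + B) + ∑ (λ i → x′ i * (M (suc i) zero * x₀ + (minor ∙ x′) i))
          ≈⟨ +-congˡ (∑-cong λ i → ≈-trans (*-congˡ (+-congʳ (*-congʳ (M-sym (suc i) zero))))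
              (solve 4 (λ x m y k → x :* (m :* y :+ k) := y :* (m :* x) :+ x :* k) ≈-refl (x′ i) (b i) x₀ _)) ⟩
        x₀ * (a * x₀ + B) + ∑ (λ i → x₀ * (b i * x′ i) + x′ i * (minor ∙ x′) i)
          ≈⟨ +-congˡ (≈-trans (∑-+ (λ i → x₀ * (b i * x′ i)) _) (+-congʳ (≈-sym (*-∑ x₀ (λ i → b i * x′ i))))) ⟩
        x₀ * (a * x₀ + B) + (x₀ * B + Q minor x′)
          -- The spare factors `1#` mark the places where `a * c` is inserted next, as the solver
          -- does not know that `c` is the inverse of `a`.
          ≈⟨ solve 5 (λ x a c B q → x :* (a :* x :+ B) :+ (x :* B :+ q) := a :* (x :* x) :+
              (:2 :* x :* B :* :1 :+ (c :* B :* B) :* :1) :+ (q :- c :* B :* B)) ≈-refl x₀ a c B _ ⟩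
        a * (x₀ * x₀) + ((1# + 1#) * x₀ * B * 1# + (c * B * B) * 1#) + (Q minor x′ - c * B * B)
          ≈⟨ +-cong (+-congˡ (+-cong (*-congˡ (≈-sym ac≈1)) (*-congˡ (≈-sym ac≈1)))) (≈-sym (Q-M′ x′)) ⟩
        a * (x₀ * x₀) + ((1# + 1#) * x₀ * B * (a * c) + (c * B * B) * (a * c)) + Q M′ x′
          ≈⟨ solve 5 (λ x a c B q → a :* (x :* x) :+ (:2 :* x :* B :* (a :* c) :+ (c :* B :* B) :* (a :* c)) :+ q :=
              a :* ((x :+ c :* B) :* (x :+ c :* B)) :+ q) ≈-refl x₀ a c B _ ⟩
        a * (w * w) + Q M′ x′ ∎
        where
        open ≈-Reasoning
        x₀ = x zero
        x′ = x ∘ suc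
        B = ⟨ b , x′ ⟩
        w = x₀ + c * B

      -- The first coordinate is chosen to make the completed square vanish, so a null vector of the
      -- Schur complement lifts to one of `M`.
      lift : Vector ℝ n → Vector ℝ (suc n)
      lift x zero = - (c * ⟨ b , x ⟩)
      lift x (suc i) = x i

      Q-lift : ∀ x → Q M (lift x) ≈ Q M′ x
      Q-lift x = ≈-trans (complete-square (lift x))
        (solve 3 (λ a s q → a :* ((:- s :+ s) :* (:- s :+ s)) :+ q := q) ≈-refl a (c * ⟨ b , x ⟩) (Q M′ x))

      -- From x₀ = w - c B one has x₀² ≤ 2w² + 2c²B², and B² is at most K N(x′). So γ has to satisfy
      -- 2γ ≤ a, to be paid by the square, and γ (1 + 2c²K) ≤ γ′, to be paid by `M′`; the smaller of
      -- the two quotients does.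
      extend-gap : Gap M′ → Gap M
      extend-gap (γ′ , 0<γ′ , gap) =
        let γ , 0<γ , 2γ≤a , γL≤γ′ = choose in γ , 0<γ , bound γ 0<γ 2γ≤a γL≤γ′
        where
        open ≤-Reasoning
        K = proj₁ (dot-bound b)
        0≤K = proj₁ (proj₂ (dot-bound b))
        B²≤KN = proj₂ (proj₂ (dot-bound b))
        L = 1# + (c * c * K + c * c * K)
        0≤cc : 0# ≤ c * c
        0≤cc = sq-nonneg c
        0<L : 0# < L
        0<L = +-pos-nonneg 0<1 (+-nonneg (*-nonneg 0≤cc 0≤K) (*-nonneg 0≤cc 0≤K))
        choose : ∃[ γ ] 0# < γ × γ + γ ≤ a × γ * L ≤ γ′
        choose with ≤-total (a ÷ (1# + 1#)) (γ′ ÷ L)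
        ... | inj₁ p = a ÷ (1# + 1#) , *-pos 0<a (⁻¹-pos 0<2)
                     , inj₂ (≈-trans (solve 1 (λ e → e :+ e := e :* :2) ≈-refl _) (÷-* 0<2))
                     , ≤-respʳ (÷-* 0<L) (*-monoʳ-≤ (<⇒≤ 0<L) p)
        ... | inj₂ p = γ′ ÷ L , *-pos 0<γ′ (⁻¹-pos 0<L)
                     , ≤-respˡ (solve 1 (λ e → e :* :2 := e :+ e) ≈-refl _)
                         (≤-respʳ (÷-* 0<2) (*-monoʳ-≤ (<⇒≤ 0<2) p))
                     , inj₂ (÷-* 0<L)
        module _ (γ : ℝ) (0<γ : 0# < γ) (2γ≤a : γ + γ ≤ a) (γL≤γ′ : γ * L ≤ γ′) where
          split : ∀ x n B → γ * (x * x + n) ≤ (γ + γ) * ((x + c * B) * (x + c * B)) + γ *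
              (n + (c * c + c * c) * (B * B))
          split x n B = ≤-by (*-nonneg (<⇒≤ 0<γ) (sq-nonneg (x + c * B + c * B)))
            (solve 5 (λ e x n c B → (e :+ e) :* ((x :+ c :* B) :* (x :+ c :* B)) :+ e :*
                (n :+ (c :* c :+ c :* c) :* (B :* B)) := e :* (x :* x :+ n) :+ e :*
                ((x :+ c :* B :+ c :* B) :* (x :+ c :* B :+ c :* B))) ≈-refl γ x n c B)
          bound : ∀ x → γ * N x ≤ Q M x
          bound x = begin
            γ * N x
              ≈⟨ *-congˡ (∑-suc _) ⟩
            γ * (x₀ * x₀ + N x′)
              ≤⟨ split x₀ (N x′) B ⟩
            (γ + γ) * (w * w) + γ * (N x′ + (c * c + c * c) * (B * B))
              ≤⟨ +-mono-≤ (*-monoʳ-≤ (sq-nonneg w) 2γ≤a)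
                  (*-monoˡ-≤ (<⇒≤ 0<γ) (+-monoʳ-≤ _ (*-monoˡ-≤ (+-nonneg 0≤cc 0≤cc) (B²≤KN x′)))) ⟩
            a * (w * w) + γ * (N x′ + (c * c + c * c) * (K * N x′))
              ≈⟨ +-congˡ (solve 4 (λ e n c k → e :* (n :+ (c :* c :+ c :* c) :* (k :* n)) := e :*
                  (:1 :+ (c :* c :* k :+ c :* c :* k)) :* n) ≈-refl γ (N x′) c K) ⟩
            a * (w * w) + γ * L * N x′
              ≤⟨ +-monoʳ-≤ _ (≤-trans (*-monoʳ-≤ (N-nonneg x′) γL≤γ′) (gap x′)) ⟩
            a * (w * w) + Q M′ x′
              ≈⟨ complete-square x ⟨
            Q M x ∎
            where
            x₀ = x zero
            x′ = x ∘ suc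
            B = ⟨ b , x′ ⟩
            w = x₀ + c * B

      extend-null : Null M′ → Null M
      extend-null (x , 0<Nx , Qx≈0) = lift x , <-respʳ (≈-sym (∑-suc _)) (+-nonneg-pos (sq-nonneg _) 0<Nx) , ≈-trans
          (Q-lift x) Qx≈0

      M′-psd : PSD M → PSD M′
      M′-psd M-psd x = ≤-respʳ (Q-lift x) (M-psd (lift x))

  a≤0⇒null : ∀ {n} (M : Matrix (suc n)) → PSD M → M zero zero ≤ 0# → Null M
  a≤0⇒null {n} M M-psd a≤0 = e₀ , N-pos e₀ zero (pos⇒≉0 0<1) , ≤-antisym (≤-respˡ (≈-sym Q-e₀) a≤0) (M-psd e₀)
    where
    e₀ : Vector ℝ (suc n)
    e₀ zero = 1#
    e₀ (suc _) = 0#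
    outer : ∀ j → j ≢ zero → e₀ j * (M ∙ e₀) j ≈ 0#
    outer zero q = contradiction ≡.refl q
    outer (suc j) _ = zeroˡ _
    inner : ∀ j → j ≢ zero → M zero j * e₀ j ≈ 0#
    inner zero q = contradiction ≡.refl q
    inner (suc j) _ = zeroʳ _
    Q-e₀ : Q M e₀ ≈ M zero zero
    Q-e₀ = ≈-trans (∑-single zero outer) (≈-trans (*-identityˡ _) (≈-trans (∑-single zero inner) (*-identityʳ _)))

  PSD⇒gap-or-null : ∀ {n} (M : Matrix n) → Symmetric M → PSD M → Gap M ⊎ Null M
  PSD⇒gap-or-null {zero} M _ _ = inj₁
      (1# , 0<1 , λ x → inj₂ (≈-trans (*-identityˡ _) (≈-trans (∑-zero _) (≈-sym (∑-zero _)))))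
  PSD⇒gap-or-null {suc n} M M-sym M-psd = [ positive , inj₂ ∘ a≤0⇒null M M-psd ]′ (<-or-≥ 0# (M zero zero))
    where
    positive : 0# < M zero zero → Gap M ⊎ Null M
    positive 0<a = [ inj₁ ∘ extend-gap , inj₂ ∘ extend-null ]′ (PSD⇒gap-or-null M′ M′-sym (M′-psd M-psd))
      where open Schur M M-sym 0<a

-- Absolute values and Perron pairs.

module Perron (R : CompleteOrderedField) where
  open Forms R public

  ∣_∣ᴿ : ℝ → ℝ
  ∣ x ∣ᴿ = [ (λ _ → x) , (λ _ → - x) ]′ (≤-total 0# x)

  ∣x∣-nonneg : ∀ x → 0# ≤ ∣ x ∣ᴿ
  ∣x∣-nonneg x with ≤-total 0# x
  ... | inj₁ p = p
  ... | inj₂ p = -‿anti-≤0 p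

  ∣x∣²≈x² : ∀ x → ∣ x ∣ᴿ * ∣ x ∣ᴿ ≈ x * x
  ∣x∣²≈x² x with ≤-total 0# x
  ... | inj₁ p = ≈-refl
  ... | inj₂ p = solve 1 (λ x → (:- x) :* (:- x) := x :* x) ≈-refl x

  x≤∣x∣ : ∀ x → x ≤ ∣ x ∣ᴿ
  x≤∣x∣ x with ≤-total 0# x
  ... | inj₁ p = ≤-refl
  ... | inj₂ p = ≤-trans p (-‿anti-≤0 p)

  -x≤∣x∣ : ∀ x → - x ≤ ∣ x ∣ᴿ
  -x≤∣x∣ x with ≤-total 0# x
  ... | inj₁ p = ≤-by (+-nonneg p p) (solve 1 (λ x → x := :- x :+ (x :+ x)) ≈-refl x)
  ... | inj₂ p = ≤-refl

  -- ( |x| - x)(|y| + y) + (|x| + x)(|y| - y) = 2(|x||y| - xy)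
  xy≤∣x∣∣y∣ : ∀ x y → x * y ≤ ∣ x ∣ᴿ * ∣ y ∣ᴿ
  xy≤∣x∣∣y∣ x y = *-cancelʳ-≤ 0<2 (≤-by
    (+-nonneg (*-nonneg (x≤y⇒0≤y-x (x≤∣x∣ x)) (≤-respʳ (neg y) (x≤y⇒0≤y-x (-x≤∣x∣ y))))
              (*-nonneg (≤-respʳ (neg x) (x≤y⇒0≤y-x (-x≤∣x∣ x))) (x≤y⇒0≤y-x (x≤∣x∣ y))))
    (solve 4 (λ x y u v → u :* v :* :2 := x :* y :* :2 :+
        ((u :- x) :* (v :+ y) :+ (u :+ x) :* (v :- y))) ≈-refl x y ∣ x ∣ᴿ ∣ y ∣ᴿ))
    where
    neg : ∀ x → ∣ x ∣ᴿ - (- x) ≈ ∣ x ∣ᴿ + x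
    neg x = solve 2 (λ u x → u :- (:- x) := u :+ x) ≈-refl ∣ x ∣ᴿ x

  -xy≤∣x∣∣y∣ : ∀ x y → - (x * y) ≤ ∣ x ∣ᴿ * ∣ y ∣ᴿ
  -xy≤∣x∣∣y∣ x y = ≤-respˡ (solve 2 (λ x y → (:- x) :* y := :- (x :* y)) ≈-refl x y)
    (≤-trans (xy≤∣x∣∣y∣ (- x) y) (*-monoʳ-≤ (∣x∣-nonneg y) (∣-x∣≤ x)))
    where
    ∣-x∣≤ : ∀ x → ∣ - x ∣ᴿ ≤ ∣ x ∣ᴿ
    ∣-x∣≤ x with ≤-total 0# (- x)
    ... | inj₁ _ = -x≤∣x∣ x
    ... | inj₂ _ = ≤-respˡ (solve 1 (λ x → x := :- (:- x)) ≈-refl x) (x≤∣x∣ x)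

  abs : ∀ {n} → Vector ℝ n → Vector ℝ n
  abs x i = ∣ x i ∣ᴿ

  N-abs : ∀ {n} (x : Vector ℝ n) → N (abs x) ≈ N x
  N-abs x = ∑-cong λ i → ∣x∣²≈x² (x i)

  Q-expand : ∀ {n} (M : Matrix n) x → Q M x ≈ ∑ (λ i → ∑ (λ j → M i j * (x i * x j)))
  Q-expand M x = ∑-cong λ i → ≈-trans (*-∑ (x i) _)
      (∑-cong λ j → solve 3 (λ x m y → x :* (m :* y) := m :* (x :* y)) ≈-refl (x i) (M i j) (x j))

  module _ {n} (A : Matrix n) (A≥0 : ∀ i j → 0# ≤ A i j) where
    Q-abs : ∀ x → Q A x ≤ Q A (abs x)
    Q-abs x = ≤-respˡ (≈-sym (Q-expand A x)) (≤-respʳ (≈-sym (Q-expand A (abs x)))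
      (∑-mono-≤ λ i → ∑-mono-≤ λ j → *-monoˡ-≤ (A≥0 i j) (xy≤∣x∣∣y∣ (x i) (x j))))

    -- The spectral radius counts moduli, so negative eigenvalues need a bound too: for them the
    -- Rayleigh inequality is applied to `abs x`.
    Q-abs⁻ : ∀ x → - Q A x ≤ Q A (abs x)
    Q-abs⁻ x = ≤-respˡ -Q (≤-respʳ (≈-sym (Q-expand A (abs x)))
      (∑-mono-≤ λ i → ∑-mono-≤ λ j → *-monoˡ-≤ (A≥0 i j) (-xy≤∣x∣∣y∣ (x i) (x j))))
      where
      neg : ∀ {k} (f : Vector ℝ k) → ∑ (λ i → - f i) ≈ - ∑ f
      neg f = ≈-trans (∑-cong λ i → solve 1 (λ x → :- x := (:- :1) :* x) ≈-refl (f i))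
                (≈-trans (≈-sym (*-∑ (- 1#) f)) (solve 1 (λ x → (:- :1) :* x := :- x) ≈-refl (∑ f)))
      -Q : ∑ (λ i → ∑ (λ j → A i j * - (x i * x j))) ≈ - Q A x
      -Q = ≈-trans (∑-cong λ i → ≈-trans
          (∑-cong λ j → solve 2 (λ a b → a :* (:- b) := :- (a :* b)) ≈-refl (A i j) (x i * x j)) (neg _))
             (≈-trans (neg _) (-‿cong (≈-sym (Q-expand A x))))

    xᵢxⱼ≤N : ∀ (x : Vector ℝ n) i j → x i * x j ≤ N x
    xᵢxⱼ≤N x i j = *-cancelʳ-≤ 0<2 (begin
      x i * x j * (1# + 1#) ≤⟨ ≤-by (sq-nonneg (x i - x j))
          (solve 2 (λ x y → x :* x :+ y :* y := x :* y :* :2 :+ (x :- y) :* (x :- y)) ≈-refl (x i) (x j)) ⟩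
      x i * x i + x j * x j ≤⟨ +-mono-≤ (≤-∑ (λ i → sq-nonneg (x i)) i) (≤-∑ (λ i → sq-nonneg (x i)) j) ⟩
      N x + N x ≈⟨ solve 1 (λ n → n :+ n := n :* :2) ≈-refl (N x) ⟩
      N x * (1# + 1#) ∎)
      where open ≤-Reasoning

    total-weight : ℝ
    total-weight = ∑ (λ i → ∑ (λ j → A i j))

    -- Any bound would do; it serves only to make the supremum of the Rayleigh quotients exist.
    Q≤KN : ∀ x → Q A x ≤ total-weight * N x
    Q≤KN x = begin
      Q A x ≈⟨ Q-expand A x ⟩
      ∑ (λ i → ∑ (λ j → A i j * (x i * x j))) ≤⟨ ∑-mono-≤ (λ i → ∑-mono-≤ λ j → *-monoˡ-≤ (A≥0 i j) (xᵢxⱼ≤N x i j)) ⟩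
      ∑ (λ i → ∑ (λ j → A i j * N x)) ≈⟨ ∑-cong
          (λ i → ≈-trans (∑-cong λ j → *-comm _ _) (≈-trans (≈-sym (*-∑ (N x) _)) (*-comm _ _))) ⟩
      ∑ (λ i → ∑ (λ j → A i j) * N x) ≈⟨ ≈-trans (∑-cong λ i → *-comm _ _)
          (≈-trans (≈-sym (*-∑ (N x) _)) (*-comm _ _)) ⟩
      total-weight * N x ∎
      where open ≤-Reasoning

  record PerronPair {n} (A : Matrix n) : Set where
    field
      ρ : ℝ
      x : Vector ℝ n
      x-nonneg : ∀ i → 0# ≤ x i
      x-nonzero : 0# < N x
      eigen : ∀ i → (A ∙ x) i ≈ ρ * x i
      rayleigh : ∀ y → Q A y ≤ ρ * N y

    ρ-nonneg : (∀ i j → 0# ≤ A i j) → 0# ≤ ρ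
    ρ-nonneg A≥0 = *-cancelʳ-≤ x-nonzero (begin
      0# * N x ≈⟨ zeroˡ _ ⟩
      0# ≤⟨ ∑-nonneg (λ i → *-nonneg (x-nonneg i) (∑-nonneg λ j → *-nonneg (A≥0 i j) (x-nonneg j))) ⟩
      Q A x ≤⟨ rayleigh x ⟩
      ρ * N x ∎)
      where open ≤-Reasoning

  module _ {n} (A : Matrix n) (ρ : ℝ) where
    deficit : Matrix n
    deficit i j = (if does (i ≟ j) then ρ else 0#) - A i j

    deficit-∙ : ∀ x i → (deficit ∙ x) i ≈ ρ * x i - (A ∙ x) i
    deficit-∙ x i = begin
      (deficit ∙ x) i ≈⟨ ∑-cong (λ j → solve 3 (λ d a x → (d :- a) :* x := d :* x :- a :* x) ≈-refl _ (A i j) (x j)) ⟩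
      ∑ (λ j → (if does (i ≟ j) then ρ else 0#) * x j - A i j * x j) ≈⟨ ∑-minus _ _ ⟩
      ∑ (λ j → (if does (i ≟ j) then ρ else 0#) * x j) - (A ∙ x) i ≈⟨ +-congʳ (≈-trans (∑-single i off) diagonal) ⟩
      ρ * x i - (A ∙ x) i ∎
      where
      open ≈-Reasoning
      off : ∀ j → j ≢ i → (if does (i ≟ j) then ρ else 0#) * x j ≈ 0#
      off j j≢i with i ≟ j
      ... | yes i≡j = contradiction (≡.sym i≡j) j≢i
      ... | no _ = zeroˡ _
      diagonal : (if does (i ≟ i) then ρ else 0#) * x i ≈ ρ * x i
      diagonal with i ≟ i
      ... | yes _ = ≈-refl
      ... | no i≢i = contradiction ≡.refl i≢i

    Q-deficit : ∀ x → Q deficit x ≈ ρ * N x - Q A x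
    Q-deficit x = begin
      Q deficit x ≈⟨ ∑-cong (λ i → ≈-trans (*-congˡ (deficit-∙ x i))
          (solve 3 (λ x r a → x :* (r :* x :- a) := r :* (x :* x) :- x :* a) ≈-refl (x i) ρ _)) ⟩
      ∑ (λ i → ρ * (x i * x i) - x i * (A ∙ x) i) ≈⟨ ∑-minus _ _ ⟩
      ∑ (λ i → ρ * (x i * x i)) - Q A x ≈⟨ +-congʳ (≈-sym (*-∑ ρ _)) ⟩
      ρ * N x - Q A x ∎
      where open ≈-Reasoning

    deficit-sym : Symmetric A → Symmetric deficit
    deficit-sym A-sym i j = +-cong off-diagonal (-‿cong (A-sym i j))
      where
      off-diagonal : (if does (i ≟ j) then ρ else 0#) ≈ (if does (j ≟ i) then ρ else 0#)
      off-diagonal with i ≟ j | j ≟ i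
      ... | yes _ | yes _ = ≈-refl
      ... | no _ | no _ = ≈-refl
      ... | yes i≡j | no j≢i = contradiction (≡.sym i≡j) j≢i
      ... | no i≢j | yes j≡i = contradiction (≡.sym j≡i) i≢j

    deficit-psd : (∀ y → Q A y ≤ ρ * N y) → PSD deficit
    deficit-psd r y = ≤-respʳ (≈-sym (Q-deficit y)) (x≤y⇒0≤y-x (r y))

  -- A vector attaining the bound is null for the semidefinite form of `deficit`, hence in its
  -- kernel. Besides yielding the Perron vector, this is the equality case that is refuted in the
  -- strict comparison.
  rayleigh-attained⇒eigen : ∀ {n} (A : Matrix n) ρ → Symmetric A → (∀ y → Q A y ≤ ρ * N y) →
                           ∀ x → ρ * N x ≤ Q A x → ∀ i → (A ∙ x) i ≈ ρ * x i
  rayleigh-attained⇒eigen A ρ A-sym r x attained i = ≈-sym (begin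
    ρ * x i ≈⟨ solve 2 (λ p a → p := (p :- a) :+ a) ≈-refl _ _ ⟩
    (ρ * x i - (A ∙ x) i) + (A ∙ x) i ≈⟨ +-congʳ (deficit-∙ A ρ x i) ⟨
    (deficit A ρ ∙ x) i + (A ∙ x) i ≈⟨ +-congʳ
        (PSD-null⇒kernel {M = deficit A ρ} (deficit-sym A ρ A-sym) (deficit-psd A ρ r) x null i) ⟩
    0# + (A ∙ x) i ≈⟨ +-identityˡ _ ⟩
    (A ∙ x) i ∎)
    where
    open ≈-Reasoning
    null : Q (deficit A ρ) x ≈ 0#
    null = ≈-trans (Q-deficit A ρ x) (≈-trans (+-congʳ (≤-antisym attained (r x))) (-‿inverseʳ _))

  module _ {n} (A : Matrix n) (A-sym : Symmetric A) (A≥0 : ∀ i j → 0# ≤ A i j) (i₀ : Fin n) where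
    private
      S : ℝ → Set
      S t = ∃[ x ] 0# < N x × t * N x ≤ Q A x

      ones : Vector ℝ n
      ones _ = 1#

      S-inhabited : S 0#
      S-inhabited = ones , N-pos ones i₀ (pos⇒≉0 0<1)
        , ≤-respˡ (≈-sym (zeroˡ _)) (∑-nonneg λ i → *-nonneg (<⇒≤ 0<1) (∑-nonneg λ j → *-nonneg (A≥0 i j) (<⇒≤ 0<1)))

      bounded : ∀ {t} → S t → t ≤ total-weight A A≥0
      bounded (x , 0<Nx , p) = *-cancelʳ-≤ 0<Nx (≤-trans p (Q≤KN A A≥0 x))

      ρ : ℝ
      ρ = ⋁ S

      isSup = ⋁-isSupremum {S} (0# , S-inhabited) (total-weight A A≥0 , bounded)

      rayleigh : ∀ y → Q A y ≤ ρ * N y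
      rayleigh y with <-or-≥ 0# (N y)
      ... | inj₁ 0<N = ≤-respˡ (÷-* 0<N) (*-monoʳ-≤ (<⇒≤ 0<N) (proj₁ isSup (y , 0<N , inj₂ (÷-* 0<N))))
      ... | inj₂ N≤0 = inj₂ (≈-trans (∑-0 λ i → ≈-trans (*-congʳ (y≈0 i)) (zeroˡ _))
          (≈-sym (≈-trans (*-congˡ N≈0) (zeroʳ ρ))))
        where
        N≈0 = ≤-antisym N≤0 (N-nonneg y)
        y≈0 = N≈0⇒≈0 y N≈0

      no-gap : ¬ Gap (deficit A ρ)
      no-gap (γ , 0<γ , gap) = too-close (proj₂ isSup (<-by 0<γ (solve 2 (λ r e → r := r :- e :+ e) ≈-refl ρ γ)))
        where
        open ≤-Reasoning
        too-close : ¬ (∃[ t ] S t × ρ - γ < t)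
        too-close (t , (x , 0<Nx , p) , ρ-γ<t) = ≤⇒≯ (gap x) (begin-strict
          Q (deficit A ρ) x ≈⟨ Q-deficit A ρ x ⟩
          ρ * N x - Q A x ≤⟨ ≤-by (x≤y⇒0≤y-x p)
              (solve 3 (λ r t q → r :- t := r :- q :+ (q :- t)) ≈-refl (ρ * N x) (t * N x) (Q A x)) ⟩
          ρ * N x - t * N x <⟨ <-by (*-pos 0<Nx (x<y⇒0<y-x ρ-γ<t))
              (solve 4 (λ r t e n → e :* n := r :* n :- t :* n :+ n :* (t :- (r :- e))) ≈-refl ρ t γ (N x)) ⟩
          γ * N x ∎)

      null : Null (deficit A ρ)
      null = [ (λ g → contradiction g no-gap) , id ]′
          (PSD⇒gap-or-null (deficit A ρ) (deficit-sym A ρ A-sym) (deficit-psd A ρ rayleigh))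

    -- A null vector of `deficit` attains ρ. Passing to absolute values keeps the norm and does not
    -- lower the form, so a nonnegative vector attains ρ as well.
    perron : PerronPair A
    perron = record
      { ρ = ρ ; x = abs x ; x-nonneg = λ i → ∣x∣-nonneg (x i)
      ; x-nonzero = <-respʳ (≈-sym (N-abs x)) (proj₁ (proj₂ null))
      ; eigen = rayleigh-attained⇒eigen A ρ A-sym rayleigh (abs x) attained
      ; rayleigh = rayleigh
      }
      where
      open ≤-Reasoning
      x = proj₁ null
      attained : ρ * N (abs x) ≤ Q A (abs x)
      attained = begin
        ρ * N (abs x) ≈⟨ *-congˡ (N-abs x) ⟩
        ρ * N x ≈⟨ solve 2 (λ p q → p := (p :- q) :+ q) ≈-refl _ _ ⟩
        ρ * N x - Q A x + Q A x ≈⟨ +-congʳ (Q-deficit A ρ x) ⟨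
        Q (deficit A ρ) x + Q A x ≈⟨ +-congʳ (proj₂ (proj₂ null)) ⟩
        0# + Q A x ≈⟨ +-identityˡ _ ⟩
        Q A x ≤⟨ Q-abs A A≥0 x ⟩
        Q A (abs x) ∎

  -- Complex eigenvalues and the spectral radius.

  *-integral : ∀ {x y} → x * y ≈ 0# → x ≈ 0# ⊎ y ≈ 0#
  *-integral {x} {y} xy≈0 with compare x 0#
  ... | tri≈ _ x≈0 _ = inj₁ x≈0
  ... | tri< _ x≉0 _ = inj₂ (*-cancelʳ-≈ (sq-pos x≉0)
      (≈-trans (solve 2 (λ x y → y :* (x :* x) := x :* y :* x) ≈-refl x y)
      (≈-trans (*-congʳ xy≈0) (≈-trans (zeroˡ _) (≈-sym (zeroˡ _))))))
  ... | tri> _ x≉0 _ = inj₂ (*-cancelʳ-≈ (sq-pos x≉0)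
      (≈-trans (solve 2 (λ x y → y :* (x :* x) := x :* y :* x) ≈-refl x y)
      (≈-trans (*-congʳ xy≈0) (≈-trans (zeroˡ _) (≈-sym (zeroˡ _))))))

  square-roots : ∀ {r a} → r * r ≈ a * a → r ≈ a ⊎ r ≈ - a
  square-roots {r} {a} r²≈a² = [ (λ p → inj₁
      (≈-trans (≈-trans (solve 2 (λ r a → r := (r :- a) :+ a) ≈-refl r a) (+-congʳ p)) (+-identityˡ a)))
                               , (λ p → inj₂ (≈-trans (≈-trans (solve 2 (λ r a → r := (r :+ a) :- a) ≈-refl r a)
                                   (+-congʳ p)) (+-identityˡ (- a)))) ]′
    (*-integral (≈-trans (solve 2 (λ r a → (r :- a) :* (r :+ a) := r :* r :- a :* a) ≈-refl r a)
        (≈-trans (+-congʳ r²≈a²) (-‿inverseʳ _))))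

  module _ {n} (A : Matrix n) (A-sym : Symmetric A) (A≥0 : ∀ i j → 0# ≤ A i j) (P : PerronPair A) where
    open PerronPair P

    private
      Λ : ℝ → Set
      Λ r = 0# ≤ r × ∃[ a ] ∃[ b ] (r * r ≈ a * a + b * b) × IsEigenvalue A a b

      real-eigenvalue≤ρ : ∀ {a r w} → r * r ≈ a * a → 0# < N w → (∀ i → (A ∙ w) i ≈ a * w i) → r ≤ ρ
      real-eigenvalue≤ρ {a} {r} {w} r²≈a² 0<N Aw≈aw = *-cancelʳ-≤ 0<N ([ plus , minus ]′ (square-roots r²≈a²))
        where
        open ≤-Reasoning
        Q≈aN : Q A w ≈ a * N w
        Q≈aN = ≈-trans (⟨⟩-cong (λ _ → ≈-refl) Aw≈aw) (⟨⟩-scaleʳ a w w)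
        plus : r ≈ a → r * N w ≤ ρ * N w
        plus r≈a = begin
          r * N w ≈⟨ *-congʳ r≈a ⟩
          a * N w ≈⟨ Q≈aN ⟨
          Q A w ≤⟨ rayleigh w ⟩
          ρ * N w ∎
        minus : r ≈ - a → r * N w ≤ ρ * N w
        minus r≈-a = begin
          r * N w ≈⟨ *-congʳ r≈-a ⟩
          (- a) * N w ≈⟨ solve 2 (λ a n → (:- a) :* n := :- (a :* n)) ≈-refl a (N w) ⟩
          - (a * N w) ≈⟨ -‿cong Q≈aN ⟨
          - Q A w ≤⟨ Q-abs⁻ A A≥0 w ⟩
          Q A (abs w) ≤⟨ rayleigh (abs w) ⟩
          ρ * N (abs w) ≈⟨ *-congˡ (N-abs w) ⟩
          ρ * N w ∎

      -- ⟨y, Ax⟩ = ⟨x, Ay⟩ reads a⟨x,y⟩ - b|y|² = a⟨x,y⟩ + b|x|².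
      eigenvalue-real : ∀ {a b} {x y : Vector ℝ n} → 0# < N x + N y →
        (∀ i → (A ∙ x) i ≈ a * x i - b * y i) → (∀ i → (A ∙ y) i ≈ a * y i + b * x i) → b ≈ 0#
      eigenvalue-real {a} {b} {x} {y} 0<N Ax Ay = *-cancelʳ-≈ 0<N (begin
        b * (N x + N y)
          ≈⟨ solve 5 (λ a b xx yy xy → b :* (xx :+ yy) := (a :* xy :+ b :* xx) :-
              (a :* xy :+ (:- b) :* yy)) ≈-refl a b (N x) (N y) ⟨ x , y ⟩ ⟩
        (a * ⟨ x , y ⟩ + b * N x) - (a * ⟨ x , y ⟩ + (- b) * N y)
          ≈⟨ +-cong (≈-sym xAy) (-‿cong (≈-sym (≈-trans yAx (+-congʳ (*-congˡ (⟨⟩-comm y x)))))) ⟩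
        ⟨ x , A ∙ y ⟩ - ⟨ y , A ∙ x ⟩
          ≈⟨ +-congʳ (self-adjoint {M = A} A-sym x y) ⟩
        ⟨ y , A ∙ x ⟩ - ⟨ y , A ∙ x ⟩
          ≈⟨ -‿inverseʳ _ ⟩
        0#
          ≈⟨ zeroˡ _ ⟨
        0# * (N x + N y) ∎)
        where
        open ≈-Reasoning
        xAy : ⟨ x , A ∙ y ⟩ ≈ a * ⟨ x , y ⟩ + b * N x
        xAy = ≈-trans (⟨⟩-cong (λ _ → ≈-refl) Ay) (⟨⟩-linearʳ a b y x x)
        yAx : ⟨ y , A ∙ x ⟩ ≈ a * ⟨ y , x ⟩ + (- b) * N y
        yAx = ≈-trans (⟨⟩-cong (λ _ → ≈-refl)
            (λ i → ≈-trans (Ax i) (+-congˡ (solve 2 (λ b y → :- (b :* y) := (:- b) :* y) ≈-refl b (y i)))))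
            (⟨⟩-linearʳ a (- b) x y y)

      N+N-pos : ∀ (x y : Vector ℝ n) i → ¬ (x i ≈ 0# × y i ≈ 0#) → 0# < N x ⊎ 0# < N y
      N+N-pos x y i p with <-or-≥ 0# (N x) | <-or-≥ 0# (N y)
      ... | inj₁ q | _ = inj₁ q
      ... | inj₂ _ | inj₁ q = inj₂ q
      ... | inj₂ q | inj₂ r = contradiction
          (N≈0⇒≈0 x (≤-antisym q (N-nonneg x)) i , N≈0⇒≈0 y (≤-antisym r (N-nonneg y)) i) p

      -- Since b = 0, the real and imaginary parts of the eigenvector satisfy the eigenvalue
      -- equation for a separately, and at least one of them is nonzero.
      Λ≤ρ : ∀ {r} → Λ r → r ≤ ρ
      Λ≤ρ {r} (_ , a , b , r²≈ , x , y , (i , nz) , Ax , Ay) =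
        [ (λ 0<Nx → real-eigenvalue≤ρ {w = x} r²≈a² 0<Nx Ax′) ,
            (λ 0<Ny → real-eigenvalue≤ρ {w = y} r²≈a² 0<Ny Ay′) ]′ pos
        where
        pos = N+N-pos x y i nz
        opaque-sum : ∀ {z u : Vector ℝ n} → (∀ i → sum (λ j → A i j * z j) ≈ u i) → ∀ i → (A ∙ z) i ≈ u i
        opaque-sum p i = ≈-trans (≈-reflexive (∑≡sum _)) (p i)
        b≈0 : b ≈ 0#
        b≈0 = eigenvalue-real {x = x} {y}
            ([ (λ p → +-pos-nonneg p (N-nonneg y)) , (λ p → +-nonneg-pos (N-nonneg x) p) ]′ pos) (opaque-sum Ax)
            (opaque-sum Ay)
        r²≈a² : r * r ≈ a * a
        r²≈a² = ≈-trans r²≈ (≈-trans (+-congˡ (*-congʳ b≈0))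
            (solve 2 (λ a b → a :* a :+ :0 :* b := a :* a) ≈-refl a b))
        Ax′ : ∀ i → (A ∙ x) i ≈ a * x i
        Ax′ i = ≈-trans (≈-trans (≈-reflexive (∑≡sum _)) (Ax i))
            (≈-trans (+-congˡ (-‿cong (*-congʳ b≈0)))
            (solve 3 (λ a x y → a :* x :- :0 :* y := a :* x) ≈-refl a (x i) (y i)))
        Ay′ : ∀ i → (A ∙ y) i ≈ a * y i
        Ay′ i = ≈-trans (≈-trans (≈-reflexive (∑≡sum _)) (Ay i))
            (≈-trans (+-congˡ (*-congʳ b≈0)) (solve 3 (λ a x y → a :* y :+ :0 :* x := a :* y) ≈-refl a (x i) (y i)))

      zero-or-not : ∀ z → z ≈ 0# ⊎ z ≉ 0#
      zero-or-not z with compare z 0#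
      ... | tri≈ _ p _ = inj₁ p
      ... | tri< _ p _ = inj₂ p
      ... | tri> _ p _ = inj₂ p

      witness : ∃[ i ] ¬ (x i ≈ 0# × 0# ≈ 0#)
      witness with Fin.any? (λ i → excluded-middle (x i ≉ 0#))
      ... | yes (i , p) = i , λ q → p (proj₁ q)
      ... | no ¬p = contradiction x-nonzero
          (≤⇒≯ (inj₂ (∑-0 λ i → [ (λ p → ≈-trans (*-congʳ p) (zeroˡ _)) , (λ p → contradiction (i , p) ¬p) ]′
          (zero-or-not (x i)))))

      ρ∈Λ : Λ ρ
      ρ∈Λ = ρ-nonneg A≥0 , ρ , 0# , solve 1 (λ r → r :* r := r :* r :+ :0 :* :0) ≈-refl ρ
          , x , (λ _ → 0#) , witness
          , (λ i → ≈-trans (≈-trans (≈-sym (≈-reflexive (∑≡sum _))) (eigen i))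
              (solve 2 (λ r x → r :* x := r :* x :- :0 :* :0) ≈-refl ρ (x i)))
          , (λ i → ≈-trans (≈-sym (≈-reflexive (∑≡sum _)))
              (≈-trans (∑-0 λ j → zeroʳ (A i j)) (solve 2 (λ r x → :0 := r :* :0 :+ :0 :* x) ≈-refl ρ (x i))))

    spectralRadius≈ρ : spectralRadius A ≈ ρ
    spectralRadius≈ρ = ≤-antisym (≮⇒≥ no-larger) (proj₁ isSup ρ∈Λ)
      where
      isSup = ⋁-isSupremum {Λ} (ρ , ρ∈Λ) (ρ , Λ≤ρ)
      no-larger : ¬ (ρ < ⋁ Λ)
      no-larger p = let r , r∈Λ , ρ<r = proj₂ isSup p in ≤⇒≯ (Λ≤ρ r∈Λ) ρ<r

-- Spectral radii of linear hypergraphs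

module Adjacency (R : CompleteOrderedField) where
  open Perron R public

  𝟙 : ∀ {P : Set} → Dec P → ℝ
  𝟙 d = if does d then 1# else 0#

  𝟙-yes : ∀ {P : Set} (d : Dec P) → P → 𝟙 d ≈ 1#
  𝟙-yes (yes _) _ = ≈-refl
  𝟙-yes (no ¬p) p = contradiction p ¬p

  𝟙-no : ∀ {P : Set} (d : Dec P) → ¬ P → 𝟙 d ≈ 0#
  𝟙-no (yes p) ¬p = contradiction p ¬p
  𝟙-no (no _) _ = ≈-refl

  𝟙-nonneg : ∀ {P : Set} (d : Dec P) → 0# ≤ 𝟙 d
  𝟙-nonneg (yes _) = <⇒≤ 0<1
  𝟙-nonneg (no _) = ≤-refl

  𝟙*-yes : ∀ {P : Set} (d : Dec P) {a} → P → 𝟙 d * a ≈ a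
  𝟙*-yes d p = ≈-trans (*-congʳ (𝟙-yes d p)) (*-identityˡ _)

  𝟙*-no : ∀ {P : Set} (d : Dec P) {a} → ¬ P → 𝟙 d * a ≈ 0#
  𝟙*-no d ¬p = ≈-trans (*-congʳ (𝟙-no d ¬p)) (zeroˡ _)

  𝟙-⇔ : ∀ {P P′ : Set} (d : Dec P) (d′ : Dec P′) → P ⇔ P′ → 𝟙 d ≈ 𝟙 d′
  𝟙-⇔ (yes p) d′ eq = ≈-sym (𝟙-yes d′ (Equivalence.to eq p))
  𝟙-⇔ (no ¬p) d′ eq = ≈-sym (𝟙-no d′ (¬p ∘ Equivalence.from eq))

  ∑-δ : ∀ {n} i (f : Vector ℝ n) → ∑ (λ j → 𝟙 (i ≟ j) * f j) ≈ f i
  ∑-δ i f = ≈-trans (∑-single i λ j j≢i → 𝟙*-no (i ≟ j) (j≢i ∘ ≡.sym)) (𝟙*-yes (i ≟ i) ≡.refl)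

  -- Turns a sum of indicators into a sum over an explicit list. It is applied to the members of an
  -- edge and to the edges at a vertex, which makes the rows of `L` computable.
  ∑-image : ∀ {n r} {P : Fin n → Set} (P? : ∀ j → Dec (P j)) (g : Fin r → Fin n) → Injective _≡_ _≡_ g →
            (∀ a → P (g a)) → (∀ j → P j → ∃[ a ] g a ≡ j) →
            ∀ f → ∑ (λ j → 𝟙 (P? j) * f j) ≈ ∑ (λ a → f (g a))
  ∑-image {P = P} P? g g-inj sound complete f = begin
    ∑ (λ j → 𝟙 (P? j) * f j) ≈⟨ ∑-cong fibre ⟩
    ∑ (λ j → ∑ (λ a → 𝟙 (g a ≟ j) * f j)) ≈⟨ ∑-comm _ ⟩
    ∑ (λ a → ∑ (λ j → 𝟙 (g a ≟ j) * f j)) ≈⟨ ∑-cong (λ a → ∑-δ (g a) f) ⟩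
    ∑ (λ a → f (g a)) ∎
    where
    open ≈-Reasoning
    fibre : ∀ j → 𝟙 (P? j) * f j ≈ ∑ (λ a → 𝟙 (g a ≟ j) * f j)
    fibre j with P? j
    ... | yes p = ≈-trans (*-identityˡ _)
        (≈-sym (≈-trans (∑-single a₀ λ a a≢a₀ → 𝟙*-no (g a ≟ j) (a≢a₀ ∘ unique a)) (𝟙*-yes (g a₀ ≟ j) ga₀≡j)))
      where
      a₀ = proj₁ (complete j p)
      ga₀≡j = proj₂ (complete j p)
      unique : ∀ a → g a ≡ j → a ≡ a₀
      unique a ga≡j = g-inj (≡.trans ga≡j (≡.sym ga₀≡j))
    ... | no ¬p = ≈-trans (zeroˡ _) (≈-sym (∑-0 λ a → 𝟙*-no (g a ≟ j) (λ ga≡j → ¬p (≡.subst P ga≡j (sound a)))))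

  module _ (H : Hypergraph) where
    edgeSum : Vector ℝ (order H) → Fin (size H) → ℝ
    edgeSum x e = ∑ λ j → 𝟙 (j ∈? edge H e) * x j

    -- (m - 1) times the adjacency operator.
    L : Vector ℝ (order H) → Vector ℝ (order H)
    L x i = ∑ λ e → 𝟙 (i ∈? edge H e) * (edgeSum x e - x i)

    -- The sum of xᵢ xⱼ over all ordered pairs i ≠ j in e.
    edgeForm : Vector ℝ (order H) → Fin (size H) → ℝ
    edgeForm x e = edgeSum x e * edgeSum x e - edgeSum (λ j → x j * x j) e

    edgeSum-pos-part : ∀ {x} → (∀ i → 0# ≤ x i) → ∀ {i e} → i ∈ edge H e → x i ≤ edgeSum x e
    edgeSum-pos-part {x} x≥0 {i} {e} i∈e = ≤-respˡ (𝟙*-yes (i ∈? edge H e) i∈e)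
      (≤-∑ (λ j → *-nonneg (𝟙-nonneg (j ∈? edge H e)) (x≥0 j)) i)

    edgeSum-pair : ∀ {x} → (∀ i → 0# < x i) → ∀ {i j e} → i ≢ j → i ∈ edge H e → j ∈ edge H e → x i < edgeSum x e
    edgeSum-pair {x} x>0 {i} {j} {e} i≢j i∈e j∈e = ≤-<-trans
      (inj₂ (≈-sym (∑-δ i x)))
      (∑-mono-< bound j (<-respˡ (≈-sym (𝟙*-no (i ≟ j) i≢j)) (<-respʳ (≈-sym (𝟙*-yes (j ∈? edge H e) j∈e)) (x>0 j))))
      where
      bound : ∀ k → 𝟙 (i ≟ k) * x k ≤ 𝟙 (k ∈? edge H e) * x k
      bound k with i ≟ k
      ... | yes ≡.refl = inj₂ (≈-trans (*-identityˡ _) (≈-sym (𝟙*-yes (i ∈? edge H e) i∈e)))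
      ... | no _ = ≤-respˡ (≈-sym (zeroˡ _)) (*-nonneg (𝟙-nonneg (k ∈? edge H e)) (<⇒≤ (x>0 k)))

    ⟨x,Lx⟩ : ∀ x → ⟨ x , L x ⟩ ≈ ∑ (edgeForm x)
    ⟨x,Lx⟩ x = begin
      ∑ (λ i → x i * ∑ (λ e → 𝟙 (i ∈? edge H e) * (edgeSum x e - x i)))
        ≈⟨ ∑-cong (λ i → *-∑ (x i) _) ⟩
      ∑ (λ i → ∑ (λ e → x i * (𝟙 (i ∈? edge H e) * (edgeSum x e - x i))))
        ≈⟨ ∑-comm _ ⟩
      ∑ (λ e → ∑ (λ i → x i * (𝟙 (i ∈? edge H e) * (edgeSum x e - x i))))
        ≈⟨ ∑-cong (λ e → ∑-cong λ i → solve 3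
            (λ x d s → x :* (d :* (s :- x)) := s :* (d :* x) :- d :* (x :* x)) ≈-refl (x i) _ (edgeSum x e)) ⟩
      ∑ (λ e → ∑ (λ i → edgeSum x e * (𝟙 (i ∈? edge H e) * x i) - 𝟙 (i ∈? edge H e) * (x i * x i)))
        ≈⟨ ∑-cong (λ e → ≈-trans (∑-minus _ _) (+-congʳ (≈-sym (*-∑ (edgeSum x e) _)))) ⟩
      ∑ (edgeForm x) ∎
      where open ≈-Reasoning

  module _ {m} (m≥2 : 2 ℕ.≤ m) where
    0<m-1 : 0# < ι m - 1#
    0<m-1 = lemma m≥2
      where
      lemma : ∀ {m} → 2 ℕ.≤ m → 0# < ι m - 1#
      lemma {suc (suc r)} (s≤s (s≤s _)) = <-respʳ (solve 1 (λ n → n := :1 :+ n :- :1) ≈-refl (ι (suc r))) (ι-pos r)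

    weight : ℝ
    weight = (ι m - 1#) ⁻¹

    0<weight : 0# < weight
    0<weight = ⁻¹-pos 0<m-1

    weight-inverse : ∀ x → (ι m - 1#) * (weight * x) ≈ x
    weight-inverse x = ≈-trans (≈-sym (*-assoc _ _ _))
        (≈-trans (*-congʳ (⁻¹-inverseʳ (pos⇒≉0 0<m-1))) (*-identityˡ x))

    module _ (H : Hypergraph) where
      private
        Adjacent : Fin (order H) → Fin (order H) → Set
        Adjacent i j = ∃[ e ] i ∈ edge H e × j ∈ edge H e

        adj? : ∀ i j → Dec (i ≢ j × Adjacent i j)
        adj? i j = ¬? (i ≟ j) ×-dec any? λ e → (i ∈? edge H e) ×-dec (j ∈? edge H e)

        if-yes : ∀ {P : Set} (d : Dec P) → P → (if does d then weight else 0#) ≈ weight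
        if-yes (yes _) _ = ≈-refl
        if-yes (no ¬p) p = contradiction p ¬p

        if-no : ∀ {P : Set} (d : Dec P) → ¬ P → (if does d then weight else 0#) ≈ 0#
        if-no (yes p) ¬p = contradiction p ¬p
        if-no (no _) _ = ≈-refl

        flip-adj : ∀ {i j} → i ≢ j × Adjacent i j → j ≢ i × Adjacent j i
        flip-adj (p , e , q , r) = p ∘ ≡.sym , e , r , q

        adj-cases : ∀ i j → ((i ≢ j × Adjacent i j) × adjacency m H i j ≈ weight) ⊎
            (¬ (i ≢ j × Adjacent i j) × adjacency m H i j ≈ 0#)
        adj-cases i j = cases (adj? i j)
          where
          cases : Dec (i ≢ j × Adjacent i j) → _
          cases (yes p) = inj₁ (p , if-yes (adj? i j) p)
          cases (no ¬p) = inj₂ (¬p , if-no (adj? i j) ¬p)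

      adjacency-sym : Symmetric (adjacency m H)
      adjacency-sym i j with adj-cases i j
      ... | inj₁ (p , eq) = ≈-trans eq (≈-sym (if-yes (adj? j i) (flip-adj p)))
      ... | inj₂ (¬p , eq) = ≈-trans eq (≈-sym (if-no (adj? j i) (¬p ∘ flip-adj)))

      adjacency-nonneg : ∀ i j → 0# ≤ adjacency m H i j
      adjacency-nonneg i j with adj-cases i j
      ... | inj₁ (_ , eq) = ≤-respʳ (≈-sym eq) (<⇒≤ 0<weight)
      ... | inj₂ (_ , eq) = inj₂ (≈-sym eq)

      module _ (linear : Linear H) where
        private
          common : ∀ i j → Fin (size H) → ℝ
          common i j e = 𝟙 (i ∈? edge H e) * (𝟙 (j ∈? edge H e) * 𝟙 (¬? (i ≟ j)))

          -- Here linearity enters: two adjacent vertices have exactly one common edge, so the sum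
          -- over the edges counts their adjacency once.
          entry : ∀ i j → adjacency m H i j ≈ weight * ∑ (common i j)
          entry i j with adj-cases i j
          ... | inj₁ ((i≢j , e , i∈e , j∈e) , eq) = ≈-trans eq
              (≈-sym (≈-trans (*-congˡ (≈-trans (∑-single e others) one)) (*-identityʳ _)))
            where
            one : common i j e ≈ 1#
            one = ≈-trans (𝟙*-yes (i ∈? _) i∈e) (≈-trans (𝟙*-yes (j ∈? _) j∈e) (𝟙-yes (¬? (i ≟ j)) i≢j))
            others : ∀ f → f ≢ e → common i j f ≈ 0#
            others f f≢e with i ∈? edge H f | j ∈? edge H f
            ... | yes i∈f | yes j∈f = contradiction (linear⇒same-edge {H} linear i≢j i∈f j∈f i∈e j∈e) f≢e
            ... | no _ | _ = zeroˡ _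
            ... | yes _ | no _ = ≈-trans (*-identityˡ _) (zeroˡ _)
          ... | inj₂ (¬adj , eq) = ≈-trans eq (≈-sym (≈-trans (*-congˡ (∑-0 none)) (zeroʳ _)))
            where
            none : ∀ e → common i j e ≈ 0#
            none e with i ∈? edge H e | j ∈? edge H e | i ≟ j
            ... | no _ | _ | _ = zeroˡ _
            ... | yes _ | no _ | _ = ≈-trans (*-identityˡ _) (zeroˡ _)
            ... | yes _ | yes _ | yes _ = ≈-trans (*-identityˡ _) (*-identityˡ _)
            ... | yes i∈e | yes j∈e | no i≢j = contradiction (i≢j , e , i∈e , j∈e) ¬adj

          others-sum : ∀ x i e → 𝟙 (i ∈? edge H e) * ∑ (λ j → 𝟙 (j ∈? edge H e) * 𝟙 (¬? (i ≟ j)) * x j)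
                                ≈ 𝟙 (i ∈? edge H e) * (edgeSum H x e - x i)
          others-sum x i e with i ∈? edge H e
          ... | no _ = ≈-trans (zeroˡ _) (≈-sym (zeroˡ _))
          ... | yes i∈e = *-congˡ (begin
            ∑ (λ j → 𝟙 (j ∈? edge H e) * 𝟙 (¬? (i ≟ j)) * x j) ≈⟨ ∑-cong remove ⟩
            ∑ (λ j → 𝟙 (j ∈? edge H e) * x j - 𝟙 (i ≟ j) * x j) ≈⟨ ∑-minus _ _ ⟩
            edgeSum H x e - ∑ (λ j → 𝟙 (i ≟ j) * x j) ≈⟨ +-congˡ (-‿cong (∑-δ i x)) ⟩
            edgeSum H x e - x i ∎)
            where
            open ≈-Reasoning
            remove : ∀ j → 𝟙 (j ∈? edge H e) * 𝟙 (¬? (i ≟ j)) * x j ≈ 𝟙 (j ∈? edge H e) * x j - 𝟙 (i ≟ j) * x j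
            remove j with i ≟ j
            ... | no _ = solve 2 (λ d x → d :* :1 :* x := d :* x :- :0 :* x) ≈-refl _ (x j)
            ... | yes ≡.refl = ≈-trans (solve 2 (λ d x → d :* :0 :* x := :1 :* x :- :1 :* x) ≈-refl _ (x j))
                                 (+-congʳ (*-congʳ (≈-sym (𝟙-yes (i ∈? edge H e) i∈e))))

        adjacency-∙ : ∀ x i → (adjacency m H ∙ x) i ≈ weight * L H x i
        adjacency-∙ x i = begin
          ∑ (λ j → adjacency m H i j * x j) ≈⟨ ∑-cong
              (λ j → ≈-trans (*-congʳ (entry i j))
              (≈-trans (*-assoc _ _ _) (*-congˡ (≈-trans (*-comm _ _) (*-∑ (x j) _))))) ⟩
          ∑ (λ j → weight * ∑ (λ e → x j * common i j e)) ≈⟨ *-∑ weight _ ⟨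
          weight * ∑ (λ j → ∑ (λ e → x j * common i j e)) ≈⟨ *-congˡ (∑-comm _) ⟩
          weight * ∑ (λ e → ∑ (λ j → x j * common i j e))
            ≈⟨ *-congˡ (∑-cong λ e → ≈-trans
                (∑-cong λ j → solve 4 (λ x a b c → x :* (a :* (b :* c)) := a :* (b :* c :* x)) ≈-refl (x j) _ _ _)
                (≈-sym (*-∑ _ _))) ⟩
          weight * ∑ (λ e → 𝟙 (i ∈? edge H e) * ∑ (λ j → 𝟙 (j ∈? edge H e) * 𝟙 (¬? (i ≟ j)) * x j))
            ≈⟨ *-congˡ (∑-cong λ e → others-sum x i e) ⟩
          weight * L H x i ∎
          where open ≈-Reasoning

-- Positive Perron vectors, test vectors and the effect of moving a vertex in an edge.

module Comparison (R : CompleteOrderedField) where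
  open Adjacency R public

  -- From here on only the operator `L` is used, so μ is m - 1 times the spectral radius and the
  -- adjacency matrix no longer occurs. `attained` is the equality case of `rayleigh`.
  record PerronVector (m : ℕ) (H : Hypergraph) : Set where
    field
      μ : ℝ
      λ₁≈ : λ₁ m H ≈ (ι m - 1#) ⁻¹ * μ
      x : Vector ℝ (order H)
      x-pos : ∀ i → 0# < x i
      eigen : ∀ i → L H x i ≈ μ * x i
      rayleigh : ∀ y → ⟨ y , L H y ⟩ ≤ μ * N y
      attained : ∀ y → μ * N y ≤ ⟨ y , L H y ⟩ → ∀ i → L H y i ≈ μ * y i
      self-adjoint-L : ∀ y z → ⟨ y , L H z ⟩ ≈ ⟨ z , L H y ⟩

  module _ {m} (m≥2 : 2 ℕ.≤ m) (H : Hypergraph) (linear : Linear H) (connected : Connected H)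
      (P : PerronPair (adjacency m H)) where
    private
      A = adjacency m H
      open PerronPair P renaming (eigen to A-eigen; rayleigh to A-rayleigh)
      w-1 = ι m - 1#
      μ = w-1 * ρ

      L≈ : ∀ y i → L H y i ≈ w-1 * (A ∙ y) i
      L≈ y i = ≈-sym (≈-trans (*-congˡ (adjacency-∙ m≥2 H linear y i)) (weight-inverse m≥2 _))

      L-form : ∀ y z → ⟨ y , L H z ⟩ ≈ w-1 * ⟨ y , A ∙ z ⟩
      L-form y z = ≈-trans (⟨⟩-cong (λ _ → ≈-refl) (L≈ z)) (⟨⟩-scaleʳ w-1 y (A ∙ z))

      eigen : ∀ i → L H x i ≈ μ * x i
      eigen i = ≈-trans (L≈ x i) (≈-trans (*-congˡ (A-eigen i)) (≈-sym (*-assoc _ _ _)))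

      -- At a zero of `x` the eigenvalue equation equates a sum of nonnegative terms with zero, so
      -- the weight of every edge through that vertex vanishes.
      zero-spreads : ∀ {i j e} → i ∈ edge H e → j ∈ edge H e → x i ≈ 0# → x j ≈ 0#
      zero-spreads {i} {j} {e} i∈e j∈e xi≈0 = ≤-antisym (≤-trans (edgeSum-pos-part H x-nonneg j∈e) (inj₂ S≈0))
          (x-nonneg j)
        where
        term-nonneg : ∀ f → 0# ≤ 𝟙 (i ∈? edge H f) * (edgeSum H x f - x i)
        term-nonneg f with i ∈? edge H f
        ... | no _ = inj₂ (≈-sym (zeroˡ _))
        ... | yes i∈f = *-nonneg (<⇒≤ 0<1) (x≤y⇒0≤y-x (edgeSum-pos-part H x-nonneg i∈f))
        term≈0 : 𝟙 (i ∈? edge H e) * (edgeSum H x e - x i) ≈ 0#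
        term≈0 = ∑≈0⇒≈0 term-nonneg (≈-trans (eigen i) (≈-trans (*-congˡ xi≈0) (zeroʳ μ))) e
        S≈0 : edgeSum H x e ≈ 0#
        S≈0 = ≈-trans (solve 2 (λ s x → s := (s :- x) :+ x) ≈-refl _ (x i))
            (≈-trans (+-cong (≈-trans (≈-sym (𝟙*-yes (i ∈? edge H e) i∈e)) term≈0) xi≈0) (+-identityˡ 0#))

      all-zero : ∀ {i j} → Star (λ a b → ∃[ e ] a ∈ edge H e × b ∈ edge H e) i j → x i ≈ 0# → x j ≈ 0#
      all-zero ε p = p
      all-zero ((e , a∈e , b∈e) ◅ path) p = all-zero path (zero-spreads a∈e b∈e p)

      x-pos : ∀ i → 0# < x i
      x-pos i with x-nonneg i
      ... | inj₁ p = p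
      ... | inj₂ p = contradiction x-nonzero
          (≤⇒≯ (inj₂ (∑-0 λ j → ≈-trans (*-congʳ (all-zero (connected i j) (≈-sym p))) (zeroˡ _))))

    fromPerronPair : PerronVector m H
    fromPerronPair = record
      { μ = μ
      ; λ₁≈ = ≈-trans (spectralRadius≈ρ A (adjacency-sym m≥2 H) (adjacency-nonneg m≥2 H) P)
                (≈-sym (≈-trans (≈-sym (*-assoc _ _ _))
                    (≈-trans (*-congʳ (≈-trans (*-comm _ _) (⁻¹-inverseʳ (pos⇒≉0 (0<m-1 m≥2))))) (*-identityˡ ρ))))
      ; x = x ; x-pos = x-pos
      ; eigen = eigen
      ; rayleigh = λ y → ≤-respˡ (≈-sym (L-form y y))
          (≤-respʳ (≈-sym (*-assoc _ _ _)) (*-monoˡ-≤ (<⇒≤ (0<m-1 m≥2)) (A-rayleigh y)))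
      ; attained = λ y p i → ≈-trans (L≈ y i)
          (≈-trans (*-congˡ (rayleigh-attained⇒eigen A ρ (adjacency-sym m≥2 H) A-rayleigh y
                     (*-cancelˡ-≤′ (≤-respˡ (*-assoc _ _ _) (≤-respʳ (L-form y y) p))) i)) (≈-sym (*-assoc _ _ _)))
      ; self-adjoint-L = λ y z → ≈-trans (L-form y z)
          (≈-trans (*-congˡ (self-adjoint {M = A} (adjacency-sym m≥2 H) y z)) (≈-sym (L-form z y)))
      }
      where
      *-cancelˡ-≤′ : ∀ {a b} → w-1 * a ≤ w-1 * b → a ≤ b
      *-cancelˡ-≤′ p = *-cancelʳ-≤ (0<m-1 m≥2) (≤-respˡ (*-comm _ _) (≤-respʳ (*-comm _ _) p))

  opaque
    perronVector : ∀ {m} → 2 ℕ.≤ m → (H : Hypergraph) → Linear H → Connected H → Fin (order H) → PerronVector m H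
    perronVector m≥2 H linear connected i₀ = fromPerronPair m≥2 H linear connected
      (perron _ (adjacency-sym m≥2 H) (adjacency-nonneg m≥2 H) i₀)

  module _ {m H} (P : PerronVector m H) where
    open PerronVector P

    private
      -- As `x` is positive, pairing with it turns entrywise comparisons of `L z` with ρ z into
      -- comparisons of μ with ρ, in the manner of Collatz and Wielandt.
      pairing : ∀ z → ⟨ x , L H z ⟩ ≈ μ * ⟨ x , z ⟩
      pairing z = ≈-trans (self-adjoint-L x z)
          (≈-trans (⟨⟩-cong (λ _ → ≈-refl) eigen) (≈-trans (⟨⟩-scaleʳ μ z x) (*-congˡ (⟨⟩-comm z x))))

      ⟨x,z⟩-nonneg : ∀ {z} → (∀ i → 0# ≤ z i) → 0# ≤ ⟨ x , z ⟩
      ⟨x,z⟩-nonneg z≥0 = ∑-nonneg λ i → *-nonneg (<⇒≤ (x-pos i)) (z≥0 i)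

    subsolution : ∀ {ρ z} → (∀ i → 0# ≤ z i) → (∀ i → ρ * z i ≤ L H z i) → ∀ i → 0# < z i → ρ ≤ μ
    subsolution {ρ} {z} z≥0 sub i 0<zi = *-cancelʳ-≤
        (∑-pos (λ j → *-nonneg (<⇒≤ (x-pos j)) (z≥0 j)) i (*-pos (x-pos i) 0<zi)) (begin
      ρ * ⟨ x , z ⟩ ≈⟨ ⟨⟩-scaleʳ ρ x z ⟨
      ⟨ x , (λ j → ρ * z j) ⟩ ≤⟨ ∑-mono-≤ (λ j → *-monoˡ-≤ (<⇒≤ (x-pos j)) (sub j)) ⟩
      ⟨ x , L H z ⟩ ≈⟨ pairing z ⟩
      μ * ⟨ x , z ⟩ ∎)
      where open ≤-Reasoning

    strict-subsolution : ∀ {ρ z} → (∀ i → 0# ≤ z i) → (∀ i → ρ * z i ≤ L H z i) → ∀ i → ρ * z i < L H z i → ρ < μ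
    strict-subsolution {ρ} {z} z≥0 sub i strictly = *-cancelʳ-< (⟨x,z⟩-nonneg z≥0) (begin-strict
      ρ * ⟨ x , z ⟩ ≈⟨ ⟨⟩-scaleʳ ρ x z ⟨
      ⟨ x , (λ j → ρ * z j) ⟩ <⟨ ∑-mono-< (λ j → *-monoˡ-≤ (<⇒≤ (x-pos j)) (sub j)) i (*-monoˡ-< (x-pos i) strictly) ⟩
      ⟨ x , L H z ⟩ ≈⟨ pairing z ⟩
      μ * ⟨ x , z ⟩ ∎)
      where open ≤-Reasoning

    strict-supersolution : ∀ {ρ z} → (∀ i → 0# ≤ z i) → (∀ i → L H z i ≤ ρ * z i) → ∀ i → L H z i < ρ * z i → μ < ρ
    strict-supersolution {ρ} {z} z≥0 super i strictly = *-cancelʳ-< (⟨x,z⟩-nonneg z≥0) (begin-strict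
      μ * ⟨ x , z ⟩ ≈⟨ pairing z ⟨
      ⟨ x , L H z ⟩ <⟨ ∑-mono-< (λ j → *-monoˡ-≤ (<⇒≤ (x-pos j)) (super j)) i (*-monoˡ-< (x-pos i) strictly) ⟩
      ⟨ x , (λ j → ρ * z j) ⟩ ≈⟨ ⟨⟩-scaleʳ ρ x z ⟩
      ρ * ⟨ x , z ⟩ ∎)
      where open ≤-Reasoning

  module Shift {H T : Hypergraph} (σ : Fin (order T) ↔ Fin (order H)) (ψ : Fin (size T) ↔ Fin (size H)) where
    open Inverse σ using () renaming (to to σ→; from to σ←) public
    open Inverse ψ using () renaming (to to ψ→; from to ψ←) public

    Same : Fin (size T) → Set
    Same e = ∀ j → σ← j ∈ edge T e ⇔ j ∈ edge H (ψ→ e)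

    -- `q` is a vertex that stays in the edge. Its positive weight is part of what row `u` gains,
    -- and so keeps that gain positive even when x p = x u.
    record Moved (u : Fin (order H)) (x : Vector ℝ (order H)) (e : Fin (size T)) : Set where
      field
        p : Fin (order H)
        p∈ : p ∈ edge H (ψ→ e)
        u∉ : u ∉ edge H (ψ→ e)
        p∉′ : σ← p ∉ edge T e
        u∈′ : σ← u ∈ edge T e
        others : ∀ j → j ≢ p → j ≢ u → σ← j ∈ edge T e ⇔ j ∈ edge H (ψ→ e)
        q : Fin (order H)
        q≢p : q ≢ p
        q∈ : q ∈ edge H (ψ→ e)
        xp≤xu : x p ≤ x u

    module _ {m} (PH : PerronVector m H) (PT : PerronVector m T) (u : Fin (order H))
             (change : ∀ e → Same e ⊎ Moved u (PerronVector.x PH) e) where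
      open PerronVector PH
      open PerronVector PT using () renaming (μ to μ′; rayleigh to rayleigh′; attained to attained′)

      private
        z : Vector ℝ (order T)
        z i = x (σ→ i)

        σ-sum : ∀ (g : Vector ℝ (order H)) e → edgeSum T (λ i → g (σ→ i)) e ≈ ∑ (λ j → 𝟙 (σ← j ∈? edge T e) * g j)
        σ-sum g e = ≈-sym (≈-trans (∑-permute _ σ)
            (∑-cong λ i → *-congʳ (≈-reflexive (≡.cong (λ k → 𝟙 (k ∈? edge T e)) (Inverse.strictlyInverseʳ σ i)))))

        same-sum : ∀ {e} → Same e → ∀ g → edgeSum T (λ i → g (σ→ i)) e ≈ edgeSum H g (ψ→ e)
        same-sum {e} same g = ≈-trans (σ-sum g e)
            (∑-cong λ j → *-congʳ (𝟙-⇔ (σ← j ∈? edge T e) (j ∈? edge H (ψ→ e)) (same j)))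

        -- Holds for every `g` because the edge form involves the sums both of `x` and of its
        -- squares.
        moved-sum : ∀ {e} (M : Moved u x e) → let open Moved M in ∀ g → edgeSum T (λ i → g (σ→ i)) e ≈ edgeSum H g (ψ→ e) + (g u - g p)
        moved-sum {e} M g = ≈-trans (σ-sum g e) (begin
          ∑ (λ j → 𝟙 (σ← j ∈? edge T e) * g j) ≈⟨ ∑-cong pointwise ⟩
          ∑ (λ j → 𝟙 (j ∈? edge H (ψ→ e)) * g j + (𝟙 (u ≟ j) * g j - 𝟙 (p ≟ j) * g j)) ≈⟨ ∑-+ _ _ ⟩
          edgeSum H g (ψ→ e) + ∑ (λ j → 𝟙 (u ≟ j) * g j - 𝟙 (p ≟ j) * g j) ≈⟨ +-congˡ
              (≈-trans (∑-minus _ _) (+-cong (∑-δ u g) (-‿cong (∑-δ p g)))) ⟩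
          edgeSum H g (ψ→ e) + (g u - g p) ∎)
          where
          open ≈-Reasoning
          open Moved M
          indicator : ∀ j → 𝟙 (σ← j ∈? edge T e) ≈ 𝟙 (j ∈? edge H (ψ→ e)) + (𝟙 (u ≟ j) - 𝟙 (p ≟ j))
          indicator j with u ≟ j | p ≟ j
          ... | yes ≡.refl | yes ≡.refl = contradiction u∈′ p∉′
          ... | yes ≡.refl | no _ = ≈-trans (𝟙-yes (σ← u ∈? _) u∈′)
              (≈-sym (≈-trans (+-congʳ (𝟙-no (u ∈? _) u∉)) (solve 0 (:0 :+ (:1 :- :0) := :1) ≈-refl)))
          ... | no _ | yes ≡.refl = ≈-trans (𝟙-no (σ← p ∈? _) p∉′)
              (≈-sym (≈-trans (+-congʳ (𝟙-yes (p ∈? _) p∈)) (solve 0 (:1 :+ (:0 :- :1) := :0) ≈-refl)))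
          ... | no u≢j | no p≢j = ≈-trans (𝟙-⇔ (σ← j ∈? _) (j ∈? _) (others j (p≢j ∘ ≡.sym) (u≢j ∘ ≡.sym)))
              (solve 1 (λ d → d := d :+ (:0 :- :0)) ≈-refl _)
          pointwise : ∀ j → 𝟙 (σ← j ∈? edge T e) * g j ≈ 𝟙 (j ∈? edge H (ψ→ e)) * g j +
              (𝟙 (u ≟ j) * g j - 𝟙 (p ≟ j) * g j)
          pointwise j = ≈-trans (*-congʳ (indicator j))
              (solve 4 (λ a b c x → (a :+ (b :- c)) :* x := a :* x :+ (b :* x :- c :* x)) ≈-refl _ _ _ (g j))

        -- With S the old edge sum, a moved edge gains 2 (x u - x p)(S - x p): the squares of x u
        -- and x p cancel against the change of the diagonal part.
        form-≤ : ∀ e → edgeForm H x (ψ→ e) ≤ edgeForm T z e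
        form-≤ e with change e
        ... | inj₁ same = inj₂ (≈-sym (+-cong (*-cong S≈ S≈) (-‿cong (same-sum same (λ j → x j * x j)))))
          where S≈ = same-sum same x
        ... | inj₂ M = ≤-by
          (*-nonneg (+-nonneg s s) (x≤y⇒0≤y-x (edgeSum-pos-part H (<⇒≤ ∘ x-pos) p∈)))
          (≈-trans (+-cong (*-cong (moved-sum M x) (moved-sum M x)) (-‿cong (moved-sum M (λ j → x j * x j))))
            (solve 4 (λ S Q u p → (S :+ (u :- p)) :* (S :+ (u :- p)) :- (Q :+ (u :* u :- p :* p)) := S :* S :- Q :+
                ((u :- p) :+ (u :- p)) :* (S :- p)) ≈-refl
              (edgeSum H x (ψ→ e)) (edgeSum H (λ j → x j * x j) (ψ→ e)) (x u) (x p)))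
          where
          open Moved M
          s = x≤y⇒0≤y-x xp≤xu

        N-z : N z ≈ N x
        N-z = ≈-sym (∑-permute (λ j → x j * x j) σ)

        form-increases : μ * N z ≤ ⟨ z , L T z ⟩
        form-increases = begin
          μ * N z ≈⟨ *-congˡ N-z ⟩
          μ * N x ≈⟨ ⟨⟩-scaleʳ μ x x ⟨
          ⟨ x , (λ i → μ * x i) ⟩ ≈⟨ ⟨⟩-cong (λ _ → ≈-refl) eigen ⟨
          ⟨ x , L H x ⟩ ≈⟨ ⟨x,Lx⟩ H x ⟩
          ∑ (edgeForm H x) ≈⟨ ∑-permute (edgeForm H x) ψ ⟩
          ∑ (λ e → edgeForm H x (ψ→ e)) ≤⟨ ∑-mono-≤ form-≤ ⟩
          ∑ (edgeForm T z) ≈⟨ ⟨x,Lx⟩ T z ⟨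
          ⟨ z , L T z ⟩ ∎
          where open ≤-Reasoning

        0<Nz : 0# < N z
        0<Nz = N-pos z (σ← u) (pos⇒≉0 (x-pos _))

      shift-≤ : μ ≤ μ′
      shift-≤ = *-cancelʳ-≤ 0<Nz (≤-trans form-increases (rayleigh′ z))

      -- If μ′ = μ then z is an eigenvector of T for μ; but row u of L z exceeds μ x u.
      shift-< : ∀ e → Moved u x e → μ < μ′
      shift-< e₀ M₀ = [ id , (λ μ≈μ′ → contradiction (<-respʳ (row μ≈μ′) (<-respˡ (eigen u) row-u))
          (<-irrefl ≈-refl)) ]′ shift-≤
        where
        row : μ ≈ μ′ → L T z (σ← u) ≈ μ * x u
        row μ≈μ′ = ≈-trans (attained′ z (≤-respˡ (*-congʳ μ≈μ′) form-increases) (σ← u))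
                (*-cong (≈-sym μ≈μ′) (≈-reflexive (≡.cong x (Inverse.strictlyInverseˡ σ u))))
        zu : z (σ← u) ≈ x u
        zu = ≈-reflexive (≡.cong x (Inverse.strictlyInverseˡ σ u))
        rowT rowH : Fin (size T) → ℝ
        rowT e = 𝟙 (σ← u ∈? edge T e) * (edgeSum T z e - z (σ← u))
        rowH e = 𝟙 (u ∈? edge H (ψ→ e)) * (edgeSum H x (ψ→ e) - x u)
        moved-row : ∀ {e} → Moved u x e → rowH e < rowT e
        moved-row {e} M = begin-strict
          rowH e ≈⟨ 𝟙*-no (u ∈? _) u∉ ⟩
          0# <⟨ x<y⇒0<y-x (edgeSum-pair H x-pos (q≢p ∘ ≡.sym) p∈ q∈) ⟩
          edgeSum H x (ψ→ e) - x p ≈⟨ solve 3 (λ s p u → s :- p := s :+ (u :- p) :- u) ≈-refl _ (x p) (x u) ⟩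
          edgeSum H x (ψ→ e) + (x u - x p) - x u ≈⟨ +-cong (moved-sum M x) (-‿cong zu) ⟨
          edgeSum T z e - z (σ← u) ≈⟨ 𝟙*-yes (σ← u ∈? _) u∈′ ⟨
          rowT e ∎
          where
          open ≤-Reasoning
          open Moved M
        same-row : ∀ {e} → Same e → rowH e ≈ rowT e
        same-row same = ≈-sym (*-cong (𝟙-⇔ (σ← u ∈? _) (u ∈? _) (same u)) (+-cong (same-sum same x) (-‿cong zu)))
        row-≤ : ∀ e → rowH e ≤ rowT e
        row-≤ e = [ inj₂ ∘ same-row , <⇒≤ ∘ moved-row ]′ (change e)
        row-u : L H x u < L T z (σ← u)
        row-u = ≤-<-trans (inj₂ (∑-permute _ ψ)) (∑-mono-< row-≤ e₀ (moved-row M₀))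

    all-same⇒≅ : (∀ e → Same e) → H ≅ T
    all-same⇒≅ same = record
      { vertices = Inverse-sym σ
      ; edges = Inverse-sym ψ
      ; incidence = λ v e → mk⇔ (λ v∈ → Equivalence.from (same (ψ← e) v)
          (≡.subst (λ f → v ∈ edge H f) (≡.sym (Inverse.strictlyInverseˡ ψ e)) v∈))
                                (λ v∈ → ≡.subst (λ f → v ∈ edge H f) (Inverse.strictlyInverseˡ ψ e)
                                    (Equivalence.to (same (ψ← e) v) v∈))
      }
      where open import Function.Properties.Inverse using () renaming (↔-sym to Inverse-sym)

-- Shifts of graphs carried over to their powers.

module ShiftedPowers (R : CompleteOrderedField) where
  open Comparison R public

  module _ {m H T} {V E V′ E′ : Set} {s t : E → V} {s′ t′ : E′ → V′}
           (P : IsPower m H s t) (simple : IsSimple s t) (P′ : IsPower m T s′ t′) (simple′ : IsSimple s′ t′)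
           {u : V} (S : Shifts s t s′ t′ u) where
    open Shifts S
    private
      module P = IsPower P
      module P′ = IsPower P′
      φ→ = Inverse.to φ
      ψ→ = Inverse.to ψ
      uH : Fin (order H)
      uH = P.fromV (inj₁ u)

    -- Inner vertices travel with their edge, so replacing one end of a graph edge moves exactly one
    -- vertex of the corresponding edge of the power.
    σᵛ : Fin (order T) ↔ Fin (order H)
    σᵛ = ↔-trans P′.vert (↔-trans (φ ⊎-↔ (ψ ×-↔ ↔-refl)) (↔-sym P.vert))

    σᵉ : Fin (size T) ↔ Fin (size H)
    σᵉ = ↔-trans P′.edg (↔-trans ψ (↔-sym P.edg))

    open Shift {H} {T} σᵛ σᵉ using (Same; Moved)

    private
      Image : E′ → V ⊎ (E × Fin (m ∸ 2)) → Set
      Image h (inj₁ v) = v ≡ φ→ (s′ h) ⊎ v ≡ φ→ (t′ h)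
      Image h (inj₂ (f , _)) = f ≡ ψ→ h

      pull : ∀ {A B : Set} (i : A ↔ B) a b → Inverse.from i b ≡ a ⇔ b ≡ Inverse.to i a
      pull i a b = mk⇔ (λ eq → trans (sym (Inverse.strictlyInverseˡ i b)) (cong (Inverse.to i) eq))
                       (λ eq → trans (cong (Inverse.from i) eq) (Inverse.strictlyInverseʳ i a))

      ⊎-⇔ : ∀ {A B C D : Set} → A ⇔ B → C ⇔ D → (A ⊎ C) ⇔ (B ⊎ D)
      ⊎-⇔ f g = mk⇔ (Sum.map (Equivalence.to f) (Equivalence.to g))
          (Sum.map (Equivalence.from f) (Equivalence.from g))

      image : ∀ h w → PowerIncident s′ t′ (Inverse.from (φ ⊎-↔ (ψ ×-↔ ↔-refl)) w) h ⇔ Image h w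
      image h (inj₁ v) = ⊎-⇔ (pull φ (s′ h) v) (pull φ (t′ h) v)
      image h (inj₂ (f , _)) = pull ψ h f

      in-T : ∀ e j → Inverse.from σᵛ j ∈ edge T e ⇔ Image (P′.toE e) (P.toV j)
      in-T e j = ⇔-trans (subst (λ f → Inverse.from σᵛ j ∈ edge T f ⇔ PowerIncident s′ t′ _ (P′.toE e))
          (P′.fromE∘toE e) (P′.incidence _ (P′.toE e))) (image (P′.toE e) (P.toV j))

      in-H : ∀ e j → j ∈ edge H (Inverse.to σᵉ e) ⇔ PowerIncident s t (P.toV j) (ψ→ (P′.toE e))
      in-H e j = subst (λ f → j ∈ edge H (Inverse.to σᵉ e) ⇔ PowerIncident s t (P.toV j) f) (P.toE∘fromE _)
          (P.incidence′ j (Inverse.to σᵉ e))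

      in-H′ : ∀ e v → Incident s t v (ψ→ (P′.toE e)) → P.fromV (inj₁ v) ∈ edge H (Inverse.to σᵉ e)
      in-H′ e v p = Equivalence.from (in-H e _)
          (subst (λ w → PowerIncident s t w (ψ→ (P′.toE e))) (sym (P.toV∘fromV _)) p)

      in-H″ : ∀ e v → P.fromV (inj₁ v) ∈ edge H (Inverse.to σᵉ e) → Incident s t v (ψ→ (P′.toE e))
      in-H″ e v p = subst (λ w → PowerIncident s t w (ψ→ (P′.toE e))) (P.toV∘fromV _) (Equivalence.to (in-H e _) p)

    same : ∀ e → let h = P′.toE e in Joins s t (ψ→ h) (φ→ (s′ h)) (φ→ (t′ h)) → Same e
    same e j k = ⇔-trans (in-T e k) (⇔-trans (agree (P.toV k)) (⇔-sym (in-H e k)))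
      where
      agree : ∀ w → Image (P′.toE e) w ⇔ PowerIncident s t w (ψ→ (P′.toE e))
      agree (inj₁ v) = ⇔-sym (Ends.joins-incident s t j v)
      agree (inj₂ (f , _)) = ⇔-refl

    module _ (x : Vector ℝ (order H)) (maximal : ∀ v → x (P.fromV (inj₁ v)) ≤ x uH) where
      moved : ∀ e → let h = P′.toE e ; a = φ→ (s′ h) ; b = φ→ (t′ h) in
        (∃[ y ] ∃[ p ] p ≢ u × Joins s t (ψ→ h) y p × ((a ≡ u × b ≡ y) ⊎ (a ≡ y × b ≡ u))) → Moved uH x e
      moved e (y , p , p≢u , j , ends) = record
        { p = P.fromV (inj₁ p)
        ; p∈ = in-H′ e p (joinsʳ j)
        ; u∉ = λ u∈ → [ u≢y , p≢u ∘ sym ]′ (incident-joins u j (in-H″ e u u∈))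
        ; p∉′ = λ p∈ → [ p≢u , joins-≢ simple j ∘ sym ]′
            (Equivalence.to (image-ends p) (subst (Image h) (P.toV∘fromV _) (Equivalence.to (in-T e _) p∈)))
        ; u∈′ = Equivalence.from (in-T e _)
            (subst (Image h) (sym (P.toV∘fromV _)) (Equivalence.from (image-ends u) (inj₁ refl)))
        ; others = λ k k≢p k≢u → ⇔-trans (in-T e k)
            (⇔-trans (agree (P.toV k) (≢-from k≢p) (≢-from k≢u)) (⇔-sym (in-H e k)))
        ; q = P.fromV (inj₁ y)
        ; q≢p = λ eq → joins-≢ simple j (inj₁-injective (from-injective P.vert eq))
        ; q∈ = in-H′ e y (joinsˡ j)
        ; xp≤xu = maximal p
        }
        where
        open Ends s t
        h = P′.toE e
        -- Otherwise the new edge would join u to itself, but the target graph is loopless.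
        u≢y : u ≢ y
        u≢y u≡y = IsSimple.loopless simple′ h
            (to-injective φ ([ (λ { (a , b) → trans a (trans u≡y (sym b)) }) ,
            (λ { (a , b) → trans a (trans (sym u≡y) (sym b)) }) ]′ ends))
        ends-⇔ : ∀ {a b} v → ((a ≡ u × b ≡ y) ⊎ (a ≡ y × b ≡ u)) → (v ≡ a ⊎ v ≡ b) ⇔ (v ≡ u ⊎ v ≡ y)
        ends-⇔ v (inj₁ (refl , refl)) = ⇔-refl
        ends-⇔ v (inj₂ (refl , refl)) = mk⇔ Sum.swap Sum.swap
        image-ends : ∀ v → Image h (inj₁ v) ⇔ (v ≡ u ⊎ v ≡ y)
        image-ends v = ends-⇔ v ends
        ≢-from : ∀ {k v} → k ≢ P.fromV (inj₁ v) → P.toV k ≢ inj₁ v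
        ≢-from {k} k≢ eq = k≢ (trans (sym (P.fromV∘toV k)) (cong P.fromV eq))
        agree : ∀ w → w ≢ inj₁ p → w ≢ inj₁ u → Image h w ⇔ PowerIncident s t w (ψ→ h)
        agree (inj₁ v) v≢p v≢u = ⇔-trans (image-ends v) (⇔-trans
          (mk⇔ [ (λ { refl → contradiction refl v≢u }) , inj₁ ]′ [ inj₂ , (λ { refl → contradiction refl v≢p }) ]′)
          (⇔-sym (joins-incident j v)))
        agree (inj₂ (f , _)) _ _ = ⇔-refl

      change : ∀ e → Same e ⊎ Moved uH x e
      change e = Sum.map (same e) (moved e) (shifted (P′.toE e))

    module _ (PH : PerronVector m H) (PT : PerronVector m T)
             (maximal : ∀ v → PerronVector.x PH (P.fromV (inj₁ v)) ≤ PerronVector.x PH uH) where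
      private
        μ = PerronVector.μ PH
        μ′ = PerronVector.μ PT
        x = PerronVector.x PH

      shifted-≤ : μ ≤ μ′
      shifted-≤ = Shift.shift-≤ σᵛ σᵉ PH PT uH (change x maximal)

      shifted-< : ∀ e → Moved uH x e → μ < μ′
      shifted-< e M = Shift.shift-< σᵛ σᵉ PH PT uH (change x maximal) e M

      shifted-<-or-≅ : H ≅ T ⊎ μ < μ′
      shifted-<-or-≅ with any? (λ e → excluded-middle (Moved uH x e))
      ... | yes (e , M) = inj₂ (shifted-< e M)
      ... | no none = inj₁ (Shift.all-same⇒≅ σᵛ σᵉ λ e → [ id , (λ M → contradiction (e , M) none) ]′
          (change x maximal e))

-- Bounds for UC_l(c₁)

module Rows (R : CompleteOrderedField) where
  open ShiftedPowers R public

  ∑-Fin1 : (f : Vector ℝ 1) → ∑ f ≈ f zero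
  ∑-Fin1 f = ≈-trans (∑-suc f) (≈-trans (+-congˡ (∑-zero _)) (+-identityʳ _))

  ∑-Fin2+ : ∀ {q} (f : Vector ℝ (suc (suc q))) → ∑ f ≈ f zero + (f (suc zero) + ∑ (λ a → f (suc (suc a))))
  ∑-Fin2+ f = ≈-trans (∑-suc f) (+-congˡ (∑-suc _))

  module _ {m H} {V E : Set} {s t : E → V} (P : IsPower m H s t) (simple : IsSimple s t)
           (vw : V → ℝ) (ew : E → ℝ) where
    open IsPower P

    private
      r = m ∸ 2

    -- Test vectors are taken constant on the inner vertices of each edge, so an edge sum has only
    -- three terms.
    powerWeight : V ⊎ (E × Fin r) → ℝ
    powerWeight (inj₁ v) = vw v
    powerWeight (inj₂ (f , _)) = ew f

    weighting : Vector ℝ (order H)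
    weighting j = powerWeight (toV j)

    weightSum : E → ℝ
    weightSum f = vw (s f) + (vw (t f) + ι r * ew f)

    private
      members : E → Fin (suc (suc r)) → V ⊎ (E × Fin r)
      members f zero = inj₁ (s f)
      members f (suc zero) = inj₁ (t f)
      members f (suc (suc a)) = inj₂ (f , a)

      members-injective : ∀ f → Injective _≡_ _≡_ (members f)
      members-injective f {zero} {zero} _ = refl
      members-injective f {zero} {suc zero} eq = contradiction (inj₁-injective eq) (IsSimple.loopless simple f)
      members-injective f {suc zero} {zero} eq = contradiction (sym (inj₁-injective eq)) (IsSimple.loopless simple f)
      members-injective f {suc zero} {suc zero} _ = refl
      members-injective f {suc (suc a)} {suc (suc .a)} refl = refl

      members-sound : ∀ f a → PowerIncident s t (members f a) f
      members-sound f zero = inj₁ refl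
      members-sound f (suc zero) = inj₂ refl
      members-sound f (suc (suc a)) = refl

      members-complete : ∀ f w → PowerIncident s t w f → ∃[ a ] members f a ≡ w
      members-complete f (inj₁ v) (inj₁ refl) = zero , refl
      members-complete f (inj₁ v) (inj₂ refl) = suc zero , refl
      members-complete f (inj₂ (.f , a)) refl = suc (suc a) , refl

    edgeSum-weighting : ∀ f → edgeSum H weighting (fromE f) ≈ weightSum f
    edgeSum-weighting f = ≈-trans
      (∑-image (λ j → j ∈? edge H (fromE f)) (fromV ∘ members f) (λ eq → members-injective f (from-injective vert eq))
        (λ a → Equivalence.from (incidence _ f) (members-sound f a))
        (λ j j∈ → let a , eq = members-complete f (toV j) (subst (PowerIncident s t (toV j)) (toE∘fromE f) (Equivalence.to (incidence′ j (fromE f)) j∈))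
                   in a , trans (cong fromV eq) (fromV∘toV j)) weighting)
      (≈-trans (∑-cong λ a → ≈-reflexive (cong powerWeight (toV∘fromV (members f a))))
      (≈-trans (∑-Fin2+ _) (+-congˡ (+-congˡ (∑-const r (ew f))))))

    L-weighting : ∀ w {q} (g : Fin q → E) → Injective _≡_ _≡_ g → (∀ a → PowerIncident s t w (g a)) →
      (∀ f → PowerIncident s t w f → ∃[ a ] g a ≡ f) →
      ∀ j → toV j ≡ w → L H weighting j ≈ ∑ (λ a → weightSum (g a) - powerWeight w)
    L-weighting w g g-inj sound complete j refl = ≈-trans
      (∑-image (λ e → j ∈? edge H e) (fromE ∘ g) (λ eq → g-inj (from-injective edg eq))
        (λ a → Equivalence.from (incidence′ j _)
            (subst (PowerIncident s t (toV j)) (sym (toE∘fromE (g a))) (sound a)))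
        (λ e j∈e → let a , eq = complete (toE e) (Equivalence.to (incidence′ j e) j∈e) in a , trans (cong fromE eq) (fromE∘toE e))
        (λ e → edgeSum H weighting e - weighting j))
      (∑-cong λ a → +-congʳ (edgeSum-weighting (g a)))

  module UCRows {m n} (m≥2 : 2 ℕ.≤ m) (l≥3 : 3 ℕ.≤ suc n) (c : ℕ) (core inner : Fin (suc n) → ℝ) (leaf : ℝ) where
    H : Hypergraph
    H = UC₁ m≥2 l≥3 c

    private
      r = m ∸ 2
      s t : Fin (suc n) ⊎ Fin c → Fin (suc n) ⊎ Fin c
      s = end₁ᵁ {n} {c}
      t = end₂ᵁ {n} {c}

    isPower : IsPower m H s t
    isPower = UC₁-isPower l≥3 m≥2 c

    open IsPower isPower using (toV; fromV; toV∘fromV)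

    vw ew : Fin (suc n) ⊎ Fin c → ℝ
    vw = [ core , (λ _ → leaf) ]′
    ew = [ inner , (λ _ → leaf) ]′

    z : Vector ℝ (order H)
    z = weighting isPower (UC-simple l≥3) vw ew

    pw : (Fin (suc n) ⊎ Fin c) ⊎ ((Fin (suc n) ⊎ Fin c) × Fin r) → ℝ
    pw = powerWeight isPower (UC-simple l≥3) vw ew

    -- The kinds of vertices are the hub, the other core vertices, the leaves, and the inner
    -- vertices of cycle edges and of pendant edges. A leaf and the inner vertices of its edge carry
    -- the same weight, hence have the same row.
    Row : (Fin (suc n) ⊎ Fin c) ⊎ ((Fin (suc n) ⊎ Fin c) × Fin r) → ℝ
    Row (inj₁ (inj₁ zero)) = (core (next zero) + ι r * inner zero) +
        ((core (prev zero) + ι r * inner (prev zero)) + ι c * (leaf + ι r * leaf))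
    Row (inj₁ (inj₁ (suc i))) = (core (next (suc i)) + ι r * inner (suc i)) +
        (core (inject₁ i) + ι r * inner (inject₁ i))
    Row (inj₁ (inj₂ a)) = core zero + ι r * leaf
    Row (inj₂ (inj₁ i , _)) = core i + core (next i) + ι r * inner i - inner i
    Row (inj₂ (inj₂ a , _)) = core zero + ι r * leaf

    private
      S : Fin (suc n) ⊎ Fin c → ℝ
      S = weightSum isPower (UC-simple l≥3) vw ew

      row : ∀ w {q} (g : Fin q → Fin (suc n) ⊎ Fin c) → Injective _≡_ _≡_ g → (∀ a → PowerIncident s t w (g a)) →
        (∀ f → PowerIncident s t w f → ∃[ a ] g a ≡ f) → ∀ j → toV j ≡ w → L H z j ≈ ∑ (λ a → S (g a) - pw w)
      row = L-weighting isPower (UC-simple l≥3) vw ew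

      single : ∀ {A : Set} (x : A) → Injective {A = Fin 1} _≡_ _≡_ (λ _ → x)
      single x {zero} {zero} _ = refl

      coreEdges : ∀ i → Fin 2 → Fin (suc n) ⊎ Fin c
      coreEdges i zero = inj₁ (suc i)
      coreEdges i (suc zero) = inj₁ (inject₁ i)

      suc≢inject₁ : ∀ {k} (i : Fin k) → suc i ≢ inject₁ i
      suc≢inject₁ (suc i) eq = suc≢inject₁ i (Fin.suc-injective eq)

      hubEdges : Fin (suc (suc c)) → Fin (suc n) ⊎ Fin c
      hubEdges zero = inj₁ zero
      hubEdges (suc zero) = inj₁ (prev zero)
      hubEdges (suc (suc a)) = inj₂ a

      prev0≢0 : prev (zero {n}) ≢ zero
      prev0≢0 eq = next≢ l≥3 zero (trans (cong next (sym eq)) (next-prev zero))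

      hubEdges-injective : Injective _≡_ _≡_ hubEdges
      hubEdges-injective {zero} {zero} _ = refl
      hubEdges-injective {zero} {suc zero} eq = contradiction (sym (inj₁-injective eq)) prev0≢0
      hubEdges-injective {suc zero} {zero} eq = contradiction (inj₁-injective eq) prev0≢0
      hubEdges-injective {suc zero} {suc zero} _ = refl
      hubEdges-injective {suc (suc a)} {suc (suc .a)} refl = refl

      coreEdges-injective : ∀ i → Injective _≡_ _≡_ (coreEdges i)
      coreEdges-injective i {zero} {zero} _ = refl
      coreEdges-injective i {zero} {suc zero} eq = contradiction (inj₁-injective eq) (suc≢inject₁ i)
      coreEdges-injective i {suc zero} {zero} eq = contradiction (sym (inj₁-injective eq)) (suc≢inject₁ i)
      coreEdges-injective i {suc zero} {suc zero} _ = refl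

    L-row : ∀ j → L H z j ≈ Row (toV j)
    L-row j = at (toV j) refl
      where
      at : ∀ w → toV j ≡ w → L H z j ≈ Row w
      at (inj₁ (inj₁ zero)) eq = ≈-trans
        (row _ hubEdges hubEdges-injective
          (λ { zero → inj₁ refl ; (suc zero) → inj₂ (cong inj₁ (sym (next-prev zero))) ; (suc (suc a)) → inj₁ refl })
          (λ { (inj₁ i) (inj₁ refl) → zero , refl
             ; (inj₁ i) (inj₂ p) → suc zero , cong inj₁ (trans (cong prev (inj₁-injective p)) (prev-next i))
             ; (inj₂ a) (inj₁ _) → suc (suc a) , refl
             ; (inj₂ a) (inj₂ ()) }) j eq)
        (≈-trans (∑-Fin2+ _) (+-cong
          (solve 4 (λ x y r i → x :+ (y :+ r :* i) :- x := y :+ r :* i) ≈-refl (core zero) (core (next zero)) (ι r)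
              (inner zero))
          (+-cong
            (≈-trans (+-congʳ (+-congˡ (+-congʳ (≈-reflexive (cong core (next-prev zero))))))
              (solve 4 (λ x y r i → y :+ (x :+ r :* i) :- x := y :+ r :* i) ≈-refl (core zero) (core (prev zero))
                  (ι r) (inner (prev zero))))
            (≈-trans (∑-const c _) (*-congˡ
                (solve 3 (λ x r y → x :+ (y :+ r :* y) :- x := y :+ r :* y) ≈-refl (core zero) (ι r) leaf))))))
      at (inj₁ (inj₁ (suc i))) eq = ≈-trans
        (row _ (coreEdges i) (coreEdges-injective i)
          (λ { zero → inj₁ refl ; (suc zero) → inj₂ (cong inj₁ (sym (next-inject₁ i))) })
          (λ { (inj₁ j) (inj₁ refl) → zero , refl
             ; (inj₁ j) (inj₂ p) → suc zero , cong inj₁ (trans (cong prev (inj₁-injective p)) (prev-next j))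
             ; (inj₂ a) (inj₁ ()) ; (inj₂ a) (inj₂ ()) }) j eq)
        (≈-trans (∑-Fin2+ _) (≈-trans (+-congˡ (≈-trans (+-congˡ (∑-zero _)) (+-identityʳ _))) (+-cong
          (solve 4 (λ x y r i → x :+ (y :+ r :* i) :- x := y :+ r :* i) ≈-refl (core (suc i)) (core (next (suc i)))
              (ι r) (inner (suc i)))
          (≈-trans (+-congʳ (+-congˡ (+-congʳ (≈-reflexive (cong core (next-inject₁ i))))))
            (solve 4 (λ x y r i → y :+ (x :+ r :* i) :- x := y :+ r :* i) ≈-refl (core (suc i)) (core (inject₁ i))
                (ι r) (inner (inject₁ i)))))))
      at (inj₁ (inj₂ a)) eq = ≈-trans
        (row _ (λ _ → inj₂ a) (single _) (λ _ → inj₂ refl)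
          (λ { (inj₁ i) (inj₁ ()) ; (inj₁ i) (inj₂ ()) ; (inj₂ b) (inj₁ ()) ; (inj₂ b) (inj₂ refl) → zero ,
              refl }) j eq)
        (≈-trans (∑-Fin1 _) (solve 3 (λ x r y → x :+ (y :+ r :* y) :- y := x :+ r :* y) ≈-refl (core zero)
            (ι r) leaf))
      at (inj₂ (inj₁ i , a)) eq = ≈-trans
        (row _ (λ _ → inj₁ i) (single _) (λ _ → refl) (λ { f refl → zero , refl }) j eq)
        (≈-trans (∑-Fin1 _) (solve 4 (λ x y r i → x :+ (y :+ r :* i) :- i := x :+ y :+ r :* i :- i) ≈-refl (core i)
            (core (next i)) (ι r) (inner i)))
      at (inj₂ (inj₂ b , a)) eq = ≈-trans
        (row _ (λ _ → inj₂ b) (single _) (λ _ → refl) (λ { f refl → zero , refl }) j eq)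
        (≈-trans (∑-Fin1 _) (solve 3 (λ x r y → x :+ (y :+ r :* y) :- y := x :+ r :* y) ≈-refl (core zero)
            (ι r) leaf))

module Bounds (R : CompleteOrderedField) where
  open Rows R public

  private
    two = 1# + 1#

  module _ {r n : ℕ} (m≥2 : 2 ℕ.≤ suc (suc r)) (l≥3 : 3 ℕ.≤ suc n) (c : ℕ)
      (PT : PerronVector (suc (suc r)) (UC₁ m≥2 l≥3 c)) where
    private
      μ = PerronVector.μ PT
      next0≢0 : next (zero {n}) ≢ zero
      next0≢0 = next≢ l≥3 zero
      prev0≢0 : prev (zero {n}) ≢ zero
      prev0≢0 eq = next≢ l≥3 zero (trans (cong next (sym eq)) (next-prev zero))

    -- The weights are a Perron vector of the star formed by the edges at the hub.
    module Lower (ρ : ℝ) (r<ρ : ι r < ρ) (quadratic : ρ * ρ ≈ ι r * ρ + (ι c + two) * (1# + ι r)) where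
      private
        -- With weight 1 on the other vertices of the star, the row of a leaf reads ρ = X + r and
        -- fixes the weight of the hub; the row of the hub, ρ X = (c + 2)(1 + r), is then the
        -- quadratic equation.
        X : ℝ
        X = ρ - ι r

        Neighbour : Fin (suc n) → Set
        Neighbour i = i ≡ next zero ⊎ next i ≡ zero

        AtHub : Fin (suc n) → Set
        AtHub i = i ≡ zero ⊎ next i ≡ zero

        neighbour? : ∀ i → Dec (Neighbour i)
        neighbour? i = (i ≟ next zero) ⊎-dec (next i ≟ zero)

        atHub? : ∀ i → Dec (AtHub i)
        atHub? i = (i ≟ zero) ⊎-dec (next i ≟ zero)

        core inner : Fin (suc n) → ℝ
        core zero = X
        core (suc i) = 𝟙 (neighbour? (suc i))
        inner i = 𝟙 (atHub? i)

        open UCRows m≥2 l≥3 c core inner 1#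
        open IsPower isPower using (toV; fromV; toV∘fromV)

        core-1 : ∀ i → i ≢ zero → Neighbour i → core i ≈ 1#
        core-1 zero i≢0 _ = contradiction refl i≢0
        core-1 (suc i) _ p = 𝟙-yes (neighbour? (suc i)) p

        core-0 : ∀ {i} → i ≡ zero → core i ≈ X
        core-0 refl = ≈-refl

        inner-1 : ∀ i → AtHub i → inner i ≈ 1#
        inner-1 i = 𝟙-yes (atHub? i)

        0<X : 0# < X
        0<X = x<y⇒0<y-x r<ρ

        core-nonneg : ∀ i → 0# ≤ core i
        core-nonneg zero = <⇒≤ 0<X
        core-nonneg (suc i) = 𝟙-nonneg (neighbour? (suc i))

        half-nonneg : ∀ i j → 0# ≤ core i + ι r * inner j
        half-nonneg i j = +-nonneg (core-nonneg i) (*-nonneg (ι-nonneg r) (𝟙-nonneg (atHub? j)))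

        z-nonneg : ∀ j → 0# ≤ z j
        z-nonneg j = at (toV j)
          where
          at : ∀ w → 0# ≤ pw w
          at (inj₁ (inj₁ i)) = core-nonneg i
          at (inj₁ (inj₂ _)) = <⇒≤ 0<1
          at (inj₂ (inj₁ i , _)) = 𝟙-nonneg (atHub? i)
          at (inj₂ (inj₂ _ , _)) = <⇒≤ 0<1

        hub : ρ * X ≈ Row (inj₁ (inj₁ zero))
        hub = begin
          ρ * X ≈⟨ solve 2 (λ p r → p :* (p :- r) := p :* p :- r :* p) ≈-refl ρ (ι r) ⟩
          ρ * ρ - ι r * ρ ≈⟨ +-congʳ quadratic ⟩
          ι r * ρ + (ι c + two) * (1# + ι r) - ι r * ρ ≈⟨ solve 3
              (λ p r c → r :* p :+ (c :+ :2) :* (:1 :+ r) :- r :* p := (:1 :+ r :* :1) :+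
              ((:1 :+ r :* :1) :+ c :* (:1 :+ r :* :1))) ≈-refl ρ (ι r) (ι c) ⟩
          (1# + ι r * 1#) + ((1# + ι r * 1#) + ι c * (1# + ι r * 1#))
            ≈⟨ +-cong (+-cong (core-1 (next zero) next0≢0 (inj₁ refl)) (*-congˡ (inner-1 zero (inj₁ refl))))
                 (+-congʳ (+-cong (core-1 (prev zero) prev0≢0 (inj₂ (next-prev zero)))
                     (*-congˡ (inner-1 (prev zero) (inj₂ (next-prev zero)))))) ⟨
          Row (inj₁ (inj₁ zero)) ∎
          where open ≈-Reasoning

        hub-side : ∀ {a i} → core a ≈ X → inner i ≈ 1# → ρ * 1# ≈ core a + ι r * inner i
        hub-side {a} {i} a≈X i≈1 = ≈-trans (solve 2 (λ p r → p :* :1 := p :- r :+ r :* :1) ≈-refl ρ (ι r))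
            (≈-sym (+-cong a≈X (*-congˡ i≈1)))

        inject₁≡0 : ∀ {i : Fin n} → suc i ≡ next zero → inject₁ i ≡ zero
        inject₁≡0 {i} eq = next-injective (trans (next-inject₁ i) eq)

        core-row : ∀ i → ρ * core (suc i) ≤ Row (inj₁ (inj₁ (suc i)))
        core-row i = row (neighbour? (suc i))
          where
          row : Dec (Neighbour (suc i)) → ρ * core (suc i) ≤ Row (inj₁ (inj₁ (suc i)))
          row (no ¬p) = ≤-respˡ (≈-sym (≈-trans (*-congˡ (𝟙-no (neighbour? (suc i)) ¬p)) (zeroʳ ρ)))
              (+-nonneg (half-nonneg (next (suc i)) (suc i)) (half-nonneg (inject₁ i) (inject₁ i)))
          row (yes p@(inj₁ eq)) = ≤-by (half-nonneg (next (suc i)) (suc i)) (≈-trans (+-comm _ _)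
            (+-congʳ (≈-sym (≈-trans (*-congˡ (𝟙-yes (neighbour? (suc i)) p))
                (hub-side {inject₁ i} {inject₁ i} (core-0 (inject₁≡0 {i} eq))
                (inner-1 (inject₁ i) (inj₁ (inject₁≡0 {i} eq))))))))
          row (yes p@(inj₂ eq)) = ≤-by (half-nonneg (inject₁ i) (inject₁ i))
            (+-congʳ (≈-sym (≈-trans (*-congˡ (𝟙-yes (neighbour? (suc i)) p))
                (hub-side {next (suc i)} {suc i} (core-0 eq) (inner-1 (suc i) (inj₂ eq))))))

        inner-row : ∀ i → ρ * inner i ≤ core i + core (next i) + ι r * inner i - inner i
        inner-row i = row (atHub? i)
          where
          others : ∀ {y} → inner i ≈ y → core i + core (next i) + ι r * y - y ≈ core i + core
              (next i) + ι r * inner i - inner i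
          others eq = ≈-sym (+-cong (+-congˡ (*-congˡ eq)) (-‿cong eq))
          at-hub : ∀ {a b} → core i ≈ a → core (next i) ≈ b → inner i ≈ 1# → ρ * 1# ≈ a + b + ι r * 1# - 1# →
              ρ * inner i ≤ core i + core (next i) + ι r * inner i - inner i
          at-hub a b i≈1 eq = inj₂ (≈-trans (*-congˡ i≈1)
              (≈-trans eq (≈-trans (+-congʳ (+-congʳ (+-cong (≈-sym a) (≈-sym b)))) (others i≈1))))
          row : Dec (AtHub i) → ρ * inner i ≤ core i + core (next i) + ι r * inner i - inner i
          row (no ¬p) = ≤-respˡ (≈-sym (≈-trans (*-congˡ (𝟙-no (atHub? i) ¬p)) (zeroʳ ρ)))
              (≤-respʳ (≈-trans (solve 3 (λ a b r → a :+ b := a :+ b :+ r :* :0 :- :0) ≈-refl (core i) (core (next i))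
              (ι r)) (others (𝟙-no (atHub? i) ¬p))) (+-nonneg (core-nonneg i) (core-nonneg (next i))))
          row (yes p@(inj₁ i≡0)) = at-hub (core-0 i≡0)
              (core-1 (next i) (λ eq → next0≢0 (trans (cong next (sym i≡0)) eq)) (inj₁ (cong next i≡0))) (inner-1 i p)
            (solve 2 (λ p r → p :* :1 := p :- r :+ :1 :+ r :* :1 :- :1) ≈-refl ρ (ι r))
          row (yes p@(inj₂ eq)) = at-hub (core-1 i (λ i≡0 → next0≢0 (trans (cong next (sym i≡0)) eq)) (inj₂ eq))
              (core-0 eq) (inner-1 i p)
            (solve 2 (λ p r → p :* :1 := :1 :+ (p :- r) :+ r :* :1 :- :1) ≈-refl ρ (ι r))

        leaf-row : ρ * 1# ≈ core zero + ι r * 1#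
        leaf-row = solve 2 (λ p r → p :* :1 := p :- r :+ r :* :1) ≈-refl ρ (ι r)

        rows : ∀ w → ρ * pw w ≤ Row w
        rows (inj₁ (inj₁ zero)) = inj₂ hub
        rows (inj₁ (inj₁ (suc i))) = core-row i
        rows (inj₁ (inj₂ _)) = inj₂ leaf-row
        rows (inj₂ (inj₁ i , _)) = inner-row i
        rows (inj₂ (inj₂ _ , _)) = inj₂ leaf-row

        second-vertex : ∃[ b ] inject₁ b ≡ next (zero {n})
        second-vertex = go l≥3
          where
          go : ∀ {n} → 3 ℕ.≤ suc n → Σ (Fin n) λ b → inject₁ b ≡ next (zero {n})
          go (s≤s (s≤s (s≤s {n = k} z≤n))) = suc zero , sym (next-inject₁ {suc (suc k)} zero)

        -- Vertex 2 of the cycle receives the positive weight of vertex 1 through the edge {1 , 2},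
        -- which does not belong to the star. For l = 3 vertex 2 is itself a neighbour of the hub,
        -- otherwise its weight is zero; both cases gain strictly.
        strict-row : ∀ b → inject₁ b ≡ next zero → ρ * core (suc b) < Row (inj₁ (inj₁ (suc b)))
        strict-row b eq = row (neighbour? (suc b))
          where
          inject₁≢0 : inject₁ b ≢ zero
          inject₁≢0 p = next0≢0 (trans (sym eq) p)
          half-pos : 0# < core (inject₁ b) + ι r * inner (inject₁ b)
          half-pos = +-pos-nonneg (<-respʳ (≈-sym (core-1 (inject₁ b) inject₁≢0 (inj₁ eq))) 0<1)
              (*-nonneg (ι-nonneg r) (𝟙-nonneg (atHub? (inject₁ b))))
          row : Dec (Neighbour (suc b)) → ρ * core (suc b) < Row (inj₁ (inj₁ (suc b)))
          row (yes (inj₁ eq′)) = contradiction (trans (sym eq) (inject₁≡0 {b} eq′)) next0≢0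
          row (yes p@(inj₂ eq′)) = <-by half-pos
              (+-congʳ (≈-sym (≈-trans (*-congˡ (𝟙-yes (neighbour? (suc b)) p))
              (hub-side {next (suc b)} {suc b} (core-0 eq′) (inner-1 (suc b) (inj₂ eq′))))))
          row (no ¬p) = <-respˡ (≈-sym (≈-trans (*-congˡ (𝟙-no (neighbour? (suc b)) ¬p)) (zeroʳ ρ)))
              (+-nonneg-pos (half-nonneg (next (suc b)) (suc b)) half-pos)

      lower : ρ < μ
      lower = strict-subsolution PT {ρ} {z} z-nonneg (λ j → ≤-respʳ (≈-sym (L-row j)) (rows (toV j))) j₂
          (<-respʳ (≈-sym (L-row j₂))
          (subst (λ w → ρ * pw w < Row w) (sym (toV∘fromV (inj₁ (inj₁ (suc b₂)))))
              (strict-row b₂ (proj₂ second-vertex))))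
        where
        b₂ = proj₁ second-vertex
        j₂ = fromV (inj₁ (inj₁ (suc b₂)))

    module Upper (ρ : ℝ) (m<ρ : ι (suc (suc r)) < ρ)
        (quadratic : ρ * ρ ≈ ι (suc (suc r)) * ρ + (ι c + two) * (1# + ι r)) where
      private
        M = ι (suc (suc r))
        e = ρ - M

        0<e : 0# < e
        0<e = x<y⇒0<y-x m<ρ

        0≤M : 0# ≤ M
        0≤M = ι-nonneg (suc (suc r))

        -- Inner vertices of a cycle edge at the hub satisfy their row with equality, (e + 1) + 2 +
        -- r - 1 = ρ, which fixes the weight of the hub once the other core vertices get 2 and the
        -- rest 1.
        core inner : Fin (suc n) → ℝ
        core zero = e + 1#
        core (suc i) = two
        inner i = 1#

        open UCRows m≥2 l≥3 c core inner 1#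
        open IsPower isPower using (toV; fromV; toV∘fromV)

        core-2 : ∀ i → i ≢ zero → core i ≈ two
        core-2 zero i≢0 = contradiction refl i≢0
        core-2 (suc i) _ = ≈-refl

        z-nonneg : ∀ j → 0# ≤ z j
        z-nonneg j = at (toV j)
          where
          at : ∀ w → 0# ≤ pw w
          at (inj₁ (inj₁ zero)) = +-nonneg (<⇒≤ 0<e) (<⇒≤ 0<1)
          at (inj₁ (inj₁ (suc i))) = <⇒≤ 0<2
          at (inj₁ (inj₂ _)) = <⇒≤ 0<1
          at (inj₂ (inj₁ i , _)) = <⇒≤ 0<1
          at (inj₂ (inj₂ _ , _)) = <⇒≤ 0<1

        -- The difference of the two sides is ρ - 2 = e + r.
        hub : Row (inj₁ (inj₁ zero)) < ρ * (e + 1#)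
        hub = <-by (+-pos-nonneg 0<e (ι-nonneg r)) (begin
          ρ * (e + 1#) ≈⟨ solve 2 (λ p m → p :* (p :- m :+ :1) := p :* p :- m :* p :+ p) ≈-refl ρ M ⟩
          ρ * ρ - M * ρ + ρ ≈⟨ +-congʳ (+-congʳ quadratic) ⟩
          M * ρ + (ι c + two) * (1# + ι r) - M * ρ + ρ
            ≈⟨ solve 3 (λ p r c → (:1 :+ (:1 :+ r)) :* p :+ (c :+ :2) :* (:1 :+ r) :- (:1 :+ (:1 :+ r)) :* p :+ p :=
                (:2 :+ r :* :1) :+ ((:2 :+ r :* :1) :+ c :* (:1 :+ r :* :1)) :+
                ((p :- (:1 :+ (:1 :+ r))) :+ r)) ≈-refl ρ (ι r) (ι c) ⟩
          (two + ι r * 1#) + ((two + ι r * 1#) + ι c * (1# + ι r * 1#)) + (e + ι r)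
            ≈⟨ +-congʳ (+-cong (+-congʳ (core-2 (next zero) next0≢0))
                (+-congʳ (+-congʳ (core-2 (prev zero) prev0≢0)))) ⟨
          Row (inj₁ (inj₁ zero)) + (e + ι r) ∎)
          where open ≈-Reasoning

        half : ∀ i → core i + ι r * 1# ≤ ρ
        half zero = ≤-by (<⇒≤ 0<1) (solve 2 (λ p r → p := (p :- (:1 :+ (:1 :+ r)) :+ :1) :+ r :* :1 :+ :1) ≈-refl ρ
            (ι r))
        half (suc i) = ≤-by (<⇒≤ 0<e) (solve 2 (λ p r → p := :2 :+ r :* :1 :+ (p :- (:1 :+ (:1 :+ r)))) ≈-refl ρ
            (ι r))

        core-row : ∀ i → Row (inj₁ (inj₁ (suc i))) ≤ ρ * two
        core-row i = ≤-respʳ (solve 1 (λ p → p :+ p := p :* :2) ≈-refl ρ)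
            (+-mono-≤ (half (next (suc i))) (half (inject₁ i)))

        leaf-row : core zero + ι r * 1# ≤ ρ * 1#
        leaf-row = ≤-respʳ (≈-sym (*-identityʳ ρ)) (half zero)

        -- e ≥ 1 as soon as r ≥ 1, since otherwise ρ e < r + 3 ≤ 2 (1 + r).
        1≤e : Fin r → 1# ≤ e
        1≤e a = ≮⇒≥ λ e<1 → <-irrefl ≈-refl (begin-strict
          ρ * e <⟨ *-monoˡ-< (≤-<-trans 0≤M m<ρ) e<1 ⟩
          ρ * 1# ≈⟨ solve 2 (λ p r → p :* :1 := (:1 :+ (:1 :+ r)) :+ (p :- (:1 :+ (:1 :+ r)))) ≈-refl ρ (ι r) ⟩
          M + e ≤⟨ +-monoʳ-≤ M (≤-trans (<⇒≤ e<1) (1≤ι a)) ⟩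
          M + ι r ≤⟨ ≤-by (*-nonneg (ι-nonneg c) (+-nonneg (<⇒≤ 0<1) (ι-nonneg r)))
              (solve 2 (λ r c → (c :+ :2) :* (:1 :+ r) := (:1 :+ (:1 :+ r)) :+ r :+ c :* (:1 :+ r)) ≈-refl (ι r)
              (ι c)) ⟩
          (ι c + two) * (1# + ι r) ≈⟨ solve 2 (λ q b → b := q :+ b :- q) ≈-refl (M * ρ) _ ⟩
          M * ρ + (ι c + two) * (1# + ι r) - M * ρ ≈⟨ +-congʳ quadratic ⟨
          ρ * ρ - M * ρ ≈⟨ solve 2 (λ p m → p :* p :- m :* p := p :* (p :- m)) ≈-refl ρ M ⟩
          ρ * e ∎)
          where
          open ≤-Reasoning
          1≤ι : ∀ {r} → Fin r → 1# ≤ ι r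
          1≤ι {suc r} _ = ≤-by (ι-nonneg r) ≈-refl

        inner-row : ∀ i → Fin r → core i + core (next i) + ι r * 1# - 1# ≤ ρ * 1#
        inner-row i a with i ≟ zero | next i ≟ zero
        ... | yes refl | _ = inj₂ (≈-trans (+-congʳ (+-congʳ (+-congˡ (core-2 (next zero) next0≢0))))
            (solve 2 (λ p r → (p :- (:1 :+ (:1 :+ r)) :+ :1) :+ :2 :+ r :* :1 :- :1 := p :* :1) ≈-refl ρ (ι r)))
        ... | no i≢0 | yes eq = inj₂ (≈-trans (+-congʳ (+-congʳ (+-cong (core-2 i i≢0) (≈-reflexive (cong core eq)))))
            (solve 2 (λ p r → :2 :+ (p :- (:1 :+ (:1 :+ r)) :+ :1) :+ r :* :1 :- :1 := p :* :1) ≈-refl ρ (ι r)))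
        ... | no i≢0 | no ≢0 = ≤-respˡ (≈-sym (+-congʳ (+-congʳ (+-cong (core-2 i i≢0) (core-2 (next i) ≢0)))))
            (≤-by (x≤y⇒0≤y-x (1≤e a))
            (solve 2 (λ p r → p :* :1 := :2 :+ :2 :+ r :* :1 :- :1 :+ (p :- (:1 :+ (:1 :+ r)) :- :1)) ≈-refl ρ (ι r)))

        rows : ∀ w → Row w ≤ ρ * pw w
        rows (inj₁ (inj₁ zero)) = <⇒≤ hub
        rows (inj₁ (inj₁ (suc i))) = core-row i
        rows (inj₁ (inj₂ _)) = leaf-row
        rows (inj₂ (inj₁ i , a)) = inner-row i a
        rows (inj₂ (inj₂ _ , _)) = leaf-row

      upper : μ < ρ
      upper = strict-supersolution PT {ρ} {z} z-nonneg (λ j → ≤-respˡ (≈-sym (L-row j)) (rows (toV j))) j₀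
          (<-respˡ (≈-sym (L-row j₀)) (subst (λ w → Row w < ρ * pw w) (sym (toV∘fromV (inj₁ (inj₁ zero)))) hub))
        where
        j₀ = fromV (inj₁ (inj₁ zero))

  module _ {r n : ℕ} (m≥2 : 2 ℕ.≤ suc (suc r)) (l≥3 : 3 ℕ.≤ suc n) (PT : PerronVector (suc (suc r)) (UC₁ m≥2 l≥3 0))
           (ρ : ℝ) (m-1<ρ : 1# + ι r < ρ) (quadratic : ρ * ρ ≈ (1# + ι r) * ρ + two * (1# + ι r)) where
    private
      -- The weights are invariant under rotation, with 2 on the inner vertices. Their row 2X + 2r -
      -- 2 = 2ρ determines X, and the core row ρ X = 2 (X + 2r) is then equivalent to the quadratic
      -- equation.
      X = ρ - ι r + 1#

      open UCRows m≥2 l≥3 0 (λ _ → X) (λ _ → two) 0#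
      open IsPower isPower using (toV; fromV; toV∘fromV)

      0<X : 0# < X
      0<X = <-respʳ (solve 2 (λ p r → p :- (:1 :+ r) :+ :2 := p :- r :+ :1) ≈-refl ρ (ι r))
          (+-pos-nonneg (x<y⇒0<y-x m-1<ρ) (<⇒≤ 0<2))

      nonneg : ∀ w → 0# ≤ pw w
      nonneg (inj₁ (inj₁ i)) = <⇒≤ 0<X
      nonneg (inj₂ (inj₁ i , _)) = <⇒≤ 0<2

      core-row : ρ * X ≈ (X + ι r * two) + (X + ι r * two)
      core-row = begin
        ρ * X ≈⟨ solve 2 (λ p r → p :* (p :- r :+ :1) := p :* p :- r :* p :+ p) ≈-refl ρ (ι r) ⟩
        ρ * ρ - ι r * ρ + ρ ≈⟨ +-congʳ (+-congʳ quadratic) ⟩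
        (1# + ι r) * ρ + two * (1# + ι r) - ι r * ρ + ρ ≈⟨ solve 2
            (λ p r → (:1 :+ r) :* p :+ :2 :* (:1 :+ r) :- r :* p :+ p := ((p :- r :+ :1) :+ r :* :2) :+
            ((p :- r :+ :1) :+ r :* :2)) ≈-refl ρ (ι r) ⟩
        (X + ι r * two) + (X + ι r * two) ∎
        where open ≈-Reasoning

      rows : ∀ w → ρ * pw w ≈ Row w
      rows (inj₁ (inj₁ zero)) = ≈-trans core-row
          (solve 2 (λ a y → a :+ a := a :+ (a :+ :0 :* y)) ≈-refl (X + ι r * two) _)
      rows (inj₁ (inj₁ (suc i))) = core-row
      rows (inj₂ (inj₁ i , a)) = solve 2
          (λ p r → p :* :2 := (p :- r :+ :1) :+ (p :- r :+ :1) :+ r :* :2 :- :2) ≈-refl ρ (ι r)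

    cycle-lower : ρ ≤ PerronVector.μ PT
    cycle-lower = subsolution PT {ρ} {z} (λ j → nonneg (toV j))
        (λ j → inj₂ (≈-trans (rows (toV j)) (≈-sym (L-row j)))) j₀
        (subst (λ w → 0# < pw w) (sym (toV∘fromV (inj₁ (inj₁ zero)))) 0<X)
      where
      j₀ = fromV (inj₁ (inj₁ zero))

  -- The larger root of ρ² = αρ + β.
  module Root {α β : ℝ} (0≤α : 0# ≤ α) (0<β : 0# < β) {D : ℝ} (D≈ : D ≈ α * α + (β + β + (β + β))) {ρ : ℝ}
      (2ρ≈ : ρ + ρ ≈ α + √ D) where
    private
      4β = β + β + (β + β)
      0<4β : 0# < 4β
      0<4β = +-pos-nonneg (+-pos-nonneg 0<β (<⇒≤ 0<β)) (+-nonneg (<⇒≤ 0<β) (<⇒≤ 0<β))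
      0≤D : 0# ≤ D
      0≤D = ≤-respʳ (≈-sym D≈) (+-nonneg (sq-nonneg α) (<⇒≤ 0<4β))

    -- Four times the equation is (2ρ - α)² = α² + 4β, and 2ρ - α is √ D.
    root : ρ * ρ ≈ α * ρ + β
    root = *-cancelʳ-≈ 0<4 (begin
      ρ * ρ * (1# + 1# + 1# + 1#) ≈⟨ solve 2
          (λ p a → p :* p :* con (+ 4) := (p :+ p :- a) :* (p :+ p :- a) :+
          (a :* p :* con (+ 4) :- a :* a)) ≈-refl ρ α ⟩
      (ρ + ρ - α) * (ρ + ρ - α) + rest ≈⟨ +-congʳ (*-cong √≈ √≈) ⟩
      √ D * √ D + rest ≈⟨ +-congʳ (≈-trans (√-square 0≤D) D≈) ⟩
      α * α + 4β + rest ≈⟨ solve 3 (λ p a b → a :* a :+ (b :+ b :+ (b :+ b)) :+ (a :* p :* con (+ 4) :- a :* a) :=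
          (a :* p :+ b) :* con (+ 4)) ≈-refl ρ α β ⟩
      (α * ρ + β) * (1# + 1# + 1# + 1#) ∎)
      where
      open ≈-Reasoning
      rest = α * ρ * (1# + 1# + 1# + 1#) - α * α
      0<4 : 0# < 1# + 1# + 1# + 1#
      0<4 = +-pos-nonneg (+-pos-nonneg 0<2 (<⇒≤ 0<1)) (<⇒≤ 0<1)
      √≈ : ρ + ρ - α ≈ √ D
      √≈ = ≈-trans (+-congʳ 2ρ≈) (solve 2 (λ a d → a :+ d :- a := d) ≈-refl α (√ D))

    α<√D : α < √ D
    α<√D = [ id , (λ √D≤α → contradiction (≤-trans (*-monoˡ-≤ (√-nonneg 0≤D) √D≤α) (*-monoʳ-≤ 0≤α √D≤α)) λ p → ≤⇒≯
        (≤-respˡ (≈-trans (√-square 0≤D) D≈) p) (<-by 0<4β ≈-refl)) ]′ (<-or-≥ α (√ D))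

    α<ρ : α < ρ
    α<ρ = *-cancelʳ-< (<⇒≤ 0<2) (begin-strict
      α * two ≈⟨ solve 1 (λ a → a :* :2 := a :+ a) ≈-refl α ⟩
      α + α <⟨ +-monoʳ-< α α<√D ⟩
      α + √ D ≈⟨ 2ρ≈ ⟨
      ρ + ρ ≈⟨ solve 1 (λ a → a :+ a := a :* :2) ≈-refl ρ ⟩
      ρ * two ∎)
      where open ≤-Reasoning

-- The extremal hypergraphs

module Classification (R : CompleteOrderedField) where
  open Bounds R public

  argmax : ∀ {n} (f : Fin n → ℝ) → Fin n → ∃[ u ] ∀ v → f v ≤ f u
  argmax {suc zero} f _ = zero , λ { zero → ≤-refl }
  argmax {suc (suc n)} f _ with argmax (f ∘ suc) zero
  ... | u , max = [ (λ f0≤ → suc u , λ { zero → f0≤ ; (suc v) → max v })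
                  , (λ fu≤ → zero , λ { zero → ≤-refl ; (suc v) → ≤-trans (max v) fu≤ }) ]′
                      (≤-total (f zero) (f (suc u)))

  module _ {m} (m≥2 : 2 ℕ.≤ m) where
    λ₁-mono-≤ : ∀ {H H′} (P : PerronVector m H) (P′ : PerronVector m H′) → PerronVector.μ P ≤ PerronVector.μ P′ →
        λ₁ m H ≤ λ₁ m H′
    λ₁-mono-≤ P P′ p = ≤-respˡ (≈-sym (PerronVector.λ₁≈ P))
        (≤-respʳ (≈-sym (PerronVector.λ₁≈ P′)) (*-monoˡ-≤ (<⇒≤ (0<weight m≥2)) p))

    λ₁-mono-< : ∀ {H H′} (P : PerronVector m H) (P′ : PerronVector m H′) → PerronVector.μ P < PerronVector.μ P′ →
        λ₁ m H < λ₁ m H′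
    λ₁-mono-< P P′ p = <-respˡ (≈-sym (PerronVector.λ₁≈ P))
        (<-respʳ (≈-sym (PerronVector.λ₁≈ P′)) (*-monoˡ-< (0<weight m≥2) p))

    UC₁-perron : ∀ {n} (l≥3 : 3 ℕ.≤ suc n) c → PerronVector m (UC₁ m≥2 l≥3 c)
    UC₁-perron l≥3 c = perronVector m≥2 _ (λ {e} {f} → InUC.linear inUC {e} {f}) (InUC.connected inUC)
        (IsPower.fromV (UC₁-isPower l≥3 m≥2 c) (inj₁ (inj₁ zero)))
      where inUC = UC₁-inUC m≥2 l≥3 c

    module Unicyclic {n k} (l≥3 : 3 ℕ.≤ suc n) {U} (inUC : InUC m (suc n) k U) where
      open InUC inUC
      G = proj₁ inPowers
      module E = GraphEnds G (proj₁ (proj₂ inPowers))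
      s = E.end₁
      t = E.end₂
      P : IsPower m U s t
      P = IsPower-≅ (proj₂ (proj₂ inPowers)) (power-isPower m E.isPower)
      open IsPower P

      loose = proj₁ unicyclic
      C : Cycle s t (suc n)
      C = proj₁ (fromLooseCycle P loose)

      -- This is where uniqueness of the loose cycle is used: a detour around e closes to a graph
      -- cycle through e, hence gives a loose cycle through e, whose edges must be those of `C`.
      bridge : ∀ e → NonCycle C e → ¬ Star (Avoid s t e) (s e) (t e)
      bridge e e∉C path = e∉C (proj₁ on-C)
          (trans (proj₂ (fromLooseCycle P loose) _) (trans (cong toE (proj₂ on-C)) (toE∘fromE e)))
        where
        detour = detour⇒cycle s t _≟_ E.isSimple e path
        C′ = toLooseCycle P (proj₁ (proj₂ detour))
        i = proj₁ (proj₂ (proj₂ detour))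
        on-C : ∃[ j ] LooseCycle.e loose j ≡ fromE e
        on-C = Equivalence.from (proj₂ unicyclic (proj₁ C′) (fromE e))
            (i , trans (proj₂ C′ i) (cong fromE (proj₂ (proj₂ (proj₂ detour)))))

      perron-U : PerronVector m U
      perron-U = perronVector m≥2 U (λ {e} {f} → linear {e} {f}) connected (fromV (inj₁ (Cycle.v C zero)))

      -- Only graph vertices compete for the maximum, because only these are replaced by a shift.
      maximum = argmax (λ v → PerronVector.x perron-U (fromV (inj₁ v))) (Cycle.v C zero)
      u = proj₁ maximum
      rooted = shifts-onto-UC excluded-middle s t E.isSimple (connected⇒graphConnected P connected) C bridge u
      c = proj₁ rooted
      S : Shifts s t (end₁ᵁ {n} {c}) end₂ᵁ u
      S = proj₁ (proj₂ rooted)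

      pendants : ℕ
      pendants = c

      size-U : suc n ℕ.+ pendants ≡ k
      size-U = trans (↔⇒≡ (↔-trans +↔⊎ (↔-trans (Shifts.ψ S) (↔-sym edg)))) size≡k

      private
        T-isPower = UC₁-isPower l≥3 m≥2 c

      U-≤ : λ₁ m U ≤ λ₁ m (UC₁ m≥2 l≥3 pendants)
      U-≤ = λ₁-mono-≤ perron-U (UC₁-perron l≥3 c)
          (shifted-≤ P E.isSimple T-isPower (UC-simple l≥3) S perron-U (UC₁-perron l≥3 c) (proj₂ maximum))

      U-≅-or-< : U ≅ UC₁ m≥2 l≥3 pendants ⊎ λ₁ m U < λ₁ m (UC₁ m≥2 l≥3 pendants)
      U-≅-or-< = Sum.map₂ (λ₁-mono-< perron-U (UC₁-perron l≥3 c))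
          (shifted-<-or-≅ P E.isSimple T-isPower (UC-simple l≥3) S perron-U (UC₁-perron l≥3 c) (proj₂ maximum))

    -- No case of isomorphism arises: the edge `e₀`, which is {1 , 2} of the longer cycle, is moved
    -- for every `U`.
    shorter-< : ∀ {n k} (l≥3 : 3 ℕ.≤ suc (suc n)) (l-1≥3 : 3 ℕ.≤ suc n) {U} (inUC : InUC m (suc (suc n)) k U) →
      λ₁ m U < λ₁ m (UC₁ m≥2 l-1≥3 (suc (Unicyclic.pendants l≥3 inUC)))
    shorter-< {n} l≥3 l-1≥3@(s≤s n≥2) inUC = λ₁-mono-< perron-U (UC₁-perron l-1≥3 (suc c))
      (shifted-< P E.isSimple T-isPower T-simple S′ perron-U (UC₁-perron l-1≥3 (suc c)) (proj₂ maximum) e₀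
        (moved P E.isSimple T-isPower T-simple S′ (PerronVector.x perron-U) (proj₂ maximum) e₀
          (subst Replacement (sym (IsPower.toE∘fromE T-isPower (inj₁ zero))) (first-replaced n≥2 S φ0≡u))))
      where
      open Unicyclic l≥3 inUC
      φ0≡u = proj₂ (proj₂ rooted)
      S′ : Shifts s t (end₁ᵁ {n} {suc c}) end₂ᵁ u
      S′ = shortened n≥2 S φ0≡u
      T-isPower = UC₁-isPower l-1≥3 m≥2 (suc c)
      T-simple = UC-simple l-1≥3 {suc c}
      e₀ = IsPower.fromE T-isPower (inj₁ zero)
      Replacement : Fin (suc n) ⊎ Fin (suc c) → Set
      Replacement h = let a = Inverse.to (Shifts.φ S′) (end₁ᵁ h) ; b = Inverse.to (Shifts.φ S′) (end₂ᵁ h) in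
        ∃[ y ] ∃[ p ] p ≢ u × Joins s t (Inverse.to (Shifts.ψ S′) h) y p × ((a ≡ u × b ≡ y) ⊎ (a ≡ y × b ≡ u))

-- Monotonicity in the cycle length and the numerical bounds.

module Main (R : CompleteOrderedField) where
  open Classification R public

  private
    two = 1# + 1#

  ι-+ : ∀ a b → ι (a ℕ.+ b) ≈ ι a + ι b
  ι-+ = Mult.×-homo-+ semiring 1#

  module _ {m k} (m≥2 : 2 ℕ.≤ m) (k≥3 : 3 ℕ.≤ k) where
    private
      UC* : ∀ {l} → 3 ℕ.≤ l → Hypergraph
      UC* {l} l≥3 = UC₁ m≥2 l≥3 (k ∸ l)

      UC*-inUC : ∀ {l} (l≥3 : 3 ℕ.≤ l) → l ℕ.≤ k → InUC m l k (UC* l≥3)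
      UC*-inUC {suc n} l≥3 l≤k = subst (λ k′ → InUC m (suc n) k′ (UC* l≥3)) (ℕ.m+[n∸m]≡n l≤k)
          (UC₁-inUC m≥2 l≥3 (k ∸ suc n))

      pendants≡ : ∀ {n} (l≥3 : 3 ℕ.≤ suc n) {U} (inUC : InUC m (suc n) k U) → Unicyclic.pendants m≥2 l≥3 inUC
          ≡ k ∸ suc n
      pendants≡ {n} l≥3 inUC = trans (sym (ℕ.m+n∸m≡n (suc n) _)) (cong (_∸ suc n) (Unicyclic.size-U m≥2 l≥3 inUC))

    UC*-largest : ∀ {l} (l≥3 : 3 ℕ.≤ l) U → InUC m l k U → λ₁ m U ≤ λ₁ m (UC* l≥3)
    UC*-largest {suc n} l≥3 U inUC = subst (λ c → λ₁ m U ≤ λ₁ m (UC₁ m≥2 l≥3 c)) (pendants≡ l≥3 inUC)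
        (Unicyclic.U-≤ m≥2 l≥3 inUC)

    ≅UC*-or-< : ∀ {l} (l≥3 : 3 ℕ.≤ l) U → InUC m l k U → U ≅ UC* l≥3 ⊎ λ₁ m U < λ₁ m (UC* l≥3)
    ≅UC*-or-< {suc n} l≥3 U inUC = subst (λ c → U ≅ UC₁ m≥2 l≥3 c ⊎ λ₁ m U < λ₁ m (UC₁ m≥2 l≥3 c))
        (pendants≡ l≥3 inUC) (Unicyclic.U-≅-or-< m≥2 l≥3 inUC)

    UC*-maximal : ∀ {l} (l≥3 : 3 ℕ.≤ l) → l ℕ.≤ k → IsMaximal m l k (UC* l≥3)
    UC*-maximal l≥3 l≤k = UC*-inUC l≥3 l≤k , UC*-largest l≥3

    maximal⇒≅UC* : ∀ {l} (l≥3 : 3 ℕ.≤ l) → l ℕ.≤ k → ∀ U → IsMaximal m l k U → U ≅ UC* l≥3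
    maximal⇒≅UC* l≥3 l≤k U (inUC , largest) = [ id , (λ U< → contradiction U< (≤⇒≯ (largest _ (UC*-inUC l≥3 l≤k)))) ]′
        (≅UC*-or-< l≥3 U inUC)

    maximal⇒λ₁≈ : ∀ {l} (l≥3 : 3 ℕ.≤ l) → l ℕ.≤ k → ∀ U → IsMaximal m l k U → λ₁ m U ≈ λ₁ m (UC* l≥3)
    maximal⇒λ₁≈ l≥3 l≤k U (inUC , largest) = ≤-antisym (UC*-largest l≥3 U inUC) (largest _ (UC*-inUC l≥3 l≤k))

    -- The comparison with the shorter cycle is applied to UC_{l+1}(c₁) itself; the cycle edge that
    -- becomes pendant accounts for the additional pendant edge.
    UC*-decreasing : ∀ {l} (l+1≥3 : 3 ℕ.≤ suc l) (l≥3 : 3 ℕ.≤ l) → suc l ℕ.≤ k → λ₁ m (UC* l+1≥3) < λ₁ m (UC* l≥3)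
    UC*-decreasing {suc n} l+1≥3 l≥3 l<k = subst (λ c → λ₁ m (UC* l+1≥3) < λ₁ m (UC₁ m≥2 l≥3 c))
      (trans (cong suc (pendants≡ l+1≥3 inUC)) (sym (ℕ.+-∸-assoc 1 l<k))) (shorter-< m≥2 l+1≥3 l≥3 inUC)
      where inUC = UC*-inUC l+1≥3 l<k

  module _ {m} (m≥2 : 2 ℕ.≤ m) where
    private
      w-1 = ι m - 1#

      unscale : ∀ B → (ι m - 1#) ⁻¹ * (w-1 * B) ≈ B
      unscale B = ≈-trans (≈-sym (*-assoc _ _ _))
          (≈-trans (*-congʳ (≈-trans (*-comm _ _) (⁻¹-inverseʳ (pos⇒≉0 (0<m-1 m≥2))))) (*-identityˡ B))

    module _ {H} (P : PerronVector m H) where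
      open PerronVector P

      ≤-λ₁ : ∀ {B} → w-1 * B ≤ μ → B ≤ λ₁ m H
      ≤-λ₁ {B} p = ≤-respˡ (unscale B) (≤-respʳ (≈-sym λ₁≈) (*-monoˡ-≤ (<⇒≤ (0<weight m≥2)) p))

      <-λ₁ : ∀ {B} → w-1 * B < μ → B < λ₁ m H
      <-λ₁ {B} p = <-respˡ (unscale B) (<-respʳ (≈-sym λ₁≈) (*-monoˡ-< (0<weight m≥2) p))

      λ₁-< : ∀ {B} → μ < w-1 * B → λ₁ m H < B
      λ₁-< {B} p = <-respʳ (unscale B) (<-respˡ (≈-sym λ₁≈) (*-monoˡ-< (0<weight m≥2) p))

    -- For a bound with denominator 2 (m - 1), twice m - 1 times the bound is the numerator α + √ D,
    -- as `Root` requires.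
    double : ∀ {N d} → 0# < d → d ≈ ι 2 * w-1 → w-1 * (N ÷ d) + w-1 * (N ÷ d) ≈ N
    double {N} {d} 0<d d≈ = begin
      w-1 * B + w-1 * B ≈⟨ solve 2 (λ w b → w :* b :+ w :* b := b :* ((:1 :+ (:1 :+ :0)) :* w)) ≈-refl w-1 B ⟩
      B * (ι 2 * w-1) ≈⟨ *-congˡ d≈ ⟨
      B * d ≈⟨ ÷-* 0<d ⟩
      N ∎
      where
      open ≈-Reasoning
      B = N ÷ d

  0<ι2*[m-1] : ∀ {m} (m≥2 : 2 ℕ.≤ m) → 0# < ι 2 * (ι m - 1#)
  0<ι2*[m-1] m≥2 = *-pos (ι-pos 1) (0<m-1 m≥2)

  module _ {m} (m≥2 : 2 ℕ.≤ m) where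
    cycleBound : ℝ
    cycleBound = (ι m - 1# + √ (ι m * ι m + ι 6 * ι m - ι 7)) ÷ (ι 2 * ι m - ι 2)

  cycleBound-≤ : ∀ {m k} (m≥2 : 2 ℕ.≤ m) (k≥3 : 3 ℕ.≤ k) → cycleBound m≥2 ≤ λ₁ m (UC₁ m≥2 k≥3 0)
  cycleBound-≤ {suc (suc r)} {suc n} m≥2@(s≤s (s≤s z≤n)) k≥3 = ≤-λ₁ m≥2 P (cycle-lower m≥2 k≥3 P ρ
      (<-respˡ α≈ (Root.α<ρ 0≤α 0<β D≈ 2ρ≈)) (≈-trans (Root.root 0≤α 0<β D≈ 2ρ≈) (+-cong (*-congʳ α≈) (*-congˡ α≈))))
    where
    M = ι (suc (suc r))
    P = UC₁-perron m≥2 k≥3 0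
    ρ = (M - 1#) * cycleBound m≥2
    α = M - 1#
    β = two * α
    α≈ : α ≈ 1# + ι r
    α≈ = solve 1 (λ r → :1 :+ (:1 :+ r) :- :1 := :1 :+ r) ≈-refl (ι r)
    0<α : 0# < α
    0<α = 0<m-1 m≥2
    0≤α = <⇒≤ 0<α
    0<β : 0# < β
    0<β = *-pos 0<2 0<α
    -- The discriminant of ρ² = (m - 1) ρ + 2 (m - 1): m² + 6m - 7 = (m - 1)² + 8 (m - 1).
    D≈ : M * M + ι 6 * M - ι 7 ≈ α * α + (β + β + (β + β))
    D≈ = solve 1 (λ m → m :* m :+ (:1 :+ (:1 :+ (:1 :+ (:1 :+ (:1 :+ (:1 :+ :0)))))) :* m :-
        (:1 :+ (:1 :+ (:1 :+ (:1 :+ (:1 :+ (:1 :+ (:1 :+ :0)))))))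
      := (m :- :1) :* (m :- :1) :+ (:2 :* (m :- :1) :+ :2 :* (m :- :1) :+
          (:2 :* (m :- :1) :+ :2 :* (m :- :1)))) ≈-refl M
    d≈ : ι 2 * M - ι 2 ≈ ι 2 * α
    d≈ = solve 2 (λ t m → (t :+ (t :+ :0)) :* m :- (t :+ (t :+ :0)) := (t :+ (t :+ :0)) :* (m :- :1)) ≈-refl 1# M
    2ρ≈ : ρ + ρ ≈ α + √ (M * M + ι 6 * M - ι 7)
    2ρ≈ = double m≥2 (<-respʳ (≈-sym d≈) (0<ι2*[m-1] m≥2)) d≈

  module _ {r n c} (m≥2 : 2 ℕ.≤ suc (suc r)) (l≥3 : 3 ℕ.≤ suc n) {Δ : ℝ} (Δ≈ : Δ ≈ ι c + two) where
    private
      M = ι (suc (suc r))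
      M-1 = M - 1#
      M-2 = M - ι 2
      β = Δ * M-1
      P = UC₁-perron m≥2 l≥3 c
      M-1≈ : M-1 ≈ 1# + ι r
      M-1≈ = solve 1 (λ r → :1 :+ (:1 :+ r) :- :1 := :1 :+ r) ≈-refl (ι r)
      M-2≈ : M-2 ≈ ι r
      M-2≈ = solve 1 (λ r → :1 :+ (:1 :+ r) :- (:1 :+ (:1 :+ :0)) := r) ≈-refl (ι r)
      0<β : 0# < β
      0<β = *-pos (<-respʳ (≈-sym Δ≈) (+-nonneg-pos (ι-nonneg c) 0<2)) (0<m-1 m≥2)
      β≈ : β ≈ (ι c + two) * (1# + ι r)
      β≈ = *-cong Δ≈ M-1≈
      D≈ : ∀ α → α * α + ι 4 * Δ * M-1 ≈ α * α + (β + β + (β + β))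
      D≈ α = +-congˡ (solve 2 (λ d w → (:1 :+ (:1 :+ (:1 :+ (:1 :+ :0)))) :* d :* w := d :* w :+ d :* w :+
          (d :* w :+ d :* w)) ≈-refl Δ M-1)

    UC₁-lower : (M-2 + √ (M-2 * M-2 + ι 4 * Δ * M-1)) ÷ (ι 2 * M-1) < λ₁ (suc (suc r)) (UC₁ m≥2 l≥3 c)
    UC₁-lower = <-λ₁ m≥2 P (Lower.lower m≥2 l≥3 c P _ (<-respˡ M-2≈ (Root.α<ρ 0≤α 0<β (D≈ M-2) 2ρ≈))
        (≈-trans (Root.root 0≤α 0<β (D≈ M-2) 2ρ≈) (+-cong (*-congʳ M-2≈) β≈)))
      where
      0≤α : 0# ≤ M-2
      0≤α = ≤-respʳ (≈-sym M-2≈) (ι-nonneg r)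
      2ρ≈ = double m≥2 {M-2 + √ (M-2 * M-2 + ι 4 * Δ * M-1)} (0<ι2*[m-1] m≥2) ≈-refl

    UC₁-upper : λ₁ (suc (suc r)) (UC₁ m≥2 l≥3 c) < (M + √ (M * M + ι 4 * Δ * M-1)) ÷ (ι 2 * M-1)
    UC₁-upper = λ₁-< m≥2 P (Upper.upper m≥2 l≥3 c P _ (Root.α<ρ 0≤α 0<β (D≈ M) 2ρ≈)
        (≈-trans (Root.root 0≤α 0<β (D≈ M) 2ρ≈) (+-congˡ β≈)))
      where
      0≤α : 0# ≤ M
      0≤α = ι-nonneg (suc (suc r))
      2ρ≈ = double m≥2 {M + √ (M * M + ι 4 * Δ * M-1)} (0<ι2*[m-1] m≥2) ≈-refl

  module _ {m k} (m≥2 : 2 ℕ.≤ m) (k≥3 : 3 ℕ.≤ k) where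
    -- Induction on k - l. The bound depends on m alone; it holds for the cycle of length k, and
    -- every shortening of the cycle strictly increases the spectral radius.
    cycleBound-bounds : ∀ c {l} (l≥3 : 3 ℕ.≤ l) → l ℕ.+ c ≡ k →
      cycleBound m≥2 ≤ λ₁ m (UC₁ m≥2 l≥3 (k ∸ l)) × (l ≢ k → cycleBound m≥2 < λ₁ m (UC₁ m≥2 l≥3 (k ∸ l)))
    cycleBound-bounds zero {l} l≥3 eq =
      subst (λ c → cycleBound m≥2 ≤ λ₁ m (UC₁ m≥2 l≥3 c)) (sym (trans (cong (_∸ l) (sym eq)) (ℕ.m+n∸m≡n l 0)))
          (cycleBound-≤ m≥2 l≥3) ,
      λ l≢k → contradiction (trans (sym (ℕ.+-identityʳ l)) eq) l≢k
    cycleBound-bounds (suc c) {l} l≥3 eq = <⇒≤ strictly , λ _ → strictly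
      where
      eq′ : suc l ℕ.+ c ≡ k
      eq′ = trans (sym (ℕ.+-suc l c)) eq
      strictly : cycleBound m≥2 < λ₁ m (UC₁ m≥2 l≥3 (k ∸ l))
      strictly = ≤-<-trans (proj₁ (cycleBound-bounds c (ℕ.m≤n⇒m≤1+n l≥3) eq′))
        (UC*-decreasing m≥2 k≥3 (ℕ.m≤n⇒m≤1+n l≥3) l≥3 (ℕ.≤-trans (ℕ.m≤m+n (suc l) c) (ℕ.≤-reflexive eq′)))

    part-i : ∀ {l} (l≥3 : 3 ℕ.≤ l) → l ℕ.≤ k →
          IsMaximal m l k (UC₁ m≥2 l≥3 (k ∸ l))
        × (∀ UC* → IsMaximal m l k UC* → UC* ≅ UC₁ m≥2 l≥3 (k ∸ l))
        × (∀ U → InUC m l k U → ¬ (U ≅ UC₁ m≥2 l≥3 (k ∸ l)) →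
             λ₁ m U < λ₁ m (UC₁ m≥2 l≥3 (k ∸ l)))
    part-i l≥3 l≤k = UC*-maximal m≥2 k≥3 l≥3 l≤k , maximal⇒≅UC* m≥2 k≥3 l≥3 l≤k
      , λ U inUC U≇ → [ (λ U≅ → contradiction U≅ U≇) , id ]′ (≅UC*-or-< m≥2 k≥3 l≥3 U inUC)

    part-ii-bound : ∀ {l} → 3 ℕ.≤ l → l ℕ.≤ k → ∀ UC* → IsMaximal m l k UC* →
      cycleBound m≥2 ≤ λ₁ m UC* × (cycleBound m≥2 ≈ λ₁ m UC* → UC* ≅ C_L m k≥3)
    part-ii-bound {l} l≥3 l≤k U max = ≤-respʳ (≈-sym λ≈) (proj₁ bounds) , λ eq → equality eq (l ℕ.≟ k)
      where
      bounds = cycleBound-bounds (k ∸ l) l≥3 (ℕ.m+[n∸m]≡n l≤k)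
      λ≈ = maximal⇒λ₁≈ m≥2 k≥3 l≥3 l≤k U max
      equality : cycleBound m≥2 ≈ λ₁ m U → Dec (l ≡ k) → U ≅ C_L m k≥3
      equality eq (no l≢k) = contradiction (proj₂ bounds l≢k) (≤⇒≯ (inj₂ (≈-sym (≈-trans eq λ≈))))
      equality eq (yes refl) = subst (λ p → U ≅ C_L m p) (ℕ.≤-irrelevant l≥3 k≥3)
        (subst (λ c → U ≅ UC₁ m≥2 l≥3 c) (ℕ.n∸n≡0 k) (maximal⇒≅UC* m≥2 k≥3 l≥3 l≤k U max))

    part-ii-strict : ∀ {l} → 4 ℕ.≤ l → l ℕ.≤ k → ∀ UC* UC*′ → IsMaximal m l k UC* → IsMaximal m (l ∸ 1) k UC*′ →
        λ₁ m UC* < λ₁ m UC*′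
    part-ii-strict {suc l} (s≤s l≥3) l<k U U′ max max′ = <-respˡ (≈-sym (maximal⇒λ₁≈ m≥2 k≥3 l+1≥3 l<k U max))
      (<-respʳ (≈-sym (maximal⇒λ₁≈ m≥2 k≥3 l≥3 (ℕ.<⇒≤ l<k) U′ max′)) (UC*-decreasing m≥2 k≥3 l+1≥3 l≥3 l<k))
      where l+1≥3 = ℕ.m≤n⇒m≤1+n l≥3

  -- In the statement k - l is a difference of real numbers, whereas the number of pendant edges is
  -- a truncated subtraction; they agree because l ≤ k.
  Δ-≈ : ∀ {k l} → l ℕ.≤ k → ι k - ι l + ι 2 ≈ ι (k ∸ l) + two
  Δ-≈ {k} {l} l≤k = ≈-trans (+-congʳ
      (+-congʳ (≈-trans (≈-reflexive (cong ι (sym (ℕ.m+[n∸m]≡n l≤k)))) (ι-+ l (k ∸ l)))))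
    (solve 2 (λ a b → a :+ b :- a :+ (:1 :+ (:1 :+ :0)) := b :+ :2) ≈-refl (ι l) (ι (k ∸ l)))

theorem3p1p1 :
    (R : CompleteOrderedField) →
    let open CompleteOrderedField R
        open Spectral R
    in
    ∀ {m k : ℕ} (m≥2 : 2 ℕ.≤ m) (k≥3 : 3 ℕ.≤ k) →
    -- (i)
      (∀ {l} (l≥3 : 3 ℕ.≤ l) → l ℕ.≤ k →
          IsMaximal m l k (UC₁ m≥2 l≥3 (k ∸ l))
        × (∀ UC* → IsMaximal m l k UC* → UC* ≅ UC₁ m≥2 l≥3 (k ∸ l))
        × (∀ U → InUC m l k U → ¬ (U ≅ UC₁ m≥2 l≥3 (k ∸ l)) →
             λ₁ m U < λ₁ m (UC₁ m≥2 l≥3 (k ∸ l))))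
    -- (ii)
    × (let bound = (ι m - 1# + √ (ι m * ι m + ι 6 * ι m - ι 7)) ÷ (ι 2 * ι m - ι 2) in
       ∀ {l} → 3 ℕ.≤ l → l ℕ.≤ k → ∀ UC* → IsMaximal m l k UC* →
          bound ≤ λ₁ m UC*
        × (bound ≈ λ₁ m UC* → UC* ≅ C_L m k≥3))
    × (∀ {l} → 4 ℕ.≤ l → l ℕ.≤ k →
       ∀ UC* UC*′ → IsMaximal m l k UC* → IsMaximal m (l ∸ 1) k UC*′ →
         λ₁ m UC* < λ₁ m UC*′)
    -- (iii)
    × (∀ {l} (l≥3 : 3 ℕ.≤ l) → l ℕ.≤ k →
       let Δ = ι k - ι l + ι 2
           m-1 = ι m - 1#
           m-2 = ι m - ι 2
       in
          (m-2 + √ (m-2 * m-2 + ι 4 * Δ * m-1)) ÷ (ι 2 * m-1)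
            < λ₁ m (UC₁ m≥2 l≥3 (k ∸ l))
        × λ₁ m (UC₁ m≥2 l≥3 (k ∸ l))
            < (ι m + √ (ι m * ι m + ι 4 * Δ * m-1)) ÷ (ι 2 * m-1))
theorem3p1p1 R {m} {k} m≥2 k≥3 = part-i m≥2 k≥3 , part-ii-bound m≥2 k≥3 , part-ii-strict m≥2 k≥3 , part-iii m≥2
  where
  open Main R
  part-iii : ∀ {m} (m≥2 : 2 ℕ.≤ m) {l} (l≥3 : 3 ℕ.≤ l) → l ℕ.≤ k →
       let Δ = ι k - ι l + ι 2
           m-1 = ι m - 1#
           m-2 = ι m - ι 2
       in
          (m-2 + √ (m-2 * m-2 + ι 4 * Δ * m-1)) ÷ (ι 2 * m-1)
            < λ₁ m (UC₁ m≥2 l≥3 (k ∸ l))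
        × λ₁ m (UC₁ m≥2 l≥3 (k ∸ l))
            < (ι m + √ (ι m * ι m + ι 4 * Δ * m-1)) ÷ (ι 2 * m-1)
  -- Matching exhibits m as r + 2 and l as n + 1, the form in which the two bounds are proved.
  part-iii m≥2@(s≤s (s≤s z≤n)) {suc n} l≥3 l≤k = UC₁-lower {c = k ∸ suc n} m≥2 l≥3 (Δ-≈ l≤k) , UC₁-upper {c = k ∸ suc n} m≥2 l≥3 (Δ-≈ l≤k)
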